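{- Consider any instance of the Colored Knapsack Problem (ColKP) with $w_i\le b$ and $-p_{\max}<p_i\le p_{\max}$ for all items $i\in\mathcal I$, where $p_{\max}=\max\{p_i:i\in\mathcal I\}>0$. For every $\varepsilon\in(0,1)$, the color-by-color scaling algorithm (Algorithm F2 described in the context) returns a feasible ColKP solution of value at least $(1-\varepsilon)\,\mathrm{OPT}$.
   Context: ColKP instance: items $\mathcal I=\{1,\dots,n\}$, capacity $b\in\mathbb Z_{>0}$, colors $\mathcal C=\{1,\dots,m\}$; each item $i$ has weight $w_i\in\mathbb Z_{>0}$, profit $p_i\in\mathbb Z$ and color $\kappa_i\in\mathcal C$. For $S\subseteq\mathcal I$: $w(S)=\sum_{i\in S}w_i$, $p(S)=\sum_{i\in S}p_i$, $\mathcal I_c=\{i\in\mathcal I:\kappa_i=c\}$, $k_c(S)=|S\cap\mathcal I_c|$, $d(S)=\max_{c\in\mathcal C}k_c(S)$. A color $c$ is dominant in $S$ if $k_c(S)=d(S)$. $S$ is color-feasible if $2d(S)\le|S|+1$, and feasible if moreover $w(S)\le b$. $\mathrm{OPT}=\max\{p(S):S\subseteq\mathcal I\text{ feasible}\}$. Algorithm LP-Round: (1) compute an optimal basic solution $x^*$ (an optimal extreme point) of the linear program: maximize $\sum_{i}p_ix_i$ subject to $\sum_{i}w_ix_i\le b$, $\sum_{i\in\mathcal I_c}x_i-\sum_{i\in\mathcal I\setminus\mathcal I_c}x_i\le1$ for all $c\in\mathcal C$, $x_i\in[0,1]$ for all $i$; (2) set $S_0=\{i:x_i^*=1\}$; (3)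 if $S_0$ is not color-feasible, let $c$ be its unique dominant color and remove from $S_0$ an item of $S_0\cap\mathcal I_c$ of minimum profit; (4) return the more profitable of $S_0$ and $\{r\}$, where $r$ is an item with $p_r=p_{\max}$. Algorithm F2 (input: the instance and $\varepsilon$): (1) Run LP-Round, let $\mathrm{LB}$ be the profit of the set it returns, and let $\mathrm{UB}=3\,\mathrm{LB}$. (2) Set $\lambda=\varepsilon\,\mathrm{LB}/n$ and $\hat p_i=\lfloor p_i/\lambda\rfloor$ for all $i$. (3) If all $p_i\ge0$, set $z_{\min}=0$, $z_{\max}=\lceil\mathrm{UB}/\lambda\rceil$; otherwise set $z_{\min}=\lfloor -n\,p_{\max}/\lambda\rfloor$, $z_{\max}=\lceil(\mathrm{UB}+n\,p_{\max})/\lambda\rceil$. Let $\mathcal Z=\{z_{\min},z_{\min}+1,\dots,z_{\max}\}$. (4) Inner programs: for each color $c$, compute a table $h_c(k,\zeta)$, $k\in\{0,\dots,|\mathcal I_c|\}$, $\zeta\in\mathcal Z$, by the usual item-by-item knapsack recursion with a cardinality counter: start with $h_c(0,0)=0$ and all other entries $+\infty$, and process the items $i\in\mathcal I_c$ one at a time, each time either not packing $i$ (leaving $(k,\zeta)$ and the weight unchanged) or packing it (moving from $(k,\zeta)$ to $(k+1,\zeta+\hat p_i)$ and adding $w_i$ to the weight), keeping the minimum weight for each pair; a transition is performed only if the resulting profit level lies in $\mathcal Z$ and the resulting weight is at most $b$. Let $\mathcal S_c=\{(k,\zeta):h_c(k,\zeta)<+\infty\}$ for the final table. (5) Outer program: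 set $g(0,0,0,0)=0$ and all other entries $g(c,t,d,z)=+\infty$, for $c\in\{0,\dots,m\}$, $t,d\in\{0,\dots,n\}$, $z\in\mathcal Z$. For $c=1,\dots,m$, for all $(t,d,z)$ with $g(c-1,t,d,z)<+\infty$ and all $(k,\zeta)\in\mathcal S_c$, set $g(c,t+k,\max\{d,k\},z+\zeta)\leftarrow\min\{g(c,t+k,\max\{d,k\},z+\zeta),\,g(c-1,t,d,z)+h_c(k,\zeta)\}$, performed only if $z+\zeta\in\mathcal Z$ and $g(c-1,t,d,z)+h_c(k,\zeta)\le b$. (6) Among all terminal entries with $g(m,t,d,z)\le b$ and $2d\le t+1$, choose one with maximum $z$, and return the set recovered by backtracking through the outer and inner transitions.
   Formalization: The parameter ε ranges over the rational numbers in (0,1) instead of all real numbers, and the linear program in LP-Round is solved over the rationals. -}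

module Defs where

open import Data.Bool.Base using (if_then_else_; _∧_)
open import Data.Fin.Base using (Fin)
open import Data.Fin.Properties using (all?) renaming (_≟_ to _≟ᶠ_)
open import Data.Fin.Subset using (Subset; ⊥; ⁅_⁆; _∈_; _∩_; _∪_; _-_; ∁; ∣_∣)
open import Data.Integer.Base as ℤ using (ℤ; 0ℤ; +_)
import Data.Integer.Properties as ℤₚ
open import Data.List.Base using (List; []; _∷_; allFin; cartesianProduct; filter; foldr; map; reverse; upTo)
open import Data.Maybe.Base using (Maybe; just; nothing; zipWith)
open import Data.Nat.Base as ℕ using (ℕ; zero; suc; _⊔_; _⊓_)
import Data.Nat.Properties as ℕₚ
open import Data.Product.Base using (∃-syntax; _×_; _,_)
open import Data.Product.Properties using (≡-dec)
open import Data.Rational.Base as ℚ using (ℚ; 0ℚ; 1ℚ; floor; ceiling)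
import Data.Rational.Properties as ℚₚ
open import Data.Sum.Base using (_⊎_)
open import Data.Vec.Base using (lookup; tabulate)
import Data.Vec.Functional as Vector
open import Relation.Binary.PropositionalEquality using (_≡_)
open import Relation.Nullary.Decidable using (Dec; yes; no; does)
open import Relation.Nullary.Negation using (¬_)

open import Algebra.Properties.Monoid.Sum ℕₚ.+-0-monoid using () renaming (sum to ∑ℕ)
open import Algebra.Properties.Monoid.Sum ℤₚ.+-0-monoid using () renaming (sum to ∑ℤ)
open import Algebra.Properties.Monoid.Sum ℚₚ.+-0-monoid using () renaming (sum to ∑ℚ)

infixl 7 _÷₀_

fromℤ : ℤ → ℚ
fromℤ i = i ℚ./ 1

fromℕ : ℕ → ℚ
fromℕ k = fromℤ (+ k)

-- Division made total by  x ÷₀ 0 = 0 .  The algorithm only divides by n and by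
-- ε·LB/n, both of which are positive under the hypotheses of the theorem.
_÷₀_ : ℚ → ℚ → ℚ
x ÷₀ y with y ℚₚ.≟ 0ℚ
... | yes _   = 0ℚ
... | no  y≢0 = ℚ._÷_ x y {{ℚ.≢-nonZero y≢0}}

-- Summing  restrict 0 S f  over all items gives the sum of f over S.
restrict : ∀ {A : Set} {n} → A → Subset n → (Fin n → A) → Fin n → A
restrict o S f i = if lookup S i then f i else o

-- The value 0 for the empty family is never used: the theorem assumes a
-- positive maximum profit.
maximum : ∀ {n} → (Fin n → ℤ) → ℤ
maximum {zero}        f = 0ℤ
maximum {suc zero}    f = f Fin.zero
maximum {suc (suc n)} f = f Fin.zero ℤ.⊔ maximum (λ i → f (Fin.suc i))

record Instance (n m : ℕ) : Set where
  field
    b   : ℕ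
    b>0 : 0 ℕ.< b
    w   : Fin n → ℕ
    w>0 : ∀ i → 0 ℕ.< w i
    p   : Fin n → ℤ
    κ   : Fin n → Fin m

module Solutions {n m : ℕ} (I : Instance n m) where
  open Instance I

  pmax : ℤ
  pmax = maximum p

  weight : Subset n → ℕ
  weight S = ∑ℕ (restrict 0 S w)

  profit : Subset n → ℤ
  profit S = ∑ℤ (restrict 0ℤ S p)

  class : Fin m → Subset n
  class c = tabulate λ i → does (κ i ≟ᶠ c)

  count : Fin m → Subset n → ℕ
  count c S = ∣ S ∩ class c ∣

  maxCount : Subset n → ℕ
  maxCount S = Vector.foldr _⊔_ 0 λ c → count c S

  Dominant : Fin m → Subset n → Set
  Dominant c S = count c S ≡ maxCount S

  ColorFeasible : Subset n → Set
  ColorFeasible S = 2 ℕ.* maxCount S ℕ.≤ ∣ S ∣ ℕ.+ 1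

  Feasible : Subset n → Set
  Feasible S = ColorFeasible S × weight S ℕ.≤ b

  IsOPT : ℤ → Set
  IsOPT v = (∃[ S ] Feasible S × profit S ≡ v)
          × (∀ S → Feasible S → profit S ℤ.≤ v)

module LinearProgram {n m : ℕ} (I : Instance n m) where
  open Instance I
  open Solutions I

  Point : Set
  Point = Fin n → ℚ

  sumOver : Subset n → Point → ℚ
  sumOver S x = ∑ℚ (restrict 0ℚ S x)

  objective : Point → ℚ
  objective x = ∑ℚ λ i → fromℤ (p i) ℚ.* x i

  record FeasiblePoint (x : Point) : Set where
    field
      capacity : ∑ℚ (λ i → fromℕ (w i) ℚ.* x i) ℚ.≤ fromℕ b
      color    : ∀ c → sumOver (class c) x ℚ.- sumOver (∁ (class c)) x ℚ.≤ 1ℚ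
      lower    : ∀ i → 0ℚ ℚ.≤ x i
      upper    : ∀ i → x i ℚ.≤ 1ℚ

  record OptimalExtremePoint (x : Point) : Set where
    field
      feasible : FeasiblePoint x
      optimal  : ∀ y → FeasiblePoint y → objective y ℚ.≤ objective x
      extreme  : ∀ y z θ → FeasiblePoint y → FeasiblePoint z → 0ℚ ℚ.< θ → θ ℚ.< 1ℚ →
                 (∀ i → x i ≡ θ ℚ.* y i ℚ.+ (1ℚ ℚ.- θ) ℚ.* z i) →
                 ∀ i → y i ≡ z i

  ones : Point → Subset n
  ones x = tabulate λ i → does (x i ℚₚ.≟ 1ℚ)

  -- A color-infeasible set has exactly one dominant color, so quantifying over
  -- any dominant c is the same as taking the unique one.
  data Repair (S : Subset n) : Subset n → Set where
    keep   : ColorFeasible S → Repair S S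
    remove : ∀ c j → ¬ ColorFeasible S → Dominant c S → j ∈ S ∩ class c →
             (∀ i → i ∈ S ∩ class c → p j ℤ.≤ p i) → Repair S (S - j)

  -- LPRound S : some execution returns S; the choices of the optimal extreme
  -- point and all ties are left open.
  record LPRound (S : Subset n) : Set where
    field
      x         : Point
      x-optimal : OptimalExtremePoint x
      S₀        : Subset n
      repair    : Repair (ones x) S₀
      r         : Fin n
      r-max     : p r ≡ pmax
      choice    : (S ≡ S₀    × profit ⁅ r ⁆ ℤ.≤ profit S₀)
                ⊎ (S ≡ ⁅ r ⁆ × profit S₀ ℤ.≤ profit ⁅ r ⁆)

-- ℕ∞ is ℕ with +∞ = nothing.
ℕ∞ : Set
ℕ∞ = Maybe ℕ

_+∞_ : ℕ∞ → ℕ∞ → ℕ∞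
_+∞_ = zipWith ℕ._+_

_⊓∞_ : ℕ∞ → ℕ∞ → ℕ∞
nothing ⊓∞ v       = v
just u  ⊓∞ nothing = just u
just u  ⊓∞ just v  = just (u ⊓ v)

minimum∞ : List ℕ∞ → ℕ∞
minimum∞ = foldr _⊓∞_ nothing

module DynamicProgram {n m : ℕ} (I : Instance n m) (ε : ℚ) (LB : ℤ) where
  open Instance I
  open Solutions I

  UB : ℤ
  UB = + 3 ℤ.* LB

  -- The scaling factor λ (a reserved symbol in Agda).
  scale : ℚ
  scale = (ε ℚ.* fromℤ LB) ÷₀ fromℕ n

  p̂ : Fin n → ℤ
  p̂ i = floor (fromℤ (p i) ÷₀ scale)

  nonNegative? : Dec (∀ i → 0ℤ ℤ.≤ p i)
  nonNegative? = all? λ i → 0ℤ ℤₚ.≤? p i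

  zmin : ℤ
  zmin = if does nonNegative?
         then 0ℤ
         else floor (fromℤ (ℤ.- (+ n ℤ.* pmax)) ÷₀ scale)

  zmax : ℤ
  zmax = if does nonNegative?
         then ceiling (fromℤ UB ÷₀ scale)
         else ceiling (fromℤ (UB ℤ.+ + n ℤ.* pmax) ÷₀ scale)

  -- The value v of a transition into profit level z, or +∞ if the transition is
  -- not performed (z outside {zmin,…,zmax}, or v above the capacity).
  admit : ℤ → ℕ∞ → ℕ∞
  admit z nothing  = nothing
  admit z (just u) =
    if does (zmin ℤₚ.≤? z) ∧ does (z ℤₚ.≤? zmax) ∧ does (u ℕₚ.≤? b)
    then just u
    else nothing

  -- Both recursions run along a list of the items (colors) processed so far,
  -- the latest one at the head. Each new entry is written as the minimum over
  -- the transitions that enter it.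

  packed : Fin n → (ℕ → ℤ → ℕ∞) → ℕ → ℤ → ℕ∞
  packed i h zero    ζ = nothing
  packed i h (suc k) ζ = admit ζ (h k (ζ ℤ.- p̂ i) +∞ just (w i))

  inner : List (Fin n) → ℕ → ℤ → ℕ∞
  inner []       k ζ = if does (k ℕₚ.≟ 0) ∧ does (ζ ℤₚ.≟ 0ℤ) then just 0 else nothing
  inner (i ∷ is) k ζ = inner is k ζ ⊓∞ packed i (inner is) k ζ

  items : Fin m → List (Fin n)
  items c = reverse (filter (λ i → κ i ≟ᶠ c) (allFin n))

  h : Fin m → ℕ → ℤ → ℕ∞
  h c = inner (items c)

  -- (t , d , z) : number of items, largest color count, profit level.
  State : Set
  State = ℕ × ℕ × ℤ

  _≟ˢ_ : (s s′ : State) → Dec (s ≡ s′)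
  _≟ˢ_ = ≡-dec ℕₚ._≟_ (≡-dec ℕₚ._≟_ ℤₚ._≟_)

  _▷_ : State → ℕ × ℤ → State
  (t , d , z) ▷ (k , ζ) = t ℕ.+ k , d ⊔ k , z ℤ.+ ζ

  -- {zmin,…,zmax}, given zmin ≤ zmax.
  levels : List ℤ
  levels = map (λ j → zmin ℤ.+ + j) (upTo (suc ℤ.∣ zmax ℤ.- zmin ∣))

  states : List State
  states = cartesianProduct (upTo (suc n)) (cartesianProduct (upTo (suc n)) levels)

  -- Pairs outside 𝒮_c are harmless here: their h-value +∞ gives no transition.
  pairs : Fin m → List (ℕ × ℤ)
  pairs c = cartesianProduct (upTo (suc ∣ class c ∣)) levels

  transition : Fin m → (State → ℕ∞) → State → ℕ × ℤ → ℕ∞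
  transition c g s@(_ , _ , z) (k , ζ) = admit (z ℤ.+ ζ) (g s +∞ h c k ζ)

  enter : Fin m → (State → ℕ∞) → State → State × (ℕ × ℤ) → ℕ∞
  enter c g s′ (s , q) = if does ((s ▷ q) ≟ˢ s′) then transition c g s q else nothing

  outer : List (Fin m) → State → ℕ∞
  outer []       s  = if does (s ≟ˢ (0 , 0 , 0ℤ)) then just 0 else nothing
  outer (c ∷ cs) s′ =
    minimum∞ (map (enter c (outer cs) s′) (cartesianProduct states (pairs c)))

  -- Backtracking: S is recovered from an entry by repeatedly choosing a
  -- transition that attains the stored value.

  data InnerTrace : List (Fin n) → ℕ → ℤ → Subset n → Set where
    start : InnerTrace [] 0 0ℤ ⊥
    skip  : ∀ {i is k ζ S} →
            inner (i ∷ is) k ζ ≡ inner is k ζ →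
            InnerTrace is k ζ S →
            InnerTrace (i ∷ is) k ζ S
    pack  : ∀ {i is k ζ S} →
            inner (i ∷ is) (suc k) ζ ≡ packed i (inner is) (suc k) ζ →
            InnerTrace is k (ζ ℤ.- p̂ i) S →
            InnerTrace (i ∷ is) (suc k) ζ (⁅ i ⁆ ∪ S)

  data OuterTrace : List (Fin m) → State → Subset n → Set where
    start : OuterTrace [] (0 , 0 , 0ℤ) ⊥
    step  : ∀ {c cs s′ S T} s k ζ →
            s′ ≡ s ▷ (k , ζ) →
            outer (c ∷ cs) s′ ≡ transition c (outer cs) s (k , ζ) →
            InnerTrace (items c) k ζ T →
            OuterTrace cs s S →
            OuterTrace (c ∷ cs) s′ (T ∪ S)

  colors : List (Fin m)
  colors = reverse (allFin m)

  Terminal : State → Set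
  Terminal s@(t , d , z) =
    (∃[ u ] outer colors s ≡ just u × u ℕ.≤ b) × 2 ℕ.* d ℕ.≤ t ℕ.+ 1

  record Output (S : Subset n) : Set where
    field
      t d      : ℕ
      z        : ℤ
      terminal : Terminal (t , d , z)
      maximal  : ∀ t′ d′ z′ → Terminal (t′ , d′ , z′) → z′ ℤ.≤ z
      trace    : OuterTrace colors (t , d , z) S

-- F2 I ε S : some execution of the algorithm on input (I , ε) returns S.
record F2 {n m : ℕ} (I : Instance n m) (ε : ℚ) (S : Subset n) : Set where
  field
    S₁      : Subset n
    lpRound : LinearProgram.LPRound I S₁
    output  : DynamicProgram.Output I ε (Solutions.profit I S₁) S

-- At most one colour constraint of the linear program can be tight, since the
-- sum of two colour functionals is nonpositive. Hence an optimal extreme point x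
-- has at most two fractional items: along three of them some direction keeps
-- the capacity and the tight colour constraint. If rounding x down violates the
-- constraint of colour c, that constraint is tight at x and the two fractional
-- items have other colours, so their values add up to at most 1 and removing one
-- item of colour c repairs the set. Either way the LP value is at most
-- p(S₀) + 2 pmax, so OPT ≤ 3 LB. An optimal extreme point exists over ℚ because
-- Fourier–Motzkin elimination yields a lexicographic maximum of
-- (objective, x), which is optimal and extreme.
--
-- With λ = ε LB / n ≤ pmax every partial packing of an optimal set T has its
-- rounded profit in {zmin,…,zmax}, so the dynamic program reaches the terminal
-- state of T and returns a set S with p̂(S) ≥ p̂(T). Rounding loses at most λ per
-- item, hence p(S) ≥ λ p̂(S) ≥ λ p̂(T) ≥ OPT - n λ = OPT - ε LB ≥ (1 - ε) OPT.

{-# OPTIONS --safe #-}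
module Submission where

open import Defs
open import Data.Bool.Base using (Bool; true; false; if_then_else_; _∧_; _∨_)
open import Data.Empty using (⊥-elim)
open import Data.Fin.Base using (Fin; zero; suc)
import Data.Fin.Properties as Finₚ
open import Data.Fin.Subset using (Subset; ⁅_⁆; _∩_; _∪_; _-_; ∁; ∣_∣; _⊆_) renaming (_∈_ to _∈ˢ_; _∉_ to _∉ˢ_; ⊥ to ∅)
import Data.Fin.Subset.Properties as Sₚ
open import Data.Integer.Base as ℤ using (ℤ; 0ℤ; +_)
import Data.Integer.DivMod as ℤ
import Data.Integer.Properties as ℤₚ
open import Data.List.Base as List using (List; []; _∷_; _++_; filter; cartesianProductWith; allFin; reverse)
open import Data.List.Membership.Propositional using (_∈_)
open import Data.List.Membership.Propositional.Properties
open import Data.List.Relation.Unary.Any using (here; there)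
open import Data.Maybe.Base using (Maybe; just; nothing)
open import Data.Maybe.Properties using (just-injective)
open import Data.Nat.Base as ℕ using (ℕ; zero; suc)
import Data.Nat.Properties as ℕₚ
open import Data.Product.Base using (∃-syntax; _×_; _,_; proj₁; proj₂)
open import Data.Rational.Base as ℚ using (ℚ; 0ℚ; 1ℚ; floor; ceiling; toℚᵘ)
import Data.Rational.Properties as ℚₚ
open import Data.Rational.Solver using (module +-*-Solver)
import Data.Rational.Unnormalised.Base as ℚᵘ
import Data.Rational.Unnormalised.Properties as ℚᵘₚ
open import Data.Sum.Base using (_⊎_; inj₁; inj₂)
open import Data.Vec.Base using (lookup; []; _∷_)
import Data.Vec.Base as Vec
import Data.Vec.Properties as Vecₚ
import Data.Vec.Functional as Vector
import Data.List.Relation.Unary.All as All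
import Data.List.Relation.Unary.Any.Properties as Anyₚ
open import Data.List.Relation.Unary.AllPairs using ([]; _∷_)
open import Data.List.Relation.Unary.Unique.Propositional using (Unique)
import Data.List.Relation.Unary.Unique.Propositional.Properties as Uniqueₚ
import Data.List.Relation.Binary.Permutation.Setoid as Perm
import Data.List.Relation.Binary.Permutation.Setoid.Properties as Permₚ
open import Function.Base using (_∘_)
open import Relation.Binary.Definitions using (Total; Transitive; tri<; tri≈; tri>)
open import Relation.Binary.PropositionalEquality
open import Relation.Nullary.Decidable as Dec using (Dec; yes; no; does; dec-true; ¬?; _×-dec_)
open import Relation.Nullary.Negation using (¬_; contradiction)

open import Algebra.Bundles using (CommutativeRing)
open import Algebra.Structures using (IsCommutativeMonoid)
open import Algebra.Properties.Monoid.Sum ℕₚ.+-0-monoid using () renaming (sum to ∑ℕ)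
open import Algebra.Properties.Monoid.Sum ℤₚ.+-0-monoid using () renaming (sum to ∑ℤ)
open import Algebra.Properties.Monoid.Sum ℚₚ.+-0-monoid using () renaming (sum to ∑ℚ; sum-cong-≗ to ∑ℚ-cong)
open import Algebra.Properties.CommutativeMonoid.Sum ℚₚ.+-0-commutativeMonoid using () renaming (∑-distrib-+ to ∑ℚ-distrib-+)
open import Algebra.Properties.Semiring.Sum (CommutativeRing.semiring ℚₚ.+-*-commutativeRing) using () renaming (*-distribˡ-sum to *-distribˡ-∑ℚ)

open +-*-Solver using (solve; _:=_; _:+_; _:*_; :-_; _:-_; con)

-- The statement speaks of every execution: the extreme point, all ties and all backtracking choices
-- are arbitrary, so the bounds may use only the conditions recorded in `LPRound` and `Output`. That
-- some execution exists is a separate claim, and the elimination theory for linear programs serves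
-- this claim alone. Profit, weight and colour surplus of a set become scalar products with its
-- characteristic vector, so sets and points of the relaxation obey the same lemmas. The delicate
-- point of the dynamic program is the window of profit levels: a transition that leaves it is
-- dropped, and with negative profits a partial sum need not lie between 0 and the final profit. The
-- inner programs run through parts of one colour class and the outer program through unions of
-- classes, so the window is shown to contain the level of every subset of the set being traced. The
-- lower end rests on the nonnegative profit of the whole set and on `pmax` as a bound on single
-- profits, the upper end on UB and on the lower bound -`pmax` for single profits.

0≤+ : ∀ {x y} → 0ℚ ℚ.≤ x → 0ℚ ℚ.≤ y → 0ℚ ℚ.≤ x ℚ.+ y
0≤+ {x} {y} p q = ℚₚ.nonNegative⁻¹ (x ℚ.+ y) {{ℚₚ.nonNeg+nonNeg⇒nonNeg x {{ℚ.nonNegative p}} y {{ℚ.nonNegative q}}}}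

0<+ : ∀ {x y} → 0ℚ ℚ.< x → 0ℚ ℚ.≤ y → 0ℚ ℚ.< x ℚ.+ y
0<+ {x} {y} p q = ℚₚ.positive⁻¹ (x ℚ.+ y) {{ℚₚ.pos+nonNeg⇒pos x {{ℚ.positive p}} y {{ℚ.nonNegative q}}}}

0≤* : ∀ {x y} → 0ℚ ℚ.≤ x → 0ℚ ℚ.≤ y → 0ℚ ℚ.≤ x ℚ.* y
0≤* {x} {y} p q = ℚₚ.nonNegative⁻¹ (x ℚ.* y) {{ℚₚ.nonNeg*nonNeg⇒nonNeg x {{ℚ.nonNegative p}} y {{ℚ.nonNegative q}}}}

0<* : ∀ {x y} → 0ℚ ℚ.< x → 0ℚ ℚ.< y → 0ℚ ℚ.< x ℚ.* y
0<* {x} {y} p q = ℚₚ.positive⁻¹ (x ℚ.* y) {{ℚₚ.pos*pos⇒pos x {{ℚ.positive p}} y {{ℚ.positive q}}}}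

0≤1 : 0ℚ ℚ.≤ 1ℚ
0≤1 = ℚ.*≤* (ℤ.+≤+ ℕ.z≤n)

0<1 : 0ℚ ℚ.< 1ℚ
0<1 = ℚ.*<* (ℤ.+<+ (ℕ.s≤s ℕ.z≤n))

≤⇒0≤- : ∀ {x y} → x ℚ.≤ y → 0ℚ ℚ.≤ y ℚ.- x
≤⇒0≤- {x} {y} p = subst (ℚ._≤ y ℚ.- x) (ℚₚ.+-inverseʳ x) (ℚₚ.+-monoˡ-≤ (ℚ.- x) p)

<⇒0<- : ∀ {x y} → x ℚ.< y → 0ℚ ℚ.< y ℚ.- x
<⇒0<- {x} {y} p = subst (ℚ._< y ℚ.- x) (ℚₚ.+-inverseʳ x) (ℚₚ.+-monoˡ-< (ℚ.- x) p)

-- Linear inequalities are proved by exhibiting y - x as a nonnegative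
-- combination d of the differences of the assumed ones.
≤-by : ∀ {x y} d → 0ℚ ℚ.≤ d → y ≡ x ℚ.+ d → x ℚ.≤ y
≤-by {x} {y} d p e = subst (x ℚ.≤_) (sym e) (subst (ℚ._≤ x ℚ.+ d) (ℚₚ.+-identityʳ x) (ℚₚ.+-monoʳ-≤ x p))

<-by : ∀ {x y} d → 0ℚ ℚ.< d → y ≡ x ℚ.+ d → x ℚ.< y
<-by {x} {y} d p e = subst (x ℚ.<_) (sym e) (subst (ℚ._< x ℚ.+ d) (ℚₚ.+-identityʳ x) (ℚₚ.+-monoʳ-< x p))

0≤⇒neg≤0 : ∀ {x} → 0ℚ ℚ.≤ x → ℚ.- x ℚ.≤ 0ℚ
0≤⇒neg≤0 {x} p = ≤-by x p (sym (ℚₚ.+-inverseˡ x))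

reciprocal : ∀ {x} → 0ℚ ℚ.< x → ∃[ y ] (0ℚ ℚ.< y × y ℚ.* x ≡ 1ℚ)
reciprocal {x} p = ℚ.1/ x , ℚₚ.positive⁻¹ (ℚ.1/ x) {{ℚₚ.1/pos⇒pos x}} , ℚₚ.*-inverseˡ x
  where instance
    _ = ℚ.positive p
    _ = ℚₚ.pos⇒nonZero x

÷₀-* : ∀ x {y} → y ≢ 0ℚ → (x ÷₀ y) ℚ.* y ≡ x
÷₀-* x {y} y≢0 with y ℚₚ.≟ 0ℚ
... | yes y≡0 = contradiction y≡0 y≢0
... | no  z   = trans (ℚₚ.*-assoc x _ y) (trans (cong (x ℚ.*_) (ℚₚ.*-inverseˡ y {{ℚ.≢-nonZero z}})) (ℚₚ.*-identityʳ x))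

≤⇒≯ : ∀ {x y} → x ℚ.≤ y → ¬ (y ℚ.< x)
≤⇒≯ p q = ℚₚ.<-irrefl refl (ℚₚ.≤-<-trans p q)

0<⇒≢0 : ∀ {x} → 0ℚ ℚ.< x → x ≢ 0ℚ
0<⇒≢0 p e = ℚₚ.<⇒≢ p (sym e)

-- The embedding of ℤ

private
  -- `fromℤ i` is a normalised fraction and does not compute for a variable i. Its unnormalised
  -- image is equivalent to i over 1, where ring and order laws reduce to laws of ℤ.
  toℚᵘ-fromℤ : ∀ i → toℚᵘ (fromℤ i) ℚᵘ.≃ ℚᵘ.mkℚᵘ i 0
  toℚᵘ-fromℤ i = ℚₚ.toℚᵘ-fromℚᵘ (ℚᵘ.mkℚᵘ i 0)

abstract
  fromℤ-+ : ∀ i j → fromℤ (i ℤ.+ j) ≡ fromℤ i ℚ.+ fromℤ j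
  fromℤ-+ i j = ℚₚ.toℚᵘ-injective (begin
    toℚᵘ (fromℤ (i ℤ.+ j))                  ≈⟨ toℚᵘ-fromℤ (i ℤ.+ j) ⟩
    ℚᵘ.mkℚᵘ (i ℤ.+ j) 0                     ≈⟨ ℚᵘ.*≡* (cong (ℤ._* ℤ.+ 1) (cong₂ ℤ._+_ (sym (ℤₚ.*-identityʳ i)) (sym (ℤₚ.*-identityʳ j)))) ⟩
    ℚᵘ.mkℚᵘ i 0 ℚᵘ.+ ℚᵘ.mkℚᵘ j 0            ≈⟨ ℚᵘₚ.+-cong (toℚᵘ-fromℤ i) (toℚᵘ-fromℤ j) ⟨
    toℚᵘ (fromℤ i) ℚᵘ.+ toℚᵘ (fromℤ j)      ≈⟨ ℚₚ.toℚᵘ-homo-+ (fromℤ i) (fromℤ j) ⟨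
    toℚᵘ (fromℤ i ℚ.+ fromℤ j)              ∎)
    where open ℚᵘₚ.≃-Reasoning

  fromℤ-* : ∀ i j → fromℤ (i ℤ.* j) ≡ fromℤ i ℚ.* fromℤ j
  fromℤ-* i j = ℚₚ.toℚᵘ-injective (begin
    toℚᵘ (fromℤ (i ℤ.* j))                  ≈⟨ toℚᵘ-fromℤ (i ℤ.* j) ⟩
    ℚᵘ.mkℚᵘ i 0 ℚᵘ.* ℚᵘ.mkℚᵘ j 0            ≈⟨ ℚᵘₚ.*-cong (toℚᵘ-fromℤ i) (toℚᵘ-fromℤ j) ⟨
    toℚᵘ (fromℤ i) ℚᵘ.* toℚᵘ (fromℤ j)      ≈⟨ ℚₚ.toℚᵘ-homo-* (fromℤ i) (fromℤ j) ⟨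
    toℚᵘ (fromℤ i ℚ.* fromℤ j)              ∎)
    where open ℚᵘₚ.≃-Reasoning

  fromℤ-neg : ∀ i → fromℤ (ℤ.- i) ≡ ℚ.- fromℤ i
  fromℤ-neg i = ℚₚ.toℚᵘ-injective (begin
    toℚᵘ (fromℤ (ℤ.- i))                    ≈⟨ toℚᵘ-fromℤ (ℤ.- i) ⟩
    ℚᵘ.- ℚᵘ.mkℚᵘ i 0                        ≈⟨ ℚᵘₚ.-‿cong (toℚᵘ-fromℤ i) ⟨
    ℚᵘ.- toℚᵘ (fromℤ i)                     ≈⟨ ℚₚ.toℚᵘ-homo‿- (fromℤ i) ⟨
    toℚᵘ (ℚ.- fromℤ i)                      ∎)
    where open ℚᵘₚ.≃-Reasoning

  fromℤ-mono-≤ : ∀ {i j} → i ℤ.≤ j → fromℤ i ℚ.≤ fromℤ j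
  fromℤ-mono-≤ {i} {j} i≤j = ℚₚ.toℚᵘ-cancel-≤ (begin
    toℚᵘ (fromℤ i)   ≃⟨ toℚᵘ-fromℤ i ⟩
    ℚᵘ.mkℚᵘ i 0      ≤⟨ ℚᵘ.*≤* (ℤₚ.*-monoʳ-≤-nonNeg (+ 1) i≤j) ⟩
    ℚᵘ.mkℚᵘ j 0      ≃⟨ toℚᵘ-fromℤ j ⟨
    toℚᵘ (fromℤ j)   ∎)
    where open ℚᵘₚ.≤-Reasoning

  fromℤ-mono-< : ∀ {i j} → i ℤ.< j → fromℤ i ℚ.< fromℤ j
  fromℤ-mono-< {i} {j} i<j = ℚₚ.toℚᵘ-cancel-< (begin-strict
    toℚᵘ (fromℤ i)   ≃⟨ toℚᵘ-fromℤ i ⟩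
    ℚᵘ.mkℚᵘ i 0      <⟨ ℚᵘ.*<* (ℤₚ.*-monoʳ-<-pos (+ 1) i<j) ⟩
    ℚᵘ.mkℚᵘ j 0      ≃⟨ toℚᵘ-fromℤ j ⟨
    toℚᵘ (fromℤ j)   ∎)
    where open ℚᵘₚ.≤-Reasoning

fromℤ-cancel-≤ : ∀ {i j} → fromℤ i ℚ.≤ fromℤ j → i ℤ.≤ j
fromℤ-cancel-≤ {i} {j} p with i ℤₚ.≤? j
... | yes q = q
... | no ¬q = contradiction (fromℤ-mono-< (ℤₚ.≰⇒> ¬q)) (≤⇒≯ p)

fromℤ-cancel-< : ∀ {i j} → fromℤ i ℚ.< fromℤ j → i ℤ.< j
fromℤ-cancel-< {i} {j} p with i ℤₚ.<? j
... | yes q = q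
... | no ¬q = contradiction p (≤⇒≯ (fromℤ-mono-≤ (ℤₚ.≮⇒≥ ¬q)))

fromℕ-+ : ∀ i j → fromℕ (i ℕ.+ j) ≡ fromℕ i ℚ.+ fromℕ j
fromℕ-+ i j = fromℤ-+ (+ i) (+ j)

fromℕ-mono-≤ : ∀ {i j} → i ℕ.≤ j → fromℕ i ℚ.≤ fromℕ j
fromℕ-mono-≤ p = fromℤ-mono-≤ (ℤ.+≤+ p)

fromℕ-cancel-≤ : ∀ {i j} → fromℕ i ℚ.≤ fromℕ j → i ℕ.≤ j
fromℕ-cancel-≤ p = ℤₚ.drop‿+≤+ (fromℤ-cancel-≤ p)

fromℕ-suc : ∀ k → fromℕ (suc k) ≡ 1ℚ ℚ.+ fromℕ k
fromℕ-suc k = fromℕ-+ 1 k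

0≤fromℕ : ∀ k → 0ℚ ℚ.≤ fromℕ k
0≤fromℕ k = fromℕ-mono-≤ {0} {k} ℕ.z≤n

0<fromℕ : ∀ {k} → 0 ℕ.< k → 0ℚ ℚ.< fromℕ k
0<fromℕ p = fromℤ-mono-< (ℤ.+<+ p)

abstract
  floor≤ : ∀ q → fromℤ (floor q) ℚ.≤ q
  floor≤ q@record{} = ℚₚ.toℚᵘ-cancel-≤ (begin
    toℚᵘ (fromℤ (floor q))  ≃⟨ toℚᵘ-fromℤ (floor q) ⟩
    ℚᵘ.mkℚᵘ (floor q) 0     ≤⟨ ℚᵘ.*≤* (subst (floor q ℤ.* ℚ.↧ q ℤ.≤_) (sym (ℤₚ.*-identityʳ (ℚ.↥ q))) (ℤ.[n/d]*d≤n (ℚ.↥ q) (ℚ.↧ q))) ⟩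
    toℚᵘ q                  ∎)
    where open ℚᵘₚ.≤-Reasoning

  <floor+1 : ∀ q → q ℚ.< fromℤ (floor q) ℚ.+ 1ℚ
  <floor+1 q@record{} = subst (q ℚ.<_) (trans (cong fromℤ (ℤₚ.+-comm (+ 1) (floor q))) (fromℤ-+ (floor q) (+ 1)))
    (ℚₚ.toℚᵘ-cancel-< (begin-strict
    toℚᵘ q                                ≃⟨ ℚᵘ.*≡* refl ⟩
    toℚᵘ q                                <⟨ ℚᵘ.*<* (subst (ℤ._< ℤ.suc (floor q) ℤ.* ℚ.↧ q) (sym (ℤₚ.*-identityʳ (ℚ.↥ q))) 
      (subst (λ k → ℚ.↥ q ℤ.< ℤ.suc k ℤ.* ℚ.↧ q) (sym (ℤ.div-pos-is-/ℕ (ℚ.↥ q) (ℚ.↧ₙ q))) (ℤ.n<s[n/ℕd]*d (ℚ.↥ q) (ℚ.↧ₙ q)))) ⟩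
    ℚᵘ.mkℚᵘ (ℤ.suc (floor q)) 0           ≃⟨ toℚᵘ-fromℤ (ℤ.suc (floor q)) ⟨
    toℚᵘ (fromℤ (ℤ.suc (floor q)))        ∎))
    where open ℚᵘₚ.≤-Reasoning

floor-≤ : ∀ {q z} → q ℚ.≤ fromℤ z → floor q ℤ.≤ z
floor-≤ {q} p = fromℤ-cancel-≤ (ℚₚ.≤-trans (floor≤ q) p)

-- From z ≤ q < `floor q` + 1 with integers at both ends, z lies strictly below the successor of the
-- floor.
floor-glb : ∀ {q z} → fromℤ z ℚ.≤ q → z ℤ.≤ floor q
floor-glb {q} {z} p = subst (z ℤ.≤_) (ℤₚ.pred-suc (floor q)) (ℤₚ.i<j⇒i≤pred[j] {z} {ℤ.suc (floor q)} (fromℤ-cancel-<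
  (ℚₚ.≤-<-trans p (subst (q ℚ.<_) (trans (ℚₚ.+-comm (fromℤ (floor q)) 1ℚ) (sym (fromℤ-+ (+ 1) (floor q)))) (<floor+1 q)))))

-- The ceiling is the negated floor of -q, so this is `floor-≤` after negation.
≤-ceiling : ∀ {q z} → fromℤ z ℚ.≤ q → z ℤ.≤ ceiling q
≤-ceiling {q@record{}} {z} p = subst (ℤ._≤ ceiling q) (ℤₚ.neg-involutive z)
  (ℤₚ.neg-mono-≤ (floor-≤ (subst (ℚ.- q ℚ.≤_) (sym (fromℤ-neg z)) (ℚₚ.neg-antimono-≤ p))))

-- Linear functionals on ℚⁿ

dot : ∀ {n} → (Fin n → ℚ) → (Fin n → ℚ) → ℚ
dot g x = ∑ℚ λ i → g i ℚ.* x i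

unit : ∀ {n} → Fin n → Fin n → ℚ
unit a i = if does (a Finₚ.≟ i) then 1ℚ else 0ℚ

unit-diag : ∀ {n} (a : Fin n) → unit a a ≡ 1ℚ
unit-diag a with a Finₚ.≟ a
... | yes _  = refl
... | no a≢a = contradiction refl a≢a

unit-off : ∀ {n} {a i : Fin n} → a ≢ i → unit a i ≡ 0ℚ
unit-off {a = a} {i} a≢i with a Finₚ.≟ i
... | yes a≡i = contradiction a≡i a≢i
... | no _    = refl

dot-cong : ∀ {n} (g : Fin n → ℚ) {x y} → (∀ i → x i ≡ y i) → dot g x ≡ dot g y
dot-cong g e = ∑ℚ-cong λ i → cong (g i ℚ.*_) (e i)

dot-+ : ∀ {n} (g x y : Fin n → ℚ) → dot g (λ i → x i ℚ.+ y i) ≡ dot g x ℚ.+ dot g y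
dot-+ g x y = trans (∑ℚ-cong λ i → ℚₚ.*-distribˡ-+ (g i) (x i) (y i))
                    (∑ℚ-distrib-+ (λ i → g i ℚ.* x i) (λ i → g i ℚ.* y i))

dot-* : ∀ {n} (g : Fin n → ℚ) k x → dot g (λ i → k ℚ.* x i) ≡ k ℚ.* dot g x
dot-* g k x = trans
  (∑ℚ-cong λ i → solve 3 (λ a b c → a :* (b :* c) := b :* (a :* c)) refl (g i) k (x i))
  (sym (*-distribˡ-∑ℚ k (λ i → g i ℚ.* x i)))

dot-linear : ∀ {n} (g : Fin n → ℚ) k x l y →
             dot g (λ i → k ℚ.* x i ℚ.+ l ℚ.* y i) ≡ k ℚ.* dot g x ℚ.+ l ℚ.* dot g y
dot-linear g k x l y = trans (dot-+ g (λ i → k ℚ.* x i) (λ i → l ℚ.* y i)) (cong₂ ℚ._+_ (dot-* g k x) (dot-* g l y))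

dot-comm : ∀ {n} (g x : Fin n → ℚ) → dot g x ≡ dot x g
dot-comm g x = ∑ℚ-cong λ i → ℚₚ.*-comm (g i) (x i)

dot-0 : ∀ {n} (g : Fin n → ℚ) {x} → (∀ i → x i ≡ 0ℚ) → dot g x ≡ 0ℚ
dot-0 {zero}  g e = refl
dot-0 {suc n} g e = cong₂ ℚ._+_ (trans (cong (g zero ℚ.*_) (e zero)) (ℚₚ.*-zeroʳ (g zero))) (dot-0 (g ∘ suc) (e ∘ suc))

dot-unit : ∀ {n} (g : Fin n → ℚ) a → dot g (unit a) ≡ g a
dot-unit {suc n} g zero    = trans (cong₂ ℚ._+_ (ℚₚ.*-identityʳ (g zero)) (dot-0 (g ∘ suc) λ _ → refl)) (ℚₚ.+-identityʳ (g zero))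
dot-unit {suc n} g (suc a) = trans (cong₂ ℚ._+_ (ℚₚ.*-zeroʳ (g zero)) (trans (dot-cong (g ∘ suc) shift) (dot-unit (g ∘ suc) a))) (ℚₚ.+-identityˡ _)
  where
  shift : ∀ i → unit (suc a) (suc i) ≡ unit a i
  shift i with a Finₚ.≟ i
  ... | yes _ = refl
  ... | no _  = refl

∑ℚ-mono : ∀ {n} {x y : Fin n → ℚ} → (∀ i → x i ℚ.≤ y i) → ∑ℚ x ℚ.≤ ∑ℚ y
∑ℚ-mono {zero}  p = ℚₚ.≤-refl
∑ℚ-mono {suc n} p = ℚₚ.+-mono-≤ (p zero) (∑ℚ-mono (p ∘ suc))

dot-mono : ∀ {n} (g h : Fin n → ℚ) {x} → (∀ i → 0ℚ ℚ.≤ x i) → (∀ i → g i ℚ.≤ h i) → dot g x ℚ.≤ dot h x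
dot-mono g h {x} nn p = ∑ℚ-mono λ i → ℚₚ.*-monoʳ-≤-nonNeg (x i) {{ℚ.nonNegative (nn i)}} (p i)

fromℤ-∑ : ∀ {n} (f : Fin n → ℤ) → fromℤ (∑ℤ f) ≡ ∑ℚ (fromℤ ∘ f)
fromℤ-∑ {zero}  f = refl
fromℤ-∑ {suc n} f = trans (fromℤ-+ (f zero) _) (cong (fromℤ (f zero) ℚ.+_) (fromℤ-∑ (f ∘ suc)))

fromℕ-∑ : ∀ {n} (f : Fin n → ℕ) → fromℕ (∑ℕ f) ≡ ∑ℚ (fromℕ ∘ f)
fromℕ-∑ {zero}  f = refl
fromℕ-∑ {suc n} f = trans (fromℕ-+ (f zero) _) (cong (fromℕ (f zero) ℚ.+_) (fromℕ-∑ (f ∘ suc)))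

-- The membership witness makes the list nonempty. With the reversed order the same lemma yields a
-- maximum.
least : ∀ {A : Set} {_≼_ : A → A → Set} → Total _≼_ → Transitive _≼_ →
        ∀ {x} {xs : List A} → x ∈ xs → ∃[ a ] (a ∈ xs × (∀ {b} → b ∈ xs → a ≼ b))
least {_≼_ = _≼_} total trans≼ {xs = x ∷ xs} _ = go x xs
  where
  reflexive : ∀ a → a ≼ a
  reflexive a with total a a
  ... | inj₁ p = p
  ... | inj₂ p = p
  go : ∀ x xs → ∃[ a ] (a ∈ (x ∷ xs) × (∀ {b} → b ∈ (x ∷ xs) → a ≼ b))
  go x []       = x , here refl , λ { (here refl) → reflexive x }
  go x (y ∷ xs) with go y xs
  ... | a , a∈ , a≼ with total x a
  ...   | inj₁ x≼a = x , here refl , λ { (here refl) → reflexive x ; (there b∈) → trans≼ x≼a (a≼ b∈) }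
  ...   | inj₂ a≼x = a , there a∈ , λ { (here refl) → a≼x ; (there b∈) → a≼ b∈ }

0≤-cancel-* : ∀ {k x} → 0ℚ ℚ.< k → 0ℚ ℚ.≤ k ℚ.* x → 0ℚ ℚ.≤ x
0≤-cancel-* {k} {x} 0<k p = ℚₚ.*-cancelˡ-≤-pos k {{ℚ.positive 0<k}} (subst (ℚ._≤ k ℚ.* x) (sym (ℚₚ.*-zeroʳ k)) p)

-- The largest z with 0 ≤ l f * z + r f for all f ∈ L is the least of the upper
-- bounds r g / - l g; it meets the lower bounds by the third hypothesis.
maximise : ∀ {A : Set} (l r : A → ℚ) (L : List A) →
  (∃[ g ] (g ∈ L × l g ℚ.< 0ℚ)) →
  (∀ {f} → f ∈ L → l f ≡ 0ℚ → 0ℚ ℚ.≤ r f) →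
  (∀ {f g} → f ∈ L → g ∈ L → 0ℚ ℚ.< l f → l g ℚ.< 0ℚ → 0ℚ ℚ.≤ (ℚ.- l g) ℚ.* r f ℚ.+ l f ℚ.* r g) →
  ∃[ z ] ((∀ {f} → f ∈ L → 0ℚ ℚ.≤ l f ℚ.* z ℚ.+ r f)
        × (∀ z′ → (∀ {f} → f ∈ L → 0ℚ ℚ.≤ l f ℚ.* z′ ℚ.+ r f) → z′ ℚ.≤ z))
maximise {A} l r L (g₀ , g₀∈ , g₀<0) zeros crossed = bound g , satisfies , largest
  where
  bound : A → ℚ
  bound f = r f ÷₀ (ℚ.- l f)
  neg? : ∀ f → Dec (l f ℚ.< 0ℚ)
  neg? f = l f ℚₚ.<? 0ℚ
  0<-l : ∀ {f} → l f ℚ.< 0ℚ → 0ℚ ℚ.< ℚ.- l f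
  0<-l p = ℚₚ.neg-antimono-< p
  bound-* : ∀ {f} → l f ℚ.< 0ℚ → bound f ℚ.* (ℚ.- l f) ≡ r f
  bound-* {f} p = ÷₀-* (r f) (0<⇒≢0 (0<-l p))
  tightest : ∃[ a ] (a ∈ filter neg? L × (∀ {b} → b ∈ filter neg? L → bound a ℚ.≤ bound b))
  tightest = least (λ a b → ℚₚ.≤-total (bound a) (bound b)) ℚₚ.≤-trans (∈-filter⁺ neg? g₀∈ g₀<0)
  g = proj₁ tightest
  g∈ : g ∈ L
  g∈ = proj₁ (∈-filter⁻ neg? {xs = L} (proj₁ (proj₂ tightest)))
  g<0 : l g ℚ.< 0ℚ
  g<0 = proj₂ (∈-filter⁻ neg? {xs = L} (proj₁ (proj₂ tightest)))
  satisfies : ∀ {f} → f ∈ L → 0ℚ ℚ.≤ l f ℚ.* bound g ℚ.+ r f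
  satisfies {f} f∈ with ℚₚ.<-cmp (l f) 0ℚ
  ... | tri< f<0 _ _ = subst (0ℚ ℚ.≤_)
          (trans (solve 3 (λ k z b → k :* (b :- z) := b :* k :+ :- k :* z) refl (ℚ.- l f) (bound g) (bound f))
          (trans (cong₂ ℚ._+_ (bound-* f<0) (cong (ℚ._* bound g) (solve 1 (λ x → :- (:- x) := x) refl (l f)))) (ℚₚ.+-comm (r f) _)))
          (0≤* (ℚₚ.<⇒≤ (0<-l f<0)) (≤⇒0≤- (proj₂ (proj₂ tightest) (∈-filter⁺ neg? f∈ f<0))))
  ... | tri≈ _ f≡0 _ = subst (0ℚ ℚ.≤_) (trans (sym (ℚₚ.+-identityˡ (r f))) (cong (ℚ._+ r f)
          (sym (trans (cong (ℚ._* bound g) f≡0) (ℚₚ.*-zeroˡ (bound g)))))) (zeros f∈ f≡0)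
  -- Replacing `r g` by `bound g` times -`l g` turns the crossing inequality into the wanted one
  -- multiplied by -`l g`, which is positive.
  ... | tri> _ _ 0<f = 0≤-cancel-* (0<-l g<0) (subst (0ℚ ℚ.≤_)
          (trans (cong (λ x → (ℚ.- l g) ℚ.* r f ℚ.+ l f ℚ.* x) (sym (bound-* g<0)))
                 (solve 4 (λ k rf lf z → k :* rf :+ lf :* (z :* k) := k :* (lf :* z :+ rf)) refl (ℚ.- l g) (r f) (l f) (bound g)))
          (crossed f∈ g∈ 0<f g<0))
  largest : ∀ z′ → (∀ {f} → f ∈ L → 0ℚ ℚ.≤ l f ℚ.* z′ ℚ.+ r f) → z′ ℚ.≤ bound g
  largest z′ sat = ≤-by (bound g ℚ.- z′) (0≤-cancel-* (0<-l g<0) (subst (0ℚ ℚ.≤_)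
      (trans (cong (l g ℚ.* z′ ℚ.+_) (sym (bound-* g<0)))
             (solve 3 (λ k z z′ → k :* z′ :+ z :* (:- k) := (:- k) :* (z :- z′)) refl (l g) (bound g) z′))
      (sat g∈)))
    (solve 2 (λ z z′ → z := z′ :+ (z :- z′)) refl (bound g) z′)

-- Linear programs by Fourier–Motzkin elimination

-- An affine form in the variables x and one parameter t. The parameter stands for the objective
-- value and is kept apart because it is never eliminated: it is what remains when all variables are
-- gone.
record Form (n : ℕ) : Set where
  constructor form
  field
    coef  : Fin n → ℚ
    slope : ℚ
    const : ℚ

open Form

eval : ∀ {n} → Form n → (Fin n → ℚ) → ℚ → ℚ
eval f x t = dot (coef f) x ℚ.+ (slope f ℚ.* t ℚ.+ const f)

System : ℕ → Set
System n = List (Form n)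

Sat : ∀ {n} → System n → (Fin n → ℚ) → ℚ → Set
Sat L x t = ∀ {f} → f ∈ L → 0ℚ ℚ.≤ eval f x t

Sat-cong : ∀ {n} {L : System n} {x y t} → (∀ i → x i ≡ y i) → Sat L x t → Sat L y t
Sat-cong {t = t} e sat {f} f∈ = subst (λ v → 0ℚ ℚ.≤ v ℚ.+ (slope f ℚ.* t ℚ.+ const f)) (dot-cong (coef f) e) (sat f∈)

lead : ∀ {n} → Form (suc n) → ℚ
lead f = coef f zero

rest : ∀ {n} → Form (suc n) → Form n
rest f = form (coef f ∘ suc) (slope f) (const f)

eval-split : ∀ {n} (f : Form (suc n)) x t → eval f x t ≡ lead f ℚ.* x zero ℚ.+ eval (rest f) (x ∘ suc) t
eval-split f x t = ℚₚ.+-assoc (lead f ℚ.* x zero) _ _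

-- The multipliers cancel the leading terms. They are both positive when `lead f` is positive and
-- `lead g` is negative, so the combination follows from the two constraints.
combine : ∀ {n} → Form (suc n) → Form (suc n) → Form n
combine f g = form (λ i → k ℚ.* coef f (suc i) ℚ.+ l ℚ.* coef g (suc i))
                   (k ℚ.* slope f ℚ.+ l ℚ.* slope g) (k ℚ.* const f ℚ.+ l ℚ.* const g)
  where
  k = ℚ.- lead g
  l = lead f

eval-combine : ∀ {n} (f g : Form (suc n)) y t →
  eval (combine f g) y t ≡ (ℚ.- lead g) ℚ.* eval (rest f) y t ℚ.+ lead f ℚ.* eval (rest g) y t
eval-combine f g y t = trans
  (cong (ℚ._+ ((k ℚ.* slope f ℚ.+ l ℚ.* slope g) ℚ.* t ℚ.+ (k ℚ.* const f ℚ.+ l ℚ.* const g)))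
    (trans (dot-comm (λ i → k ℚ.* coef f (suc i) ℚ.+ l ℚ.* coef g (suc i)) y)
    (trans (dot-linear y k (coef f ∘ suc) l (coef g ∘ suc))
           (cong₂ (λ u v → k ℚ.* u ℚ.+ l ℚ.* v) (dot-comm y (coef f ∘ suc)) (dot-comm y (coef g ∘ suc))))))
  (solve 9 (λ k l u v a b c d t → (k :* u :+ l :* v) :+ ((k :* a :+ l :* b) :* t :+ (k :* c :+ l :* d))
                            := k :* (u :+ (a :* t :+ c)) :+ l :* (v :+ (b :* t :+ d))) refl
     k l (dot (coef f ∘ suc) y) (dot (coef g ∘ suc) y) (slope f) (slope g) (const f) (const g) t)
  where
  k = ℚ.- lead g
  l = lead f

module _ {n : ℕ} where
  zero? : (f : Form (suc n)) → Dec (lead f ≡ 0ℚ)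
  zero? f = lead f ℚₚ.≟ 0ℚ

  positive? : (f : Form (suc n)) → Dec (0ℚ ℚ.< lead f)
  positive? f = 0ℚ ℚₚ.<? lead f

  negative? : (f : Form (suc n)) → Dec (lead f ℚ.< 0ℚ)
  negative? f = lead f ℚₚ.<? 0ℚ

  eliminate : System (suc n) → System n
  eliminate L = List.map rest (filter zero? L) ++ cartesianProductWith combine (filter positive? L) (filter negative? L)

  rest∈eliminate : ∀ {L f} → f ∈ L → lead f ≡ 0ℚ → rest f ∈ eliminate L
  rest∈eliminate f∈ p = ∈-++⁺ˡ (∈-map⁺ rest (∈-filter⁺ zero? f∈ p))

  combine∈eliminate : ∀ {L f g} → f ∈ L → g ∈ L → 0ℚ ℚ.< lead f → lead g ℚ.< 0ℚ → combine f g ∈ eliminate L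
  combine∈eliminate {L} f∈ g∈ p q = ∈-++⁺ʳ (List.map rest (filter zero? L))
    (∈-cartesianProductWith⁺ combine (∈-filter⁺ positive? f∈ p) (∈-filter⁺ negative? g∈ q))

  Sat-eliminate : ∀ {L x t} → Sat L x t → Sat (eliminate L) (x ∘ suc) t
  Sat-eliminate {L} {x} {t} sat f∈ with ∈-++⁻ (List.map rest (filter zero? L)) f∈
  ... | inj₁ f∈′ with ∈-map⁻ rest f∈′
  ...   | f , f∈z , refl with ∈-filter⁻ zero? {xs = L} f∈z
  ...     | f∈L , f≡0 = subst (0ℚ ℚ.≤_) (trans (eval-split f x t) (trans
                (cong (λ l → l ℚ.* x zero ℚ.+ eval (rest f) (x ∘ suc) t) f≡0)
                (solve 2 (λ a b → con 0ℚ :* a :+ b := b) refl (x zero) (eval (rest f) (x ∘ suc) t))))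
                (sat f∈L)
  Sat-eliminate {L} {x} {t} sat f∈ | inj₂ f∈′
    with ∈-cartesianProductWith⁻ combine (filter positive? L) (filter negative? L) f∈′
  ...   | f , g , f∈p , g∈n , refl with ∈-filter⁻ positive? {xs = L} f∈p | ∈-filter⁻ negative? {xs = L} g∈n
  ...     | f∈L , 0<f | g∈L , g<0 = subst (0ℚ ℚ.≤_) (trans
               (cong₂ (λ u v → (ℚ.- lead g) ℚ.* u ℚ.+ lead f ℚ.* v) (eval-split f x t) (eval-split g x t))
               (trans (solve 5 (λ lg lf x u v → (:- lg) :* (lf :* x :+ u) :+ lf :* (lg :* x :+ v) := (:- lg) :* u :+ lf :* v) refl
                  (lead g) (lead f) (x zero) (eval (rest f) (x ∘ suc) t) (eval (rest g) (x ∘ suc) t))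
                (sym (eval-combine f g (x ∘ suc) t))))
             (0≤+ (0≤* (ℚₚ.<⇒≤ (ℚₚ.neg-antimono-< g<0)) (sat f∈L)) (0≤* (ℚₚ.<⇒≤ 0<f) (sat g∈L)))

-- Guarantees that each maximisation has an upper bound to attain. The form that bounds one variable
-- has coefficient 0 at all the others, so it passes unchanged through their elimination and is
-- still there when its own variable is reached.
record Bounded {n} (L : System n) : Set where
  field
    variables : ∀ i → ∃[ f ] (f ∈ L × coef f i ℚ.< 0ℚ × (∀ j → j ≢ i → coef f j ≡ 0ℚ))
    parameter : ∃[ f ] (f ∈ L × slope f ℚ.< 0ℚ × (∀ j → coef f j ≡ 0ℚ))

open Bounded

Bounded-eliminate : ∀ {n} {L : System (suc n)} → Bounded L → Bounded (eliminate L)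
Bounded-eliminate {L = L} bnd = record
  { variables = λ i → let f , f∈ , f<0 , off = variables bnd (suc i) in
      rest f , rest∈eliminate f∈ (off zero λ ()) , f<0 , λ j j≢i → off (suc j) λ { refl → j≢i refl }
  ; parameter = let f , f∈ , f<0 , off = parameter bnd in
      rest f , rest∈eliminate f∈ (off zero) , f<0 , λ j → off (suc j)
  }

-- (x , t) is the lexicographic maximum of the solution set, t being the most
-- and x zero the least significant coordinate.
LexMax : ∀ {n} → System n → (Fin n → ℚ) → ℚ → Set
LexMax {zero}  L x t = ∀ t′ → Sat L x t′ → t′ ℚ.≤ t
LexMax {suc n} L x t = LexMax (eliminate L) (x ∘ suc) t
                     × (∀ z → Sat L (z Vector.∷ (x ∘ suc)) t → z ℚ.≤ x zero)

eval₀ : (f : Form 0) → ∀ x t → eval f x t ≡ slope f ℚ.* t ℚ.+ const f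
eval₀ f x t = ℚₚ.+-identityˡ _

-- The common solution s cancels under the multipliers of `combine`. This gives the third hypothesis
-- of `maximise` for the parameter.
crossing : ∀ lf lg u v s → 0ℚ ℚ.< lf → lg ℚ.< 0ℚ → 0ℚ ℚ.≤ lf ℚ.* s ℚ.+ u → 0ℚ ℚ.≤ lg ℚ.* s ℚ.+ v →
           0ℚ ℚ.≤ (ℚ.- lg) ℚ.* u ℚ.+ lf ℚ.* v
crossing lf lg u v s 0<lf lg<0 p q = subst (0ℚ ℚ.≤_)
  (solve 5 (λ lg lf s u v → (:- lg) :* (lf :* s :+ u) :+ lf :* (lg :* s :+ v) := (:- lg) :* u :+ lf :* v) refl lg lf s u v)
  (0≤+ (0≤* (ℚₚ.<⇒≤ (ℚₚ.neg-antimono-< lg<0)) p) (0≤* (ℚₚ.<⇒≤ 0<lf) q))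

-- The recursion settles the parameter first and then restores the variables in the reverse order of
-- elimination, each with its largest possible value. For a variable, the last two hypotheses of
-- `maximise` are the two families in `eliminate`, evaluated at the coordinates already chosen.
lexMax : ∀ {n} (L : System n) → Bounded L → ∀ {y s} → Sat L y s → ∃[ x ] ∃[ t ] (Sat L x t × LexMax L x t)
lexMax {zero} L bnd {y} {s} sat = y , proj₁ top
    , (λ {f} f∈ → subst (0ℚ ℚ.≤_) (sym (eval₀ f y (proj₁ top))) (proj₁ (proj₂ top) f∈))
    , λ t′ sat′ → proj₂ (proj₂ top) t′ λ {f} f∈ → subst (0ℚ ℚ.≤_) (eval₀ f y t′) (sat′ f∈)
  where
  sat₀ : ∀ {f} → f ∈ L → 0ℚ ℚ.≤ slope f ℚ.* s ℚ.+ const f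
  sat₀ {f} f∈ = subst (0ℚ ℚ.≤_) (eval₀ f y s) (sat f∈)
  top = maximise slope const L (let f , f∈ , f<0 , _ = parameter bnd in f , f∈ , f<0)
    (λ {f} f∈ f≡0 → subst (0ℚ ℚ.≤_) (trans (cong (λ l → l ℚ.* s ℚ.+ const f) f≡0)
        (solve 2 (λ a b → con 0ℚ :* a :+ b := b) refl s (const f))) (sat₀ f∈))
    (λ {f} {g} f∈ g∈ 0<f g<0 → crossing (slope f) (slope g) (const f) (const g) s 0<f g<0 (sat₀ f∈) (sat₀ g∈))
lexMax {suc n} L bnd {y₀} {s₀} sat₀ = extend (lexMax (eliminate L) (Bounded-eliminate bnd) (Sat-eliminate {x = y₀} {s₀} sat₀))
  where
  extend : ∃[ y ] ∃[ t ] (Sat (eliminate L) y t × LexMax (eliminate L) y t) → ∃[ x ] ∃[ t ] (Sat L x t × LexMax L x t)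
  extend (y , t , sat , lex) = proj₁ top Vector.∷ y , t
      , (λ {f} f∈ → subst (0ℚ ℚ.≤_) (sym (eval-split f (proj₁ top Vector.∷ y) t)) (proj₁ (proj₂ top) f∈)) , lex
      , λ z′ sat′ → proj₂ (proj₂ top) z′ λ {f} f∈ → subst (0ℚ ℚ.≤_) (eval-split f (z′ Vector.∷ y) t) (sat′ f∈)
    where
    top = maximise lead (λ f → eval (rest f) y t) L (let f , f∈ , f<0 , _ = variables bnd zero in f , f∈ , f<0)
      (λ f∈ f≡0 → sat (rest∈eliminate f∈ f≡0))
      (λ {f} {g} f∈ g∈ 0<f g<0 → subst (0ℚ ℚ.≤_) (eval-combine f g y t) (sat (combine∈eliminate f∈ g∈ 0<f g<0)))

lexMax-optimal : ∀ {n} {L : System n} {x t} → LexMax L x t → ∀ {y s} → Sat L y s → s ℚ.≤ t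
lexMax-optimal {zero}  {L} {x} lex {y} {s} sat = lex s (Sat-cong {L = L} {y} {x} (λ ()) sat)
lexMax-optimal {suc n} {L} (lex , _) {y} sat = lexMax-optimal {n} {eliminate L} lex (Sat-eliminate {x = y} sat)

-- The terms θ (b - a) and (1 - θ) (c - a) add up to 0 and neither is positive, so both vanish.
convex-max : ∀ {a b c θ} → 0ℚ ℚ.< θ → θ ℚ.< 1ℚ → a ≡ θ ℚ.* b ℚ.+ (1ℚ ℚ.- θ) ℚ.* c → b ℚ.≤ a → c ℚ.≤ a → b ≡ a × c ≡ a
convex-max {a} {b} {c} {θ} 0<θ θ<1 e b≤a c≤a = ℚₚ.≤-antisym b≤a a≤b , ℚₚ.≤-antisym c≤a a≤c
  where
  0<1-θ = <⇒0<- θ<1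
  a≤b : a ℚ.≤ b
  a≤b = ≤-by (b ℚ.- a) (0≤-cancel-* 0<θ (subst (0ℚ ℚ.≤_)
      (trans (solve 3 (λ a c θ → (con 1ℚ :- θ) :* (a :- c) := a :- (θ :* a :+ (con 1ℚ :- θ) :* c)) refl a c θ)
      (trans (cong (ℚ._- (θ ℚ.* a ℚ.+ (1ℚ ℚ.- θ) ℚ.* c)) e)
             (solve 4 (λ a b c θ → (θ :* b :+ (con 1ℚ :- θ) :* c) :- (θ :* a :+ (con 1ℚ :- θ) :* c) := θ :* (b :- a)) refl a b c θ)))
      (0≤* (ℚₚ.<⇒≤ 0<1-θ) (≤⇒0≤- c≤a))))
    (solve 2 (λ a b → b := a :+ (b :- a)) refl a b)
  a≤c : a ℚ.≤ c
  a≤c = ≤-by (c ℚ.- a) (0≤-cancel-* 0<1-θ (subst (0ℚ ℚ.≤_)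
      (trans (solve 3 (λ a b θ → θ :* (a :- b) := a :- (θ :* b :+ (con 1ℚ :- θ) :* a)) refl a b θ)
      (trans (cong (ℚ._- (θ ℚ.* b ℚ.+ (1ℚ ℚ.- θ) ℚ.* a)) e)
             (solve 4 (λ a b c θ → (θ :* b :+ (con 1ℚ :- θ) :* c) :- (θ :* b :+ (con 1ℚ :- θ) :* a) := (con 1ℚ :- θ) :* (c :- a)) refl a b c θ)))
      (0≤* (ℚₚ.<⇒≤ 0<θ) (≤⇒0≤- b≤a))))
    (solve 2 (λ a c → c := a :+ (c :- a)) refl a c)

-- Coordinates are settled from the most significant one down. Once the tails of y and z agree with
-- that of x, both heads compete in the maximisation that defines `x zero`, so they are at most
-- `x zero`, and `convex-max` makes them equal to it.
lexMax-extreme : ∀ {n} {L : System n} {x t} → LexMax L x t → ∀ {y z θ} → 0ℚ ℚ.< θ → θ ℚ.< 1ℚ →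
  Sat L y t → Sat L z t → (∀ i → x i ≡ θ ℚ.* y i ℚ.+ (1ℚ ℚ.- θ) ℚ.* z i) →
  ∀ i → y i ≡ x i × z i ≡ x i
lexMax-extreme {suc n} {L} {x} {t} (lex , top) {y} {z} 0<θ θ<1 saty satz e = λ
  { zero    → convex-max 0<θ θ<1 (e zero)
      (top (y zero) (Sat-cong {L = L} {y} {y zero Vector.∷ (x ∘ suc)} (λ { zero → refl ; (suc i) → proj₁ (tails i) }) saty))
      (top (z zero) (Sat-cong {L = L} {z} {z zero Vector.∷ (x ∘ suc)} (λ { zero → refl ; (suc i) → proj₂ (tails i) }) satz))
  ; (suc i) → tails i
  }
  where
  tails : ∀ i → y (suc i) ≡ x (suc i) × z (suc i) ≡ x (suc i)
  tails = lexMax-extreme {n} {eliminate L} lex 0<θ θ<1 (Sat-eliminate {x = y} saty) (Sat-eliminate {x = z} satz) (e ∘ suc)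

-- The relaxation as a system of affine forms

sign : ∀ {n} → Subset n → Fin n → ℚ
sign T i = if lookup T i then 1ℚ else ℚ.- 1ℚ

∑-sign : ∀ {n} (T : Subset n) x → ∑ℚ (restrict 0ℚ T x) ℚ.- ∑ℚ (restrict 0ℚ (∁ T) x) ≡ dot (sign T) x
∑-sign []          x = refl
∑-sign (true ∷ T)  x = trans
  (solve 3 (λ x a b → (x :+ a) :- (con 0ℚ :+ b) := con 1ℚ :* x :+ (a :- b)) refl (x zero) (∑ℚ (restrict 0ℚ T (x ∘ suc))) (∑ℚ (restrict 0ℚ (∁ T) (x ∘ suc))))
  (cong (1ℚ ℚ.* x zero ℚ.+_) (∑-sign T (x ∘ suc)))
∑-sign (false ∷ T) x = trans
  (solve 3 (λ x a b → (con 0ℚ :+ a) :- (x :+ b) := con (ℚ.- 1ℚ) :* x :+ (a :- b)) refl (x zero) (∑ℚ (restrict 0ℚ T (x ∘ suc))) (∑ℚ (restrict 0ℚ (∁ T) (x ∘ suc))))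
  (cong ((ℚ.- 1ℚ) ℚ.* x zero ℚ.+_) (∑-sign T (x ∘ suc)))

dot-neg : ∀ {n} (g x : Fin n → ℚ) → dot (λ i → ℚ.- g i) x ≡ ℚ.- dot g x
dot-neg g x = trans
  (dot-comm (λ i → ℚ.- g i) x)
  (trans (dot-cong x λ i → solve 1 (λ a → :- a := con (ℚ.- 1ℚ) :* a) refl (g i))
  (trans (dot-* x (ℚ.- 1ℚ) g)
  (trans (cong ((ℚ.- 1ℚ) ℚ.*_) (dot-comm x g)) (solve 1 (λ a → con (ℚ.- 1ℚ) :* a := :- a) refl (dot g x)))))

module Relaxation {n m : ℕ} (I : Instance n m) where
  open Instance I
  open Solutions I
  open LinearProgram I

  P W : Fin n → ℚ
  P i = fromℤ (p i)
  W i = fromℕ (w i)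

  σ : Fin m → Fin n → ℚ
  σ c = sign (class c)

  color-dot : ∀ c x → sumOver (class c) x ℚ.- sumOver (∁ (class c)) x ≡ dot (σ c) x
  color-dot c x = ∑-sign (class c) x

  capacityForm objectiveForm ceilingForm : Form n
  capacityForm  = form (λ i → ℚ.- W i) 0ℚ (fromℕ b)
  objectiveForm = form P (ℚ.- 1ℚ) 0ℚ
  ceilingForm   = form (λ _ → 0ℚ) (ℚ.- 1ℚ) (∑ℚ λ i → P i ℚ.⊔ 0ℚ)

  colorForm : Fin m → Form n
  colorForm c = form (λ i → ℚ.- σ c i) 0ℚ 1ℚ

  lowerForm upperForm : Fin n → Form n
  lowerForm i = form (unit i) 0ℚ 0ℚ
  upperForm i = form (λ j → ℚ.- unit i j) 0ℚ 1ℚ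

  -- The constraints on (x , t) expressing that x is feasible and t ≤ p · x. The
  -- ceiling on t is redundant, but only such a form bounds t by itself.
  system : System n
  system = capacityForm ∷ objectiveForm ∷ ceilingForm ∷
           (List.map colorForm (allFin m) ++ (List.map lowerForm (allFin n) ++ List.map upperForm (allFin n)))

  color∈ : ∀ c → colorForm c ∈ system
  color∈ c = there (there (there (∈-++⁺ˡ (∈-map⁺ colorForm (∈-allFin c)))))

  lower∈ : ∀ i → lowerForm i ∈ system
  lower∈ i = there (there (there (∈-++⁺ʳ (List.map colorForm (allFin m)) (∈-++⁺ˡ (∈-map⁺ lowerForm (∈-allFin i))))))

  upper∈ : ∀ i → upperForm i ∈ system
  upper∈ i = there (there (there (∈-++⁺ʳ (List.map colorForm (allFin m)) (∈-++⁺ʳ (List.map lowerForm (allFin n)) (∈-map⁺ upperForm (∈-allFin i))))))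

  eval-capacity : ∀ x t → eval capacityForm x t ≡ fromℕ b ℚ.- dot W x
  eval-capacity x t = trans (cong (ℚ._+ (0ℚ ℚ.* t ℚ.+ fromℕ b)) (dot-neg W x))
    (solve 3 (λ a t b → :- a :+ (con 0ℚ :* t :+ b) := b :- a) refl (dot W x) t (fromℕ b))

  eval-objective : ∀ x t → eval objectiveForm x t ≡ dot P x ℚ.- t
  eval-objective x t = solve 2 (λ a t → a :+ (con (ℚ.- 1ℚ) :* t :+ con 0ℚ) := a :- t) refl (dot P x) t

  eval-ceiling : ∀ x t → eval ceilingForm x t ≡ ∑ℚ (λ i → P i ℚ.⊔ 0ℚ) ℚ.- t
  eval-ceiling x t = trans (cong (ℚ._+ _) (trans (dot-comm (λ _ → 0ℚ) x) (dot-0 x λ _ → refl)))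
    (solve 2 (λ b t → con 0ℚ :+ (con (ℚ.- 1ℚ) :* t :+ b) := b :- t) refl (∑ℚ (λ i → P i ℚ.⊔ 0ℚ)) t)

  eval-color : ∀ c x t → eval (colorForm c) x t ≡ 1ℚ ℚ.- dot (σ c) x
  eval-color c x t = trans (cong (ℚ._+ (0ℚ ℚ.* t ℚ.+ 1ℚ)) (dot-neg (σ c) x))
    (solve 2 (λ a t → :- a :+ (con 0ℚ :* t :+ con 1ℚ) := con 1ℚ :- a) refl (dot (σ c) x) t)

  eval-lower : ∀ i x t → eval (lowerForm i) x t ≡ x i
  eval-lower i x t = trans (cong (ℚ._+ (0ℚ ℚ.* t ℚ.+ 0ℚ)) (trans (dot-comm (unit i) x) (dot-unit x i)))
    (solve 2 (λ a t → a :+ (con 0ℚ :* t :+ con 0ℚ) := a) refl (x i) t)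

  eval-upper : ∀ i x t → eval (upperForm i) x t ≡ 1ℚ ℚ.- x i
  eval-upper i x t = trans (cong (ℚ._+ (0ℚ ℚ.* t ℚ.+ 1ℚ)) (trans (dot-neg (unit i) x) (cong ℚ.-_ (trans (dot-comm (unit i) x) (dot-unit x i)))))
    (solve 2 (λ a t → :- a :+ (con 0ℚ :* t :+ con 1ℚ) := con 1ℚ :- a) refl (x i) t)

  0≤-⇒≤ : ∀ {x y} → 0ℚ ℚ.≤ y ℚ.- x → x ℚ.≤ y
  0≤-⇒≤ {x} {y} q = ≤-by (y ℚ.- x) q (solve 2 (λ x y → y := x :+ (y :- x)) refl x y)

  system-sound : ∀ {x t} → Sat system x t → FeasiblePoint x × t ℚ.≤ dot P x
  system-sound {x} {t} sat = record
    { capacity = 0≤-⇒≤ (subst (0ℚ ℚ.≤_) (eval-capacity x t) (sat (here refl)))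
    ; color    = λ c → subst (ℚ._≤ 1ℚ) (sym (color-dot c x)) (0≤-⇒≤ (subst (0ℚ ℚ.≤_) (eval-color c x t) (sat (color∈ c))))
    ; lower    = λ i → subst (0ℚ ℚ.≤_) (eval-lower i x t) (sat (lower∈ i))
    ; upper    = λ i → 0≤-⇒≤ (subst (0ℚ ℚ.≤_) (eval-upper i x t) (sat (upper∈ i)))
    } , 0≤-⇒≤ (subst (0ℚ ℚ.≤_) (eval-objective x t) (sat (there (here refl))))

  objective≤ceiling : ∀ {x} → FeasiblePoint x → dot P x ℚ.≤ ∑ℚ λ i → P i ℚ.⊔ 0ℚ
  objective≤ceiling {x} feas = ∑ℚ-mono λ i → ℚₚ.≤-trans
    (ℚₚ.*-monoʳ-≤-nonNeg (x i) {{ℚ.nonNegative (lower i)}} (ℚₚ.p≤p⊔q (P i) 0ℚ))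
    (subst ((P i ℚ.⊔ 0ℚ) ℚ.* x i ℚ.≤_) (ℚₚ.*-identityʳ (P i ℚ.⊔ 0ℚ))
      (ℚₚ.*-monoˡ-≤-nonNeg (P i ℚ.⊔ 0ℚ) {{ℚ.nonNegative (ℚₚ.p≤q⊔p (P i) 0ℚ)}} (upper i)))
    where open FeasiblePoint feas

  system-complete : ∀ {x t} → FeasiblePoint x → t ℚ.≤ dot P x → Sat system x t
  system-complete {x} {t} feas t≤ = λ
    { (here refl)                 → subst (0ℚ ℚ.≤_) (sym (eval-capacity x t)) (≤⇒0≤- capacity)
    ; (there (here refl))         → subst (0ℚ ℚ.≤_) (sym (eval-objective x t)) (≤⇒0≤- t≤)
    ; (there (there (here refl))) → subst (0ℚ ℚ.≤_) (sym (eval-ceiling x t)) (≤⇒0≤- (ℚₚ.≤-trans t≤ (objective≤ceiling feas)))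
    ; (there (there (there f∈)))  → family f∈
    }
    where
    open FeasiblePoint feas
    family : ∀ {f} → f ∈ (List.map colorForm (allFin m) ++ (List.map lowerForm (allFin n) ++ List.map upperForm (allFin n))) →
             0ℚ ℚ.≤ eval f x t
    family f∈ with ∈-++⁻ (List.map colorForm (allFin m)) f∈
    ... | inj₁ f∈₁ with ∈-map⁻ colorForm f∈₁
    ...   | c , _ , refl = subst (0ℚ ℚ.≤_) (sym (eval-color c x t)) (≤⇒0≤- (subst (ℚ._≤ 1ℚ) (color-dot c x) (color c)))
    family f∈ | inj₂ f∈₂ with ∈-++⁻ (List.map lowerForm (allFin n)) f∈₂
    ... | inj₁ f∈₃ with ∈-map⁻ lowerForm f∈₃
    ...   | i , _ , refl = subst (0ℚ ℚ.≤_) (sym (eval-lower i x t)) (lower i)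
    family f∈ | inj₂ f∈₂ | inj₂ f∈₄ with ∈-map⁻ upperForm f∈₄
    ...   | i , _ , refl = subst (0ℚ ℚ.≤_) (sym (eval-upper i x t)) (≤⇒0≤- (upper i))

  -1<0 : ℚ.- 1ℚ ℚ.< 0ℚ
  -1<0 = ℚₚ.neg-antimono-< 0<1

  system-bounded : Bounded system
  system-bounded = record
    { variables = λ i → upperForm i , upper∈ i , subst (λ u → ℚ.- u ℚ.< 0ℚ) (sym (unit-diag i)) -1<0
                , λ j j≢i → cong ℚ.-_ (unit-off (j≢i ∘ sym))
    ; parameter = ceilingForm , there (there (here refl)) , -1<0 , λ _ → refl
    }

  origin-feasible : FeasiblePoint (λ _ → 0ℚ)
  origin-feasible = record
    { capacity = subst (ℚ._≤ fromℕ b) (sym (dot-0 W λ _ → refl)) (0≤fromℕ b)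
    ; color    = λ c → subst (ℚ._≤ 1ℚ) (sym (trans (color-dot c λ _ → 0ℚ) (dot-0 (σ c) λ _ → refl))) 0≤1
    ; lower    = λ _ → ℚₚ.≤-refl
    ; upper    = λ _ → 0≤1
    }

  -- At the maximal t the constraint t ≤ p · x is an equality. If x lies inside a feasible segment,
  -- `convex-max` gives both ends the objective value t, so both satisfy the system with the same t
  -- and lexicographic maximality identifies them with x.
  optimalExtremePoint : ∃[ x ] OptimalExtremePoint x
  optimalExtremePoint = result (lexMax system system-bounded (system-complete origin-feasible ℚₚ.≤-refl))
    where
    result : ∃[ x ] ∃[ t ] (Sat system x t × LexMax system x t) → ∃[ x ] OptimalExtremePoint x
    result (x , t , sat , lex) = x , record
      { feasible = proj₁ (system-sound sat)
      ; optimal  = best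
      ; extreme  = ext
      }
      where
      best′ : ∀ y → FeasiblePoint y → objective y ℚ.≤ t
      best′ y feas = lexMax-optimal {L = system} {x} lex {y} (system-complete feas ℚₚ.≤-refl)
      best : ∀ y → FeasiblePoint y → objective y ℚ.≤ objective x
      best y feas = ℚₚ.≤-trans (best′ y feas) (proj₂ (system-sound sat))
      t≡ : objective x ≡ t
      t≡ = ℚₚ.≤-antisym (best′ x (proj₁ (system-sound sat))) (proj₂ (system-sound sat))
      ext : ∀ y z θ → FeasiblePoint y → FeasiblePoint z → 0ℚ ℚ.< θ → θ ℚ.< 1ℚ →
            (∀ i → x i ≡ θ ℚ.* y i ℚ.+ (1ℚ ℚ.- θ) ℚ.* z i) → ∀ i → y i ≡ z i
      ext y z θ fy fz 0<θ θ<1 e i = trans (proj₁ (same i)) (sym (proj₂ (same i)))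
        where
        split : objective y ≡ objective x × objective z ≡ objective x
        split = convex-max 0<θ θ<1 (trans (dot-cong P e) (dot-linear P θ y (1ℚ ℚ.- θ) z)) (best y fy) (best z fz)
        same : ∀ i → y i ≡ x i × z i ≡ x i
        same = lexMax-extreme {L = system} lex 0<θ θ<1
          (system-complete fy (ℚₚ.≤-reflexive (trans (sym t≡) (sym (proj₁ split)))))
          (system-complete fz (ℚₚ.≤-reflexive (trans (sym t≡) (sym (proj₂ split))))) e

-- Item sets as characteristic vectors

χ : ∀ {n} → Subset n → Fin n → ℚ
χ S i = if lookup S i then 1ℚ else 0ℚ

∈⇒lookup : ∀ {n} {S : Subset n} {i} → i ∈ˢ S → lookup S i ≡ true
∈⇒lookup = Vecₚ.[]=⇒lookup

lookup⇒∈ : ∀ {n} {S : Subset n} {i} → lookup S i ≡ true → i ∈ˢ S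
lookup⇒∈ {S = S} {i} = Vecₚ.lookup⇒[]= i S

∉⇒lookup : ∀ {n} {S : Subset n} {i} → i ∉ˢ S → lookup S i ≡ false
∉⇒lookup {S = S} {i} i∉S with lookup S i in e
... | true  = contradiction (lookup⇒∈ e) i∉S
... | false = refl

χ-∈ : ∀ {n} {S : Subset n} {i} → i ∈ˢ S → χ S i ≡ 1ℚ
χ-∈ i∈S = cong (if_then 1ℚ else 0ℚ) (∈⇒lookup i∈S)

χ-∉ : ∀ {n} {S : Subset n} {i} → i ∉ˢ S → χ S i ≡ 0ℚ
χ-∉ i∉S = cong (if_then 1ℚ else 0ℚ) (∉⇒lookup i∉S)

0≤χ : ∀ {n} (S : Subset n) i → 0ℚ ℚ.≤ χ S i
0≤χ S i with lookup S i
... | true  = 0≤1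
... | false = ℚₚ.≤-refl

χ≤1 : ∀ {n} (S : Subset n) i → χ S i ℚ.≤ 1ℚ
χ≤1 S i with lookup S i
... | true  = ℚₚ.≤-refl
... | false = 0≤1

χ-⁅⁆ : ∀ {n} (a i : Fin n) → χ ⁅ a ⁆ i ≡ unit a i
χ-⁅⁆ a i with a Finₚ.≟ i
... | yes refl = χ-∈ (Sₚ.x∈⁅x⁆ a)
... | no a≢i   = χ-∉ (λ i∈ → a≢i (sym (Sₚ.x∈⁅y⁆⇒x≡y a i∈)))

false≢true : ∀ {A : Set} → false ≡ true → A
false≢true ()

lookup-remove : ∀ {n} (S : Subset n) j → lookup (S - j) j ≡ false
lookup-remove (_ ∷ _) zero    = refl
lookup-remove (_ ∷ S) (suc j) = lookup-remove S j

-- The explicit factors 1 and -1 make the right-hand side an instance of `dot-linear`.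
χ-remove : ∀ {n} {S : Subset n} {j} → j ∈ˢ S → ∀ i → χ (S - j) i ≡ 1ℚ ℚ.* χ S i ℚ.+ (ℚ.- 1ℚ) ℚ.* unit j i
χ-remove {S = S} {j} j∈S i with j Finₚ.≟ i
... | yes refl = trans (χ-∉ {S = S - j} λ j∈ → false≢true (trans (sym (lookup-remove S j)) (∈⇒lookup {S = S - j} j∈))) (cong (λ u → 1ℚ ℚ.* u ℚ.+ (ℚ.- 1ℚ) ℚ.* 1ℚ) (sym (χ-∈ j∈S)))
... | no j≢i with lookup S i in e
...   | true  = χ-∈ {S = S - j} (Sₚ.x∈p∧x≢y⇒x∈p-y (lookup⇒∈ e) (j≢i ∘ sym))
...   | false = χ-∉ {S = S - j} (λ i∈ → false≢true (trans (sym e) (∈⇒lookup {S = S} (Sₚ.p─q⊆p S ⁅ j ⁆ i∈))))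
dot-∑ : ∀ {n} {A : Set} (ι : A → ℚ) (o : A) → ι o ≡ 0ℚ → (S : Subset n) (f : Fin n → A) →
        ∑ℚ (ι ∘ restrict o S f) ≡ dot (ι ∘ f) (χ S)
dot-∑ ι o e S f = ∑ℚ-cong pointwise
  where
  pointwise : ∀ i → ι (restrict o S f i) ≡ ι (f i) ℚ.* χ S i
  pointwise i with lookup S i
  ... | true  = sym (ℚₚ.*-identityʳ (ι (f i)))
  ... | false = trans e (sym (ℚₚ.*-zeroʳ (ι (f i))))

∣∣-dot : ∀ {n} (S : Subset n) → fromℕ ∣ S ∣ ≡ dot (λ _ → 1ℚ) (χ S)
∣∣-dot []          = refl
∣∣-dot (true ∷ S)  = trans (fromℕ-suc ∣ S ∣) (cong (1ℚ ℚ.+_) (∣∣-dot S))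
∣∣-dot (false ∷ S) = trans (∣∣-dot S) (sym (ℚₚ.+-identityˡ _))

-- Members of S inside T count +1 and the others -1, so the value is ∣S ∩ T∣ - (∣S∣ - ∣S ∩ T∣).
sign-dot : ∀ {n} (T S : Subset n) → dot (sign T) (χ S) ≡ (fromℕ ∣ S ∩ T ∣ ℚ.+ fromℕ ∣ S ∩ T ∣) ℚ.- fromℕ ∣ S ∣
sign-dot [] [] = refl
sign-dot (t ∷ T) (false ∷ S) = trans (cong (ℚ._+ dot (sign T) (χ S)) (ℚₚ.*-zeroʳ (if t then 1ℚ else ℚ.- 1ℚ))) (trans (ℚₚ.+-identityˡ (dot (sign T) (χ S))) (sign-dot T S))
sign-dot (true ∷ T) (true ∷ S) = trans (cong (1ℚ ℚ.+_) (sign-dot T S)) (trans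
  (solve 2 (λ k s → con 1ℚ :+ ((k :+ k) :- s) := ((con 1ℚ :+ k) :+ (con 1ℚ :+ k)) :- (con 1ℚ :+ s)) refl (fromℕ ∣ S ∩ T ∣) (fromℕ ∣ S ∣))
  (sym (cong₂ (λ k s → (k ℚ.+ k) ℚ.- s) (fromℕ-suc ∣ S ∩ T ∣) (fromℕ-suc ∣ S ∣))))
sign-dot (false ∷ T) (true ∷ S) = trans (cong ((ℚ.- 1ℚ) ℚ.+_) (sign-dot T S)) (trans
  (solve 2 (λ k s → con (ℚ.- 1ℚ) :+ ((k :+ k) :- s) := (k :+ k) :- (con 1ℚ :+ s)) refl (fromℕ ∣ S ∩ T ∣) (fromℕ ∣ S ∣))
  (sym (cong (λ s → (fromℕ ∣ S ∩ T ∣ ℚ.+ fromℕ ∣ S ∩ T ∣) ℚ.- s) (fromℕ-suc ∣ S ∣))))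

⊔-fold-upper : ∀ {m} (f : Fin m → ℕ) c → f c ℕ.≤ Vector.foldr ℕ._⊔_ 0 f
⊔-fold-upper f zero    = ℕₚ.m≤m⊔n (f zero) _
⊔-fold-upper f (suc c) = ℕₚ.≤-trans (⊔-fold-upper (f ∘ suc) c) (ℕₚ.m≤n⊔m (f zero) _)

-- The first alternative covers the empty family, whose fold is the start value 0.
⊔-fold-attained : ∀ {m} (f : Fin m → ℕ) → Vector.foldr ℕ._⊔_ 0 f ≡ 0 ⊎ ∃[ c ] f c ≡ Vector.foldr ℕ._⊔_ 0 f
⊔-fold-attained {zero}  f = inj₁ refl
⊔-fold-attained {suc m} f with ℕₚ.⊔-sel (f zero) (Vector.foldr ℕ._⊔_ 0 (f ∘ suc))
... | inj₁ e = inj₂ (zero , sym e)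
... | inj₂ e with ⊔-fold-attained (f ∘ suc)
...   | inj₁ z       = inj₁ (trans e z)
...   | inj₂ (c , q) = inj₂ (suc c , trans q (sym e))

maximum-attained : ∀ {n} (f : Fin (suc n) → ℤ) → ∃[ i ] f i ≡ maximum f
maximum-attained {zero}  f = zero , refl
maximum-attained {suc n} f with ℤₚ.⊔-sel (f zero) (maximum (f ∘ suc)) | maximum-attained (f ∘ suc)
... | inj₁ e | _       = zero , sym e
... | inj₂ e | (i , q) = suc i , trans q (sym e)

module Encoding {n m : ℕ} (I : Instance n m) where
  open Instance I
  open Solutions I
  open LinearProgram I
  open Relaxation I

  profit-dot : ∀ S → fromℤ (profit S) ≡ dot P (χ S)
  profit-dot S = trans (fromℤ-∑ (restrict 0ℤ S p)) (dot-∑ fromℤ 0ℤ refl S p)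

  weight-dot : ∀ S → fromℕ (weight S) ≡ dot W (χ S)
  weight-dot S = trans (fromℕ-∑ (restrict 0 S w)) (dot-∑ fromℕ 0 refl S w)

  -- The value of the colour functional on a set, kept in ℤ so that strict inequalities can be
  -- sharpened by one: colour feasibility says that no surplus exceeds 1, and infeasibility forces a
  -- surplus of at least 2.
  surplus : Fin m → Subset n → ℤ
  surplus c S = + (count c S ℕ.+ count c S) ℤ.- + ∣ S ∣

  surplus-dot : ∀ c S → dot (σ c) (χ S) ≡ fromℤ (surplus c S)
  surplus-dot c S = trans (sign-dot (class c) S) (sym (trans (fromℤ-+ (+ (count c S ℕ.+ count c S)) (ℤ.- + ∣ S ∣))
    (cong₂ ℚ._+_ (fromℕ-+ (count c S) (count c S)) (fromℤ-neg (+ ∣ S ∣)))))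

  surplus≤1⇒ : ∀ c S → surplus c S ℤ.≤ + 1 → 2 ℕ.* count c S ℕ.≤ ∣ S ∣ ℕ.+ 1
  surplus≤1⇒ c S q = ℤₚ.drop‿+≤+ (subst₂ ℤ._≤_
    (trans (ℤₚ.+-assoc (+ (count c S ℕ.+ count c S)) (ℤ.- + ∣ S ∣) (+ ∣ S ∣))
      (trans (cong (λ k → + (count c S ℕ.+ count c S) ℤ.+ k) (ℤₚ.+-inverseˡ (+ ∣ S ∣)))
      (trans (ℤₚ.+-identityʳ _) (cong (λ k → + (count c S ℕ.+ k)) (sym (ℕₚ.+-identityʳ (count c S)))))))
    (cong +_ (ℕₚ.+-comm 1 ∣ S ∣)) (ℤₚ.+-monoˡ-≤ (+ ∣ S ∣) q))

  ⇒surplus≤1 : ∀ c S → 2 ℕ.* count c S ℕ.≤ ∣ S ∣ ℕ.+ 1 → surplus c S ℤ.≤ + 1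
  ⇒surplus≤1 c S q = subst (surplus c S ℤ.≤_)
    (trans (cong (λ k → k ℤ.- + ∣ S ∣) (ℤₚ.+-comm (+ ∣ S ∣) (+ 1))) (trans (ℤₚ.+-assoc (+ 1) (+ ∣ S ∣) (ℤ.- + ∣ S ∣)) (cong (λ k → + 1 ℤ.+ k) (ℤₚ.+-inverseʳ (+ ∣ S ∣)))))
    (ℤₚ.+-monoˡ-≤ (ℤ.- + ∣ S ∣) (ℤ.+≤+ (subst (λ k → count c S ℕ.+ k ℕ.≤ ∣ S ∣ ℕ.+ 1) (ℕₚ.+-identityʳ (count c S)) q)))

  count≤⇒ColorFeasible : ∀ S → (∀ c → 2 ℕ.* count c S ℕ.≤ ∣ S ∣ ℕ.+ 1) → ColorFeasible S
  count≤⇒ColorFeasible S q with ⊔-fold-attained (λ c → count c S)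
  ... | inj₁ e       = subst (λ k → 2 ℕ.* k ℕ.≤ ∣ S ∣ ℕ.+ 1) (sym e) ℕ.z≤n
  ... | inj₂ (c , e) = subst (λ k → 2 ℕ.* k ℕ.≤ ∣ S ∣ ℕ.+ 1) e (q c)

  ColorFeasible⇒count≤ : ∀ S → ColorFeasible S → ∀ c → 2 ℕ.* count c S ℕ.≤ ∣ S ∣ ℕ.+ 1
  ColorFeasible⇒count≤ S q c = ℕₚ.≤-trans (ℕₚ.*-monoʳ-≤ 2 (⊔-fold-upper (λ c → count c S) c)) q

  dot⇒ColorFeasible : ∀ S → (∀ c → dot (σ c) (χ S) ℚ.≤ 1ℚ) → ColorFeasible S
  dot⇒ColorFeasible S q = count≤⇒ColorFeasible S λ c →
    surplus≤1⇒ c S (fromℤ-cancel-≤ (subst (ℚ._≤ 1ℚ) (surplus-dot c S) (q c)))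

  ColorFeasible⇒dot : ∀ S → ColorFeasible S → ∀ c → dot (σ c) (χ S) ℚ.≤ 1ℚ
  ColorFeasible⇒dot S q c = subst (ℚ._≤ 1ℚ) (sym (surplus-dot c S)) (fromℤ-mono-≤ (⇒surplus≤1 c S (ColorFeasible⇒count≤ S q c)))

  dot⇒Feasible : ∀ S → (∀ c → dot (σ c) (χ S) ℚ.≤ 1ℚ) → dot W (χ S) ℚ.≤ fromℕ b → Feasible S
  dot⇒Feasible S q r = dot⇒ColorFeasible S q , fromℕ-cancel-≤ (subst (ℚ._≤ fromℕ b) (sym (weight-dot S)) r)

  χ-feasible : ∀ S → Feasible S → FeasiblePoint (χ S)
  χ-feasible S (cf , wt) = record
    { capacity = subst (ℚ._≤ fromℕ b) (weight-dot S) (fromℕ-mono-≤ wt)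
    ; color    = λ c → subst (ℚ._≤ 1ℚ) (sym (color-dot c (χ S))) (ColorFeasible⇒dot S cf c)
    ; lower    = 0≤χ S
    ; upper    = χ≤1 S
    }

  dominant-surplus : ∀ {c S} → ¬ ColorFeasible S → Dominant c S → fromℤ (+ 2) ℚ.≤ dot (σ c) (χ S)
  dominant-surplus {c} {S} ¬cf dom = subst (fromℤ (+ 2) ℚ.≤_) (sym (surplus-dot c S))
    (fromℤ-mono-≤ (ℤₚ.i<j⇒suc[i]≤j (ℤₚ.≰⇒> λ q → ¬cf (subst (λ k → 2 ℕ.* k ℕ.≤ ∣ S ∣ ℕ.+ 1) dom (surplus≤1⇒ c S q)))))

  -- Two colour classes are disjoint, so the sum of two colour functionals is
  -- nonpositive: at most one colour constraint is tight.
  two-colors : ∀ {c c′} → c ≢ c′ → ∀ {x} → (∀ i → 0ℚ ℚ.≤ x i) → dot (σ c) x ℚ.+ dot (σ c′) x ℚ.≤ 0ℚ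
  two-colors {c} {c′} c≢c′ {x} nn = subst₂ ℚ._≤_
    (trans (dot-comm (λ i → 1ℚ ℚ.* σ c i ℚ.+ 1ℚ ℚ.* σ c′ i) x) (trans (dot-linear x 1ℚ (σ c) 1ℚ (σ c′))
       (cong₂ ℚ._+_ (trans (ℚₚ.*-identityˡ _) (dot-comm x (σ c))) (trans (ℚₚ.*-identityˡ _) (dot-comm x (σ c′))))))
    (trans (dot-comm (λ _ → 0ℚ) x) (dot-0 x λ _ → refl))
    (dot-mono _ _ nn pointwise)
    where
    pointwise : ∀ i → 1ℚ ℚ.* σ c i ℚ.+ 1ℚ ℚ.* σ c′ i ℚ.≤ 0ℚ
    pointwise i rewrite Vecₚ.lookup∘tabulate (λ i → does (κ i Finₚ.≟ c)) i | Vecₚ.lookup∘tabulate (λ i → does (κ i Finₚ.≟ c′)) i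
      with κ i Finₚ.≟ c | κ i Finₚ.≟ c′
    ... | yes p | yes q = contradiction (trans (sym p) q) c≢c′
    ... | yes _ | no _  = ℚₚ.≤-refl
    ... | no _  | yes _ = ℚₚ.≤-refl
    ... | no _  | no _  = ℚ.*≤* ℤ.-≤+

  σ-cases : ∀ c i → σ c i ≡ 1ℚ ⊎ σ c i ≡ ℚ.- 1ℚ
  σ-cases c i with lookup (class c) i
  ... | true  = inj₁ refl
  ... | false = inj₂ refl

  σ-∈ : ∀ {c i} → i ∈ˢ class c → σ c i ≡ 1ℚ
  σ-∈ i∈ = cong (if_then 1ℚ else (ℚ.- 1ℚ)) (∈⇒lookup i∈)

  W>0 : ∀ i → 0ℚ ℚ.< W i
  W>0 i = 0<fromℕ (w>0 i)

-- Perturbing an extreme point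

room : ∀ s g → 0ℚ ℚ.≤ s → 0ℚ ℚ.< s ⊎ g ≡ 0ℚ →
       ∃[ δ ] (0ℚ ℚ.< δ × (∀ {δ′} → 0ℚ ℚ.≤ δ′ → δ′ ℚ.≤ δ → δ′ ℚ.* g ℚ.≤ s × (ℚ.- δ′) ℚ.* g ℚ.≤ s))
room s g 0≤s (inj₂ refl) = 1ℚ , 0<1 , λ {δ′} _ _ →
  subst (ℚ._≤ s) (sym (ℚₚ.*-zeroʳ δ′)) 0≤s , subst (ℚ._≤ s) (sym (ℚₚ.*-zeroʳ (ℚ.- δ′))) 0≤s
room s g 0≤s (inj₁ 0<s) = fit (ℚₚ.≤-total 0ℚ g)
  where
  -- M bounds the absolute value of the rate g, and the step is δ = s / (M + 1). The added 1 keeps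
  -- the denominator positive when g is 0. Both signs are treated at once because the point will be
  -- moved along v and along -v.
  scaled : ∀ M → 0ℚ ℚ.≤ M → g ℚ.≤ M → ℚ.- g ℚ.≤ M →
           ∃[ δ ] (0ℚ ℚ.< δ × (∀ {δ′} → 0ℚ ℚ.≤ δ′ → δ′ ℚ.≤ δ → δ′ ℚ.* g ℚ.≤ s × (ℚ.- δ′) ℚ.* g ℚ.≤ s))
  scaled M 0≤M g≤M -g≤M = δ , 0<* 0<s 0<r , λ {δ′} 0≤δ′ δ′≤δ →
      ℚₚ.≤-trans (ℚₚ.*-monoˡ-≤-nonNeg δ′ {{ℚ.nonNegative 0≤δ′}} g≤M) (small 0≤δ′ δ′≤δ)
    , subst (ℚ._≤ s) (solve 2 (λ d g → d :* (:- g) := (:- d) :* g) refl δ′ g)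
        (ℚₚ.≤-trans (ℚₚ.*-monoˡ-≤-nonNeg δ′ {{ℚ.nonNegative 0≤δ′}} -g≤M) (small 0≤δ′ δ′≤δ))
    where
    inverse = reciprocal (subst (0ℚ ℚ.<_) (ℚₚ.+-comm 1ℚ M) (0<+ 0<1 0≤M))
    r = proj₁ inverse
    0<r = proj₁ (proj₂ inverse)
    δ = s ℚ.* r
    small : ∀ {δ′} → 0ℚ ℚ.≤ δ′ → δ′ ℚ.≤ δ → δ′ ℚ.* M ℚ.≤ s
    small {δ′} 0≤δ′ δ′≤δ = ≤-by ((δ ℚ.- δ′) ℚ.* M ℚ.+ δ)
      (0≤+ (0≤* (≤⇒0≤- δ′≤δ) 0≤M) (ℚₚ.<⇒≤ (0<* 0<s 0<r)))
      (trans (sym (ℚₚ.*-identityʳ s)) (trans (cong (s ℚ.*_) (sym (proj₂ (proj₂ inverse))))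
        (solve 4 (λ s r M d → s :* (r :* (M :+ con 1ℚ)) := d :* M :+ ((s :* r :- d) :* M :+ s :* r)) refl s r M δ′)))
  fit : 0ℚ ℚ.≤ g ⊎ g ℚ.≤ 0ℚ → _
  fit (inj₁ 0≤g) = scaled g 0≤g ℚₚ.≤-refl (ℚₚ.≤-trans (0≤⇒neg≤0 0≤g) 0≤g)
  fit (inj₂ g≤0) = scaled (ℚ.- g) 0≤-g (ℚₚ.≤-trans g≤0 0≤-g) ℚₚ.≤-refl
    where 0≤-g = ℚₚ.neg-antimono-≤ g≤0

-- Each condition also holds for all smaller nonnegative steps, so the minimum of finitely many
-- positive steps suits all conditions.
commonRoom : ∀ {N} (Q : Fin N → ℚ → Set) →
  (∀ k → ∃[ δ ] (0ℚ ℚ.< δ × (∀ {δ′} → 0ℚ ℚ.≤ δ′ → δ′ ℚ.≤ δ → Q k δ′))) →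
  ∃[ δ ] (0ℚ ℚ.< δ × (∀ {δ′} → 0ℚ ℚ.≤ δ′ → δ′ ℚ.≤ δ → ∀ k → Q k δ′))
commonRoom {zero}  Q rooms = 1ℚ , 0<1 , λ _ _ ()
commonRoom {suc N} Q rooms = δ , ⊓-pos , λ p q → λ
  { zero    → proj₂ (proj₂ (rooms zero)) p (ℚₚ.≤-trans q (ℚₚ.p⊓q≤p δ₀ δ₁))
  ; (suc k) → proj₂ (proj₂ others) p (ℚₚ.≤-trans q (ℚₚ.p⊓q≤q δ₀ δ₁)) k
  }
  where
  others = commonRoom (Q ∘ suc) (rooms ∘ suc)
  δ₀ = proj₁ (rooms zero)
  δ₁ = proj₁ others
  δ = δ₀ ℚ.⊓ δ₁
  ⊓-pos : 0ℚ ℚ.< δ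
  ⊓-pos with ℚₚ.⊓-sel δ₀ δ₁
  ... | inj₁ e = subst (0ℚ ℚ.<_) (sym e) (proj₁ (proj₂ (rooms zero)))
  ... | inj₂ e = subst (0ℚ ℚ.<_) (sym e) (proj₁ (proj₂ others))

module ExtremePoint {n m : ℕ} (I : Instance n m)
  {x : Fin n → ℚ} (x-optimal : LinearProgram.OptimalExtremePoint I x) where
  open Instance I
  open Solutions I
  open LinearProgram I
  open Relaxation I
  open Encoding I
  open OptimalExtremePoint x-optimal
  open FeasiblePoint feasible

  Tight : Fin m → Set
  Tight c = dot (σ c) x ≡ 1ℚ

  Fractional : Fin n → Set
  Fractional i = 0ℚ ℚ.< x i × x i ℚ.< 1ℚ

  color′ : ∀ c → dot (σ c) x ℚ.≤ 1ℚ
  color′ c = subst (ℚ._≤ 1ℚ) (color-dot c x) (color c)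

  -- The sign of δ is left free, so both ends of the segment around x are obtained from this one
  -- lemma.
  moved : ∀ {δ v} →
    dot W v ≡ 0ℚ →
    (∀ c → δ ℚ.* dot (σ c) v ℚ.≤ 1ℚ ℚ.- dot (σ c) x) →
    (∀ i → (ℚ.- δ) ℚ.* v i ℚ.≤ x i) →
    (∀ i → δ ℚ.* v i ℚ.≤ 1ℚ ℚ.- x i) →
    FeasiblePoint (λ i → 1ℚ ℚ.* x i ℚ.+ δ ℚ.* v i)
  moved {δ} {v} Wv≡0 colors lowers uppers = record
    { capacity = subst (ℚ._≤ fromℕ b) (sym (trans (dot-linear W 1ℚ x δ v) (trans (cong (λ z → 1ℚ ℚ.* dot W x ℚ.+ δ ℚ.* z) Wv≡0)
        (solve 2 (λ a d → con 1ℚ :* a :+ d :* con 0ℚ := a) refl (dot W x) δ)))) capacity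
    ; color = λ c → subst (ℚ._≤ 1ℚ) (sym (trans (color-dot c _) (dot-linear (σ c) 1ℚ x δ v)))
        (≤-by (1ℚ ℚ.- dot (σ c) x ℚ.- δ ℚ.* dot (σ c) v) (≤⇒0≤- (colors c))
          (solve 2 (λ a b → con 1ℚ := (con 1ℚ :* a :+ b) :+ (con 1ℚ :- a :- b)) refl (dot (σ c) x) (δ ℚ.* dot (σ c) v)))
    ; lower = λ i → ≤-by (x i ℚ.- (ℚ.- δ) ℚ.* v i) (≤⇒0≤- (lowers i))
          (solve 3 (λ a d v → con 1ℚ :* a :+ d :* v := con 0ℚ :+ (a :- (:- d) :* v)) refl (x i) δ (v i))
    ; upper = λ i → ≤-by (1ℚ ℚ.- x i ℚ.- δ ℚ.* v i) (≤⇒0≤- (uppers i))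
          (solve 2 (λ a b → con 1ℚ := (con 1ℚ :* a :+ b) :+ (con 1ℚ :- a :- b)) refl (x i) (δ ℚ.* v i))
    }

  -- Along v the capacity and the tight colour constraints do not change, and every other constraint
  -- has slack or a zero rate. So x + δ v and x - δ v are feasible for some δ > 0. Their midpoint is
  -- x, extremality makes them equal, and δ v = 0.
  no-direction : ∀ {v} → dot W v ≡ 0ℚ → (∀ c → Tight c → dot (σ c) v ≡ 0ℚ) →
                 (∀ i → Fractional i ⊎ v i ≡ 0ℚ) → ∀ i → v i ≡ 0ℚ
  no-direction {v} Wv≡0 tight support i = trans
    (sym (trans (cong (ℚ._* v i) (proj₂ (proj₂ inverse))) (ℚₚ.*-identityˡ (v i))))
    (trans (ℚₚ.*-assoc (proj₁ inverse) δ (v i)) (trans (cong (proj₁ inverse ℚ.*_) δv≡0) (ℚₚ.*-zeroʳ (proj₁ inverse))))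
    where
    colorRoom = commonRoom (λ c δ → δ ℚ.* dot (σ c) v ℚ.≤ 1ℚ ℚ.- dot (σ c) x × (ℚ.- δ) ℚ.* dot (σ c) v ℚ.≤ 1ℚ ℚ.- dot (σ c) x)
      λ c → room (1ℚ ℚ.- dot (σ c) x) (dot (σ c) v) (≤⇒0≤- (color′ c)) (slack c)
      where
      slack : ∀ c → 0ℚ ℚ.< 1ℚ ℚ.- dot (σ c) x ⊎ dot (σ c) v ≡ 0ℚ
      slack c with dot (σ c) x ℚₚ.≟ 1ℚ
      ... | yes t = inj₂ (tight c t)
      ... | no ¬t = inj₁ (<⇒0<- (ℚₚ.≰⇒> λ q → ¬t (ℚₚ.≤-antisym (color′ c) q)))
    lowerRoom = commonRoom (λ i δ → δ ℚ.* v i ℚ.≤ x i × (ℚ.- δ) ℚ.* v i ℚ.≤ x i) λ i → room (x i) (v i) (lower i) (slack (support i))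
      where
      slack : ∀ {i} → Fractional i ⊎ v i ≡ 0ℚ → 0ℚ ℚ.< x i ⊎ v i ≡ 0ℚ
      slack (inj₁ (p , _)) = inj₁ p
      slack (inj₂ e)       = inj₂ e
    upperRoom = commonRoom (λ i δ → δ ℚ.* v i ℚ.≤ 1ℚ ℚ.- x i × (ℚ.- δ) ℚ.* v i ℚ.≤ 1ℚ ℚ.- x i)
      λ i → room (1ℚ ℚ.- x i) (v i) (≤⇒0≤- (upper i)) (slack (support i))
      where
      slack : ∀ {i} → Fractional i ⊎ v i ≡ 0ℚ → 0ℚ ℚ.< 1ℚ ℚ.- x i ⊎ v i ≡ 0ℚ
      slack (inj₁ (_ , q)) = inj₁ (<⇒0<- q)
      slack (inj₂ e)       = inj₂ e
    -- Colour, lower and upper constraints are treated as a family indexed by `Fin 3`, which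
    -- produces a single δ for all of them.
    common = commonRoom {3} (λ
        { zero             δ → ∀ c → δ ℚ.* dot (σ c) v ℚ.≤ 1ℚ ℚ.- dot (σ c) x × (ℚ.- δ) ℚ.* dot (σ c) v ℚ.≤ 1ℚ ℚ.- dot (σ c) x
        ; (suc zero)       δ → ∀ i → δ ℚ.* v i ℚ.≤ x i × (ℚ.- δ) ℚ.* v i ℚ.≤ x i
        ; (suc (suc zero)) δ → ∀ i → δ ℚ.* v i ℚ.≤ 1ℚ ℚ.- x i × (ℚ.- δ) ℚ.* v i ℚ.≤ 1ℚ ℚ.- x i
        }) (λ { zero → colorRoom ; (suc zero) → lowerRoom ; (suc (suc zero)) → upperRoom })
    δ = proj₁ common
    0<δ = proj₁ (proj₂ common)
    inverse = reciprocal 0<δ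
    fits = proj₂ (proj₂ common) (ℚₚ.<⇒≤ 0<δ) ℚₚ.≤-refl
    twice : ∀ i → (ℚ.- (ℚ.- δ)) ℚ.* v i ≡ δ ℚ.* v i
    twice i = solve 2 (λ d v → (:- (:- d)) :* v := d :* v) refl δ (v i)
    y≡z : ∀ i → 1ℚ ℚ.* x i ℚ.+ δ ℚ.* v i ≡ 1ℚ ℚ.* x i ℚ.+ (ℚ.- δ) ℚ.* v i
    y≡z = extreme _ _ ℚ.½
      (moved {δ} {v} Wv≡0 (λ c → proj₁ (fits zero c)) (λ i → proj₂ (fits (suc zero) i)) (λ i → proj₁ (fits (suc (suc zero)) i)))
      (moved {ℚ.- δ} {v} Wv≡0 (λ c → proj₂ (fits zero c)) (λ i → subst (ℚ._≤ x i) (sym (twice i)) (proj₁ (fits (suc zero) i))) (λ i → proj₂ (fits (suc (suc zero)) i)))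
      (ℚ.*<* (ℤ.+<+ (ℕ.s≤s ℕ.z≤n))) (ℚ.*<* (ℤ.+<+ (ℕ.s≤s (ℕ.s≤s ℕ.z≤n))))
      (λ i → trans
        (solve 2 (λ a w → a := con ℚ.½ :* (con 1ℚ :* a :+ w) :+ (con 1ℚ :- con ℚ.½) :* (con 1ℚ :* a :+ (:- w))) refl (x i) (δ ℚ.* v i))
        (cong (λ u → ℚ.½ ℚ.* (1ℚ ℚ.* x i ℚ.+ δ ℚ.* v i) ℚ.+ (1ℚ ℚ.- ℚ.½) ℚ.* (1ℚ ℚ.* x i ℚ.+ u)) (ℚₚ.neg-distribˡ-* δ (v i))))
    δv≡0 : δ ℚ.* v i ≡ 0ℚ
    δv≡0 = trans
      (solve 3 (λ a d v → d :* v := con ℚ.½ :* ((con 1ℚ :* a :+ d :* v) :- (con 1ℚ :* a :+ (:- d) :* v))) refl (x i) δ (v i))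
      (trans (cong (λ y → ℚ.½ ℚ.* (y ℚ.- (1ℚ ℚ.* x i ℚ.+ (ℚ.- δ) ℚ.* v i))) (y≡z i))
             (trans (cong (ℚ.½ ℚ.*_) (ℚₚ.+-inverseʳ (1ℚ ℚ.* x i ℚ.+ (ℚ.- δ) ℚ.* v i))) (ℚₚ.*-zeroʳ ℚ.½)))

  -- One linear equation that stands for all tight colour constraints. Since at most one colour is
  -- tight, s can be its functional, or 0 if there is none; an admissible direction then has to
  -- satisfy just two equations, given by `W` and s.
  Covers : (Fin n → ℚ) → Set
  Covers s = ∀ v → dot s v ≡ 0ℚ → ∀ c → Tight c → dot (σ c) v ≡ 0ℚ

  tight-unique : ∀ {c c′} → Tight c → Tight c′ → c ≡ c′
  tight-unique {c} {c′} t t′ with c Finₚ.≟ c′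
  ... | yes e = e
  ... | no ne = contradiction
    (subst₂ (λ u v → u ℚ.+ v ℚ.≤ 0ℚ) t t′ (two-colors ne lower))
    λ 2≤0 → ≤⇒≯ 2≤0 (ℚ.*<* (ℤ.+<+ (ℕ.s≤s ℕ.z≤n)))

  covering : ∃[ s ] Covers s
  covering with Finₚ.any? (λ c → dot (σ c) x ℚₚ.≟ 1ℚ)
  ... | yes (c , t) = σ c , λ v e c′ t′ → subst (λ c → dot (σ c) v ≡ 0ℚ) (tight-unique t t′) e
  ... | no none     = (λ _ → 0ℚ) , λ v e c t → contradiction (c , t) none

  -- The direction with entries `W j` at i and -`W i` at j keeps the capacity. If the minor vanished
  -- it would also be orthogonal to s, hence zero by `no-direction`, but its entry `W j` is
  -- positive.
  not-parallel : ∀ {s} → Covers s → ∀ {i j} → i ≢ j → Fractional i → Fractional j →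
                 ¬ (W i ℚ.* s j ℚ.- W j ℚ.* s i ≡ 0ℚ)
  not-parallel {s} covers {i} {j} i≢j fi fj e = 0<⇒≢0 (W>0 j) (trans (sym at-i) (no-direction {v} Wv≡0 (covers v sv≡0) support i))
    where
    v : Fin n → ℚ
    v k = W j ℚ.* unit i k ℚ.+ (ℚ.- W i) ℚ.* unit j k
    along : ∀ g → dot g v ≡ W j ℚ.* g i ℚ.+ (ℚ.- W i) ℚ.* g j
    along g = trans (dot-linear g (W j) (unit i) (ℚ.- W i) (unit j)) (cong₂ (λ a b → W j ℚ.* a ℚ.+ (ℚ.- W i) ℚ.* b) (dot-unit g i) (dot-unit g j))
    Wv≡0 : dot W v ≡ 0ℚ
    Wv≡0 = trans (along W) (solve 2 (λ a b → b :* a :+ (:- a) :* b := con 0ℚ) refl (W i) (W j))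
    sv≡0 : dot s v ≡ 0ℚ
    sv≡0 = trans (along s) (trans (solve 4 (λ a b c d → b :* c :+ (:- a) :* d := :- (a :* d :- b :* c)) refl (W i) (W j) (s i) (s j)) (cong ℚ.-_ e))
    at-i : v i ≡ W j
    at-i = trans (cong₂ (λ a b → W j ℚ.* a ℚ.+ (ℚ.- W i) ℚ.* b) (unit-diag i) (unit-off (i≢j ∘ sym)))
                 (solve 2 (λ a b → b :* con 1ℚ :+ (:- a) :* con 0ℚ := b) refl (W i) (W j))
    support : ∀ k → Fractional k ⊎ v k ≡ 0ℚ
    support k with i Finₚ.≟ k | j Finₚ.≟ k
    ... | yes refl | _        = inj₁ fi
    ... | no _     | yes refl = inj₁ fj
    ... | no _     | no _     = inj₂ (solve 2 (λ a b → b :* con 0ℚ :+ (:- a) :* con 0ℚ := con 0ℚ) refl (W i) (W j))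

  -- A cross product is orthogonal to both factors, so it is an admissible direction and must
  -- vanish. Its entry at k is the minor of i and j, which `not-parallel` shows to be nonzero.
  no-three : ∀ {i j k} → i ≢ j → i ≢ k → j ≢ k → Fractional i → Fractional j → ¬ Fractional k
  no-three {i} {j} {k} i≢j i≢k j≢k fi fj fk = not-parallel {s} (proj₂ covering) i≢j fi fj
      (trans (sym at-k) (no-direction {v} Wv≡0 (proj₂ covering v sv≡0) support k))
    where
    s = proj₁ covering
    -- the cross product of (W i , W j , W k) and (s i , s j , s k)
    α = W j ℚ.* s k ℚ.- W k ℚ.* s j
    β = W k ℚ.* s i ℚ.- W i ℚ.* s k
    γ = W i ℚ.* s j ℚ.- W j ℚ.* s i
    v : Fin n → ℚ
    v l = 1ℚ ℚ.* (α ℚ.* unit i l ℚ.+ β ℚ.* unit j l) ℚ.+ γ ℚ.* unit k l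
    along : ∀ g → dot g v ≡ 1ℚ ℚ.* (α ℚ.* g i ℚ.+ β ℚ.* g j) ℚ.+ γ ℚ.* g k
    along g = trans (dot-linear g 1ℚ (λ l → α ℚ.* unit i l ℚ.+ β ℚ.* unit j l) γ (unit k))
      (cong₂ (λ a b → 1ℚ ℚ.* a ℚ.+ γ ℚ.* b)
        (trans (dot-linear g α (unit i) β (unit j)) (cong₂ (λ a b → α ℚ.* a ℚ.+ β ℚ.* b) (dot-unit g i) (dot-unit g j))) (dot-unit g k))
    Wv≡0 : dot W v ≡ 0ℚ
    Wv≡0 = trans (along W) (solve 6 (λ a b c p q r →
      con 1ℚ :* ((b :* r :- c :* q) :* a :+ (c :* p :- a :* r) :* b) :+ (a :* q :- b :* p) :* c := con 0ℚ) refl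
      (W i) (W j) (W k) (s i) (s j) (s k))
    sv≡0 : dot s v ≡ 0ℚ
    sv≡0 = trans (along s) (solve 6 (λ a b c p q r →
      con 1ℚ :* ((b :* r :- c :* q) :* p :+ (c :* p :- a :* r) :* q) :+ (a :* q :- b :* p) :* r := con 0ℚ) refl
      (W i) (W j) (W k) (s i) (s j) (s k))
    at-k : v k ≡ γ
    at-k = trans (cong₂ (λ a b → 1ℚ ℚ.* a ℚ.+ γ ℚ.* b) (cong₂ (λ a b → α ℚ.* a ℚ.+ β ℚ.* b) (unit-off i≢k) (unit-off j≢k)) (unit-diag k))
                 (solve 3 (λ a b c → con 1ℚ :* (a :* con 0ℚ :+ b :* con 0ℚ) :+ c :* con 1ℚ := c) refl α β γ)
    support : ∀ l → Fractional l ⊎ v l ≡ 0ℚ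
    support l with i Finₚ.≟ l | j Finₚ.≟ l | k Finₚ.≟ l
    ... | yes refl | _        | _        = inj₁ fi
    ... | no _     | yes refl | _        = inj₁ fj
    ... | no _     | no _     | yes refl = inj₁ fk
    ... | no _     | no _     | no _     = inj₂ (solve 3 (λ a b c → con 1ℚ :* (a :* con 0ℚ :+ b :* con 0ℚ) :+ c :* con 0ℚ := con 0ℚ) refl α β γ)

-- Rounding down an extreme point

exceeds : ∀ {x y} d → 0ℚ ℚ.< d → x ≡ y ℚ.+ d → ¬ (x ℚ.≤ y)
exceeds d 0<d e p = ≤⇒≯ p (<-by d 0<d e)

module Rounding {n m : ℕ} (I : Instance n m)
  {x : Fin n → ℚ} (x-optimal : LinearProgram.OptimalExtremePoint I x) where
  open Instance I
  open Solutions I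
  open LinearProgram I
  open Relaxation I
  open Encoding I
  open ExtremePoint I x-optimal
  open OptimalExtremePoint x-optimal
  open FeasiblePoint feasible

  lookup-ones : ∀ k → lookup (ones x) k ≡ does (x k ℚₚ.≟ 1ℚ)
  lookup-ones k = Vecₚ.lookup∘tabulate (λ i → does (x i ℚₚ.≟ 1ℚ)) k

  integral : ∀ {k} → ¬ Fractional k → x k ≡ χ (ones x) k
  integral {k} ¬frac rewrite lookup-ones k with x k ℚₚ.≟ 1ℚ
  ... | yes e = e
  ... | no ne = ℚₚ.≤-antisym (ℚₚ.≮⇒≥ λ 0<x → ¬frac (0<x , ℚₚ.≰⇒> λ q → ne (ℚₚ.≤-antisym (upper k) q))) (lower k)

  fractional-χ : ∀ {k} → Fractional k → χ (ones x) k ≡ 0ℚ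
  fractional-χ {k} (_ , x<1) rewrite lookup-ones k with x k ℚₚ.≟ 1ℚ
  ... | yes e = contradiction x<1 (ℚₚ.<-irrefl e)
  ... | no _  = refl

  fractional? : ∀ k → Dec (Fractional k)
  fractional? k = (0ℚ ℚₚ.<? x k) ×-dec (x k ℚₚ.<? 1ℚ)

  -- Treats zero, one and two fractional items uniformly: a missing one gets weight 0 and a
  -- placeholder index, so i and j are known to be fractional or distinct only under positivity of
  -- the weights concerned.
  record FractionalPart : Set where
    field
      i j           : Fin n
      α β           : ℚ
      0≤α           : 0ℚ ℚ.≤ α
      α<1           : α ℚ.< 1ℚ
      0≤β           : 0ℚ ℚ.≤ β
      β<1           : β ℚ.< 1ℚ
      i-fractional  : 0ℚ ℚ.< α → Fractional i
      j-fractional  : 0ℚ ℚ.< β → Fractional j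
      distinct      : 0ℚ ℚ.< α → 0ℚ ℚ.< β → i ≢ j
      decomposition : ∀ k → x k ≡ 1ℚ ℚ.* χ (ones x) k ℚ.+ 1ℚ ℚ.* (α ℚ.* unit i k ℚ.+ β ℚ.* unit j k)

    along : ∀ g → dot g x ≡ dot g (χ (ones x)) ℚ.+ (α ℚ.* g i ℚ.+ β ℚ.* g j)
    along g = trans (dot-cong g decomposition) (trans (dot-linear g 1ℚ (χ (ones x)) 1ℚ (λ k → α ℚ.* unit i k ℚ.+ β ℚ.* unit j k))
      (cong₂ ℚ._+_ (ℚₚ.*-identityˡ (dot g (χ (ones x)))) (trans (ℚₚ.*-identityˡ _) (trans (dot-linear g α (unit i) β (unit j))
        (cong₂ (λ u v → α ℚ.* u ℚ.+ β ℚ.* v) (dot-unit g i) (dot-unit g j))))))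

  fractionalPart : Fin n → FractionalPart
  fractionalPart r with Finₚ.any? fractional?
  ... | no none = record
    { i = r ; j = r ; α = 0ℚ ; β = 0ℚ ; 0≤α = ℚₚ.≤-refl ; α<1 = 0<1 ; 0≤β = ℚₚ.≤-refl ; β<1 = 0<1
    ; i-fractional = λ p → contradiction p (ℚₚ.<-irrefl refl) ; j-fractional = λ p → contradiction p (ℚₚ.<-irrefl refl)
    ; distinct = λ p → contradiction p (ℚₚ.<-irrefl refl)
    ; decomposition = λ k → trans (integral (λ f → none (k , f)))
        (solve 2 (λ c u → c := con 1ℚ :* c :+ con 1ℚ :* (con 0ℚ :* u :+ con 0ℚ :* u)) refl (χ (ones x) k) (unit r k))
    }
  ... | yes (i , fi) with Finₚ.any? (λ j → ¬? (i Finₚ.≟ j) ×-dec fractional? j)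
  ...   | no none = record
    { i = i ; j = i ; α = x i ; β = 0ℚ ; 0≤α = lower i ; α<1 = proj₂ fi ; 0≤β = ℚₚ.≤-refl ; β<1 = 0<1
    ; i-fractional = λ _ → fi ; j-fractional = λ _ → fi
    ; distinct = λ _ p → contradiction p (ℚₚ.<-irrefl refl)
    ; decomposition = decompose
    }
    where
    decompose : ∀ k → x k ≡ 1ℚ ℚ.* χ (ones x) k ℚ.+ 1ℚ ℚ.* (x i ℚ.* unit i k ℚ.+ 0ℚ ℚ.* unit i k)
    decompose k with i Finₚ.≟ k
    ... | yes refl = trans (solve 1 (λ a → a := con 1ℚ :* con 0ℚ :+ con 1ℚ :* (a :* con 1ℚ :+ con 0ℚ :* con 1ℚ)) refl (x i))
                       (cong (λ c → 1ℚ ℚ.* c ℚ.+ 1ℚ ℚ.* (x i ℚ.* 1ℚ ℚ.+ 0ℚ ℚ.* 1ℚ)) (sym (fractional-χ fi)))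
    ... | no i≢k   = trans (integral (λ f → none (k , i≢k , f)))
                       (solve 2 (λ c a → c := con 1ℚ :* c :+ con 1ℚ :* (a :* con 0ℚ :+ con 0ℚ :* con 0ℚ)) refl (χ (ones x) k) (x i))
  ...   | yes (j , i≢j , fj) = record
    { i = i ; j = j ; α = x i ; β = x j ; 0≤α = lower i ; α<1 = proj₂ fi ; 0≤β = lower j ; β<1 = proj₂ fj
    ; i-fractional = λ _ → fi ; j-fractional = λ _ → fj
    ; distinct = λ _ _ → i≢j
    ; decomposition = decompose
    }
    where
    decompose : ∀ k → x k ≡ 1ℚ ℚ.* χ (ones x) k ℚ.+ 1ℚ ℚ.* (x i ℚ.* unit i k ℚ.+ x j ℚ.* unit j k)
    decompose k with i Finₚ.≟ k | j Finₚ.≟ k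
    ... | yes refl | yes refl = contradiction refl i≢j
    ... | yes refl | no _ = trans (solve 2 (λ a b → a := con 1ℚ :* con 0ℚ :+ con 1ℚ :* (a :* con 1ℚ :+ b :* con 0ℚ)) refl (x i) (x j))
                       (cong (λ c → 1ℚ ℚ.* c ℚ.+ 1ℚ ℚ.* (x i ℚ.* 1ℚ ℚ.+ x j ℚ.* 0ℚ)) (sym (fractional-χ fi)))
    ... | no _ | yes refl = trans (solve 2 (λ a b → b := con 1ℚ :* con 0ℚ :+ con 1ℚ :* (a :* con 0ℚ :+ b :* con 1ℚ)) refl (x i) (x j))
                       (cong (λ c → 1ℚ ℚ.* c ℚ.+ 1ℚ ℚ.* (x i ℚ.* 0ℚ ℚ.+ x j ℚ.* 1ℚ)) (sym (fractional-χ fj)))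
    ... | no i≢k | no j≢k = trans (integral (no-three i≢j i≢k j≢k fi fj))
                       (solve 3 (λ c a b → c := con 1ℚ :* c :+ con 1ℚ :* (a :* con 0ℚ :+ b :* con 0ℚ)) refl (χ (ones x) k) (x i) (x j))

  module _ (part : FractionalPart) where
    open FractionalPart part

    2ℚ 3ℚ : ℚ
    2ℚ = 1ℚ ℚ.+ 1ℚ
    3ℚ = 1ℚ ℚ.+ 2ℚ

    0<1-α = <⇒0<- α<1
    0<1-β = <⇒0<- β<1

    -- Applied with k = 2 when the rounded set is kept and with k = 1 when an item is removed as
    -- well; that item costs at most one more M, so the total loss is at most 2 M in both cases.
    objective-bound : ∀ {M k} → 0ℚ ℚ.≤ M → (∀ i → P i ℚ.≤ M) → α ℚ.+ β ℚ.≤ k → dot P x ℚ.≤ dot P (χ (ones x)) ℚ.+ k ℚ.* M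
    objective-bound {M} {k} 0≤M P≤M sum≤ = subst (ℚ._≤ dot P (χ (ones x)) ℚ.+ k ℚ.* M) (sym (along P))
      (≤-by ((k ℚ.- (α ℚ.+ β)) ℚ.* M ℚ.+ (α ℚ.* (M ℚ.- P i) ℚ.+ β ℚ.* (M ℚ.- P j)))
        (0≤+ (0≤* (≤⇒0≤- sum≤) 0≤M) (0≤+ (0≤* 0≤α (≤⇒0≤- (P≤M i))) (0≤* 0≤β (≤⇒0≤- (P≤M j)))))
        (solve 7 (λ v k m a b p q → v :+ k :* m := (v :+ (a :* p :+ b :* q)) :+ ((k :- (a :+ b)) :* m :+ (a :* (m :- p) :+ b :* (m :- q)))) refl
          (dot P (χ (ones x))) k M α β (P i) (P j)))

    α+β≤2 : α ℚ.+ β ℚ.≤ 2ℚ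
    α+β≤2 = ℚₚ.+-mono-≤ (ℚₚ.<⇒≤ α<1) (ℚₚ.<⇒≤ β<1)

    ones-weight : dot W (χ (ones x)) ℚ.≤ fromℕ b
    ones-weight = ℚₚ.≤-trans (≤-by (α ℚ.* W i ℚ.+ β ℚ.* W j)
      (0≤+ (0≤* 0≤α (ℚₚ.<⇒≤ (W>0 i))) (0≤* 0≤β (ℚₚ.<⇒≤ (W>0 j)))) (along W)) capacity

    -- If rounding down breaks the constraint of colour c, then that constraint
    -- is tight and there are two fractional items, neither of colour c.
    infeasible-ones : ∀ {c} → 2ℚ ℚ.≤ dot (σ c) (χ (ones x)) → α ℚ.+ β ℚ.≤ 1ℚ × dot (σ c) (χ (ones x)) ℚ.≤ 2ℚ
    infeasible-ones {c} 2≤K = go (σ-cases c i) (σ-cases c j)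
      where
      K = dot (σ c) (χ (ones x))
      0≤K-2 : 0ℚ ℚ.≤ K ℚ.- 2ℚ
      0≤K-2 = ≤⇒0≤- 2≤K
      total : ∀ {u v} → σ c i ≡ u → σ c j ≡ v → dot (σ c) x ≡ K ℚ.+ (α ℚ.* u ℚ.+ β ℚ.* v)
      total e e′ = trans (along (σ c)) (cong₂ (λ u v → K ℚ.+ (α ℚ.* u ℚ.+ β ℚ.* v)) e e′)
      bounded : ∀ {u v} → σ c i ≡ u → σ c j ≡ v → K ℚ.+ (α ℚ.* u ℚ.+ β ℚ.* v) ℚ.≤ 1ℚ
      bounded e e′ = subst (ℚ._≤ 1ℚ) (total e e′) (color′ c)
      go : σ c i ≡ 1ℚ ⊎ σ c i ≡ ℚ.- 1ℚ → σ c j ≡ 1ℚ ⊎ σ c j ≡ ℚ.- 1ℚ → α ℚ.+ β ℚ.≤ 1ℚ × K ℚ.≤ 2ℚ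
      -- In the first three cases one of the two items has colour c. The other item can subtract
      -- less than 1 from K ≥ 2, so the constraint of c would be violated at x.
      go (inj₁ e) (inj₁ e′) = contradiction (bounded e e′) (exceeds (1ℚ ℚ.+ (K ℚ.- 2ℚ ℚ.+ (α ℚ.+ β)))
        (0<+ 0<1 (0≤+ 0≤K-2 (0≤+ 0≤α 0≤β)))
        (solve 3 (λ k a b → k :+ (a :* con 1ℚ :+ b :* con 1ℚ) := con 1ℚ :+ (con 1ℚ :+ (k :- con 2ℚ :+ (a :+ b)))) refl K α β))
      go (inj₁ e) (inj₂ e′) = contradiction (bounded e e′) (exceeds ((1ℚ ℚ.- β) ℚ.+ (K ℚ.- 2ℚ ℚ.+ α))
        (0<+ 0<1-β (0≤+ 0≤K-2 0≤α))
        (solve 3 (λ k a b → k :+ (a :* con 1ℚ :+ b :* con (ℚ.- 1ℚ)) := con 1ℚ :+ ((con 1ℚ :- b) :+ (k :- con 2ℚ :+ a))) refl K α β))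
      go (inj₂ e) (inj₁ e′) = contradiction (bounded e e′) (exceeds ((1ℚ ℚ.- α) ℚ.+ (K ℚ.- 2ℚ ℚ.+ β))
        (0<+ 0<1-α (0≤+ 0≤K-2 0≤β))
        (solve 3 (λ k a b → k :+ (a :* con (ℚ.- 1ℚ) :+ b :* con 1ℚ) := con 1ℚ :+ ((con 1ℚ :- a) :+ (k :- con 2ℚ :+ b))) refl K α β))
      go (inj₂ e) (inj₂ e′) with dot (σ c) x ℚₚ.≟ 1ℚ
      -- Tightness says K - α - β = 1. As α + β < 2, the integer K is below 3, hence equal to 2, and
      -- α + β = 1.
      ... | yes tight = ≤-by (2ℚ ℚ.- K) (≤⇒0≤- K≤2) 
              (trans (solve 3 (λ k a b → con 1ℚ := (a :+ b) :+ ((con 2ℚ :- k) :+ ((k :+ (a :* con (ℚ.- 1ℚ) :+ b :* con (ℚ.- 1ℚ))) :- con 1ℚ))) refl K α β)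
              (trans (cong (λ z → (α ℚ.+ β) ℚ.+ ((2ℚ ℚ.- K) ℚ.+ (z ℚ.- 1ℚ))) tight′)
                     (cong ((α ℚ.+ β) ℚ.+_) (ℚₚ.+-identityʳ (2ℚ ℚ.- K))))) , K≤2
        where
        tight′ : K ℚ.+ (α ℚ.* (ℚ.- 1ℚ) ℚ.+ β ℚ.* (ℚ.- 1ℚ)) ≡ 1ℚ
        tight′ = trans (sym (total e e′)) tight
        K<3 : K ℚ.< 3ℚ
        K<3 = <-by ((1ℚ ℚ.- α) ℚ.+ (1ℚ ℚ.- β)) (0<+ 0<1-α (ℚₚ.<⇒≤ 0<1-β))
          (trans (cong (2ℚ ℚ.+_) (sym tight′))
            (solve 3 (λ k a b → con 2ℚ :+ (k :+ (a :* con (ℚ.- 1ℚ) :+ b :* con (ℚ.- 1ℚ))) := k :+ ((con 1ℚ :- a) :+ (con 1ℚ :- b))) refl K α β))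
        K≤2 : K ℚ.≤ 2ℚ
        K≤2 = subst (ℚ._≤ 2ℚ) (sym (surplus-dot c (ones x)))
          (fromℤ-mono-≤ (ℤₚ.i<j⇒i≤pred[j] (fromℤ-cancel-< {surplus c (ones x)} {+ 3} (subst (ℚ._< 3ℚ) (surplus-dot c (ones x)) K<3))))
      -- K - α - β ≤ 1 with K ≥ 2 and both weights below 1 makes both weights positive. The value of
      -- colour c at x is also positive, so by `two-colors` no other colour can be tight. Then the
      -- zero functional covers the tight colours and two fractional items contradict
      -- `not-parallel`.
      ... | no ¬tight = ⊥-elim (not-parallel {λ _ → 0ℚ} covers (distinct 0<α 0<β) (i-fractional 0<α) (j-fractional 0<β)
              (solve 2 (λ a b → a :* con 0ℚ :- b :* con 0ℚ := con 0ℚ) refl (W i) (W j)))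
        where
        slack = ≤⇒0≤- (bounded e e′)
        0<α : 0ℚ ℚ.< α
        0<α = <-by _ (0<+ 0<1-β (0≤+ 0≤K-2 slack))
          (solve 3 (λ k a b → a := con 0ℚ :+ ((con 1ℚ :- b) :+ (k :- con 2ℚ :+ (con 1ℚ :- (k :+ (a :* con (ℚ.- 1ℚ) :+ b :* con (ℚ.- 1ℚ))))))) refl K α β)
        0<β : 0ℚ ℚ.< β
        0<β = <-by _ (0<+ 0<1-α (0≤+ 0≤K-2 slack))
          (solve 3 (λ k a b → b := con 0ℚ :+ ((con 1ℚ :- a) :+ (k :- con 2ℚ :+ (con 1ℚ :- (k :+ (a :* con (ℚ.- 1ℚ) :+ b :* con (ℚ.- 1ℚ))))))) refl K α β)
        none : ∀ c′ → ¬ Tight c′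
        none c′ t′ with c′ Finₚ.≟ c
        ... | yes refl = ¬tight t′
        ... | no c′≢c  = exceeds {dot (σ c′) x ℚ.+ dot (σ c) x} {0ℚ} (1ℚ ℚ.+ ((K ℚ.- 2ℚ) ℚ.+ ((1ℚ ℚ.- α) ℚ.+ (1ℚ ℚ.- β))))
              (0<+ 0<1 (0≤+ 0≤K-2 (0≤+ (ℚₚ.<⇒≤ 0<1-α) (ℚₚ.<⇒≤ 0<1-β))))
              (trans (cong₂ ℚ._+_ t′ (total e e′))
                (solve 3 (λ k a b → con 1ℚ :+ (k :+ (a :* con (ℚ.- 1ℚ) :+ b :* con (ℚ.- 1ℚ))) := con 0ℚ :+ (con 1ℚ :+ (k :- con 2ℚ :+ ((con 1ℚ :- a) :+ (con 1ℚ :- b))))) refl K α β))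
              (two-colors c′≢c lower)
        covers : Covers λ _ → 0ℚ
        covers v _ c′ t′ = contradiction t′ (none c′)

-- Value and existence of LP-Round

module LPRounding {n m : ℕ} (I : Instance n m)
  (w≤b : ∀ i → Instance.w I i ℕ.≤ Instance.b I)
  (p≤pmax : ∀ i → Instance.p I i ℤ.≤ Solutions.pmax I)
  (0<pmax : 0ℤ ℤ.< Solutions.pmax I) where
  open Instance I
  open Solutions I
  open LinearProgram I
  open Relaxation I
  open Encoding I

  M : ℚ
  M = fromℤ pmax

  0<M : 0ℚ ℚ.< M
  0<M = fromℤ-mono-< 0<pmax

  P≤M : ∀ i → P i ℚ.≤ M
  P≤M i = fromℤ-mono-≤ (p≤pmax i)

  σ≤1 : ∀ c i → σ c i ℚ.≤ 1ℚ
  σ≤1 c i with σ-cases c i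
  ... | inj₁ e = ℚₚ.≤-reflexive e
  ... | inj₂ e = subst (ℚ._≤ 1ℚ) (sym e) (ℚ.*≤* ℤ.-≤+)

  -1≤σ : ∀ c i → ℚ.- 1ℚ ℚ.≤ σ c i
  -1≤σ c i with σ-cases c i
  ... | inj₁ e = subst (ℚ.- 1ℚ ℚ.≤_) (sym e) (ℚ.*≤* ℤ.-≤+)
  ... | inj₂ e = ℚₚ.≤-reflexive (sym e)

  dot-singleton : ∀ (g : Fin n → ℚ) a → dot g (χ ⁅ a ⁆) ≡ g a
  dot-singleton g a = trans (dot-cong g (χ-⁅⁆ a)) (dot-unit g a)

  singleton-feasible : ∀ a → Feasible ⁅ a ⁆
  singleton-feasible a = dot⇒Feasible ⁅ a ⁆
    (λ c → subst (ℚ._≤ 1ℚ) (sym (dot-singleton (σ c) a)) (σ≤1 c a))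
    (subst (ℚ._≤ fromℕ b) (sym (dot-singleton W a)) (fromℕ-mono-≤ (w≤b a)))

  profit-singleton : ∀ a → profit ⁅ a ⁆ ≡ p a
  profit-singleton a = ℤₚ.≤-antisym (fromℤ-cancel-≤ {profit ⁅ a ⁆} {p a} (ℚₚ.≤-reflexive e)) (fromℤ-cancel-≤ {p a} {profit ⁅ a ⁆} (ℚₚ.≤-reflexive (sym e)))
    where
    e : fromℤ (profit ⁅ a ⁆) ≡ fromℤ (p a)
    e = trans (profit-dot ⁅ a ⁆) (dot-singleton P a)

  dot-remove : ∀ (g : Fin n → ℚ) {S j} → j ∈ˢ S → dot g (χ (S - j)) ≡ dot g (χ S) ℚ.- g j
  dot-remove g {S} {j} j∈ = trans (dot-cong g (χ-remove j∈)) (trans (dot-linear g 1ℚ (χ S) (ℚ.- 1ℚ) (unit j))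
    (trans (cong (λ u → 1ℚ ℚ.* dot g (χ S) ℚ.+ (ℚ.- 1ℚ) ℚ.* u) (dot-unit g j))
      (solve 2 (λ a b → con 1ℚ :* a :+ con (ℚ.- 1ℚ) :* b := a :- b) refl (dot g (χ S)) (g j))))

  repair-bound : ∀ {x S₀} → OptimalExtremePoint x → Fin n → Repair (ones x) S₀ →
                 Feasible S₀ × objective x ℚ.≤ fromℤ (profit S₀) ℚ.+ (M ℚ.+ M)
  repair-bound {x} opt r (keep cf) = dot⇒Feasible (ones x) (ColorFeasible⇒dot (ones x) cf) (ones-weight part)
    , subst (objective x ℚ.≤_) (trans (cong (dot P (χ (ones x)) ℚ.+_) (solve 1 (λ m → (con 1ℚ :+ con 1ℚ) :* m := m :+ m) refl M))
        (cong (ℚ._+ (M ℚ.+ M)) (sym (profit-dot (ones x)))))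
      (objective-bound part (ℚₚ.<⇒≤ 0<M) P≤M (α+β≤2 part))
    where
    open Rounding I opt
    part = fractionalPart r
  repair-bound {x} opt r (remove c j ¬cf dom j∈ _) = dot⇒Feasible S₀ colors
      (ℚₚ.≤-trans (≤-by (W j) (ℚₚ.<⇒≤ (W>0 j)) (trans (solve 2 (λ a b → a := (a :- b) :+ b) refl (dot W (χ S)) (W j)) (cong (ℚ._+ W j) (sym (dot-remove W {S} {j} j∈S))))) (ones-weight part))
    , ≤-by ((dot P (χ S) ℚ.+ 1ℚ ℚ.* M ℚ.- objective x) ℚ.+ (M ℚ.- P j))
        (0≤+ (≤⇒0≤- (objective-bound part (ℚₚ.<⇒≤ 0<M) P≤M (proj₁ small))) (≤⇒0≤- (P≤M j)))
        (trans (cong (λ v → v ℚ.+ (M ℚ.+ M)) (trans (profit-dot S₀) (dot-remove P {S} {j} j∈S)))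
          (solve 4 (λ v q m o → (v :- q) :+ (m :+ m) := o :+ ((v :+ con 1ℚ :* m :- o) :+ (m :- q))) refl (dot P (χ S)) (P j) M (objective x)))
    where
    open Rounding I opt
    part = fractionalPart r
    S = ones x
    S₀ = S - j
    2≤K = dominant-surplus {c} {S} ¬cf dom
    small = infeasible-ones part {c} 2≤K
    j∈S : j ∈ˢ S
    j∈S = proj₁ (Sₚ.x∈p∩q⁻ S (class c) j∈)
    j∈c : j ∈ˢ class c
    j∈c = proj₂ (Sₚ.x∈p∩q⁻ S (class c) j∈)
    colors : ∀ c′ → dot (σ c′) (χ S₀) ℚ.≤ 1ℚ
    colors c′ with c′ Finₚ.≟ c
    ... | yes refl = subst (ℚ._≤ 1ℚ) (sym (trans (dot-remove (σ c) {S} {j} j∈S) (cong (λ u → dot (σ c) (χ S) ℚ.- u) (σ-∈ {c} {j} j∈c))))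
        (ℚₚ.+-monoˡ-≤ (ℚ.- 1ℚ) (proj₂ small))
    -- Colour c has surplus at least 2, so by `two-colors` colour c′ has at most -2, and the removal
    -- raises this by at most 1.
    ... | no c′≢c = subst (ℚ._≤ 1ℚ) (sym (dot-remove (σ c′) {S} {j} j∈S))
        (≤-by ((0ℚ ℚ.- (dot (σ c′) (χ S) ℚ.+ dot (σ c) (χ S))) ℚ.+ ((dot (σ c) (χ S) ℚ.- fromℤ (+ 2)) ℚ.+ ((σ c′ j ℚ.- (ℚ.- 1ℚ)) ℚ.+ fromℤ (+ 2))))
          (0≤+ (≤⇒0≤- (two-colors c′≢c (0≤χ S))) (0≤+ (≤⇒0≤- 2≤K) (0≤+ (≤⇒0≤- (-1≤σ c′ j)) (0≤fromℕ 2))))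
          (solve 3 (λ a k s → con 1ℚ := (a :- s) :+ ((con 0ℚ :- (a :+ k)) :+ ((k :- con (fromℤ (+ 2))) :+ ((s :- con (ℚ.- 1ℚ)) :+ con (fromℤ (+ 2)))))) refl
            (dot (σ c′) (χ S)) (dot (σ c) (χ S)) (σ c′ j)))

  lpRound-bound : ∀ {S} → LPRound S →
    Feasible S × pmax ℤ.≤ profit S × (∀ T → Feasible T → profit T ℤ.≤ + 3 ℤ.* profit S)
  lpRound-bound {S} record { x = x ; x-optimal = opt ; S₀ = S₀ ; repair = rep ; r = r ; r-max = r-max ; choice = choice } =
    S-feasible choice , proj₁ (value choice) , λ T T-feasible → fromℤ-cancel-≤
      (ℚₚ.≤-trans (subst (ℚ._≤ objective x) (sym (profit-dot T)) (OptimalExtremePoint.optimal opt (χ T) (χ-feasible T T-feasible)))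
      (ℚₚ.≤-trans (proj₂ bound)
        (subst (fromℤ (profit S₀) ℚ.+ (M ℚ.+ M) ℚ.≤_)
          (trans (solve 1 (λ a → a :+ (a :+ a) := con (fromℤ (+ 3)) :* a) refl (fromℤ (profit S))) (sym (fromℤ-* (+ 3) (profit S))))
          (ℚₚ.+-mono-≤ (fromℤ-mono-≤ (proj₂ (value choice))) (ℚₚ.+-mono-≤ M≤ M≤)))))
    where
    bound = repair-bound opt r rep
    r-value : profit ⁅ r ⁆ ≡ pmax
    r-value = trans (profit-singleton r) r-max
    S-feasible : _ → Feasible S
    S-feasible (inj₁ (refl , _)) = proj₁ bound
    S-feasible (inj₂ (refl , _)) = singleton-feasible r
    value : (S ≡ S₀ × profit ⁅ r ⁆ ℤ.≤ profit S₀) ⊎ (S ≡ ⁅ r ⁆ × profit S₀ ℤ.≤ profit ⁅ r ⁆) → pmax ℤ.≤ profit S × profit S₀ ℤ.≤ profit S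
    value (inj₁ (refl , q)) = subst (ℤ._≤ profit S₀) r-value q , ℤₚ.≤-refl
    value (inj₂ (refl , q)) = ℤₚ.≤-reflexive (sym r-value) , q
    M≤ : M ℚ.≤ fromℤ (profit S)
    M≤ = fromℤ-mono-≤ (proj₁ (value choice))

  colorFeasible? : ∀ S → Dec (ColorFeasible S)
  colorFeasible? S = 2 ℕ.* maxCount S ℕₚ.≤? ∣ S ∣ ℕ.+ 1

  -- A violated colour condition forces a positive maximal count, so the dominant class does contain
  -- an item to remove.
  repaired : ∀ S → ∃[ S₀ ] Repair S S₀
  repaired S with colorFeasible? S
  ... | yes cf = S , keep cf
  ... | no ¬cf with ⊔-fold-attained (λ c → count c S)
  ...   | inj₁ e       = contradiction (subst (λ k → 2 ℕ.* k ℕ.≤ ∣ S ∣ ℕ.+ 1) (sym e) ℕ.z≤n) ¬cf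
  ...   | inj₂ (c , e) with Finₚ.any? (λ j → j Sₚ.∈? (S ∩ class c))
  ...     | no none = contradiction (subst (λ k → 2 ℕ.* k ℕ.≤ ∣ S ∣ ℕ.+ 1) (trans (sym (trans (cong ∣_∣ (Sₚ.Empty-unique none)) (Sₚ.∣⊥∣≡0 n))) e) ℕ.z≤n) ¬cf
  ...     | yes (j₀ , j₀∈) = S - j , remove c j ¬cf e (proj₂ (∈-filter⁻ ∈? {xs = allFin n} (proj₁ (proj₂ cheapest))))
                           (λ i i∈ → proj₂ (proj₂ cheapest) (∈-filter⁺ ∈? (∈-allFin i) i∈))
    where
    ∈? = λ j → j Sₚ.∈? (S ∩ class c)
    cheapest : ∃[ a ] (a ∈ filter ∈? (allFin n) × (∀ {b} → b ∈ filter ∈? (allFin n) → p a ℤ.≤ p b))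
    cheapest = least (λ a b → ℤₚ.≤-total (p a) (p b)) ℤₚ.≤-trans (∈-filter⁺ ∈? (∈-allFin j₀) j₀∈)
    j = proj₁ cheapest

  lpRound-exists : ∀ {r} → p r ≡ pmax → ∃[ S ] LPRound S
  lpRound-exists {r} r-max = round (proj₂ optimalExtremePoint)
    where
    better : ∀ {x S₀} → OptimalExtremePoint x → Repair (ones x) S₀ →
             profit ⁅ r ⁆ ℤ.≤ profit S₀ ⊎ profit S₀ ℤ.≤ profit ⁅ r ⁆ → ∃[ S ] LPRound S
    better {x} {S₀} opt rep (inj₁ q) = S₀ , record { x = x ; x-optimal = opt ; S₀ = S₀ ; repair = rep ; r = r ; r-max = r-max ; choice = inj₁ (refl , q) }
    better {x} {S₀} opt rep (inj₂ q) = ⁅ r ⁆ , record { x = x ; x-optimal = opt ; S₀ = S₀ ; repair = rep ; r = r ; r-max = r-max ; choice = inj₂ (refl , q) }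
    round : ∀ {x} → OptimalExtremePoint x → ∃[ S ] LPRound S
    round {x} opt = let S₀ , rep = repaired (ones x) in better opt rep (ℤₚ.≤-total (profit ⁅ r ⁆) (profit S₀))

-- Sums over disjoint unions

Disjoint : ∀ {n} → Subset n → Subset n → Set
Disjoint S T = ∀ {i} → i ∈ˢ S → i ∉ˢ T

module _ {A : Set} {_∙_ : A → A → A} {ε : A} (isCM : IsCommutativeMonoid _≡_ _∙_ ε) where
  open IsCommutativeMonoid isCM using (assoc; comm; identityˡ; identityʳ)

  private
    ∑ : ∀ {n} → (Fin n → A) → A
    ∑ = Vector.foldr _∙_ ε

  ∑-∅ : ∀ {n} (f : Fin n → A) → ∑ (restrict ε ∅ f) ≡ ε
  ∑-∅ {zero}  f = refl
  ∑-∅ {suc n} f = trans (identityˡ _) (∑-∅ (f ∘ suc))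

  ∑-∪ : ∀ {n} (S T : Subset n) → Disjoint S T → ∀ f →
        ∑ (restrict ε (S ∪ T) f) ≡ ∑ (restrict ε S f) ∙ ∑ (restrict ε T f)
  ∑-∪ [] [] dis f = sym (identityˡ ε)
  ∑-∪ (s ∷ S) (t ∷ T) dis f = trans (cong₂ _∙_ (heads s t dis) (∑-∪ S T (λ i∈S i∈T → dis (Vec.there i∈S) (Vec.there i∈T)) (f ∘ suc)))
      (interchange (if s then f zero else ε) (if t then f zero else ε) _ _)
    where
    interchange : ∀ a b c d → (a ∙ b) ∙ (c ∙ d) ≡ (a ∙ c) ∙ (b ∙ d)
    interchange a b c d = trans (assoc a b (c ∙ d)) (trans (cong (a ∙_) (trans (sym (assoc b c d)) (trans (cong (_∙ d) (comm b c)) (assoc c b d)))) (sym (assoc a c (b ∙ d))))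
    heads : ∀ s t → Disjoint (s ∷ S) (t ∷ T) → (if s ∨ t then f zero else ε) ≡ (if s then f zero else ε) ∙ (if t then f zero else ε)
    heads true  true  dis = contradiction here′ (dis here′)
      where
      here′ : ∀ {n} {S : Subset n} → zero ∈ˢ (true ∷ S)
      here′ = lookup⇒∈ refl
    heads true  false dis = sym (identityʳ (f zero))
    heads false true  dis = sym (identityˡ (f zero))
    heads false false dis = sym (identityˡ ε)

  ∑-⁅⁆ : ∀ {n} (i : Fin n) f → ∑ (restrict ε ⁅ i ⁆ f) ≡ f i
  ∑-⁅⁆ zero    f = trans (cong (f zero ∙_) (∑-∅ (f ∘ suc))) (identityʳ (f zero))
  ∑-⁅⁆ (suc i) f = trans (identityˡ _) (∑-⁅⁆ i (f ∘ suc))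

∣∣-∑ : ∀ {n} (S : Subset n) → ∣ S ∣ ≡ ∑ℕ (restrict 0 S λ _ → 1)
∣∣-∑ []          = refl
∣∣-∑ (true ∷ S)  = cong suc (∣∣-∑ S)
∣∣-∑ (false ∷ S) = ∣∣-∑ S

∣∣-∪ : ∀ {n} (S T : Subset n) → Disjoint S T → ∣ S ∪ T ∣ ≡ ∣ S ∣ ℕ.+ ∣ T ∣
∣∣-∪ S T dis = trans (∣∣-∑ (S ∪ T)) (trans (∑-∪ ℕₚ.+-0-isCommutativeMonoid S T dis (λ _ → 1)) (sym (cong₂ ℕ._+_ (∣∣-∑ S) (∣∣-∑ T))))

⁅⁆-disjoint : ∀ {n} {i : Fin n} {S} → i ∉ˢ S → Disjoint ⁅ i ⁆ S
⁅⁆-disjoint {i = i} {S} i∉S j∈i j∈S = i∉S (subst (_∈ˢ S) (Sₚ.x∈⁅y⁆⇒x≡y i j∈i) j∈S)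

unique-reverse : ∀ {A : Set} {xs : List A} → Unique xs → Unique (reverse xs)
unique-reverse {A} {xs} = Permₚ.Unique-resp-↭ (setoid A) (Perm.↭-sym (setoid A) (Permₚ.↭-reverse (setoid A) xs))

-- Extended naturals

Below : ℕ∞ → ℕ → Set
Below v k = ∃[ u ] (v ≡ just u × u ℕ.≤ k)

Below-⊓ˡ : ∀ {v v′ k} → Below v k → Below (v ⊓∞ v′) k
Below-⊓ˡ {v′ = nothing} (u , refl , u≤k) = u , refl , u≤k
Below-⊓ˡ {v′ = just u′} (u , refl , u≤k) = u ℕ.⊓ u′ , refl , ℕₚ.≤-trans (ℕₚ.m⊓n≤m u u′) u≤k

Below-⊓ʳ : ∀ {v v′ k} → Below v′ k → Below (v ⊓∞ v′) k
Below-⊓ʳ {nothing} q                   = q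
Below-⊓ʳ {just u} (u′ , refl , u′≤k) = u ℕ.⊓ u′ , refl , ℕₚ.≤-trans (ℕₚ.m⊓n≤n u u′) u′≤k

Below-+ : ∀ {v v′ k k′} → Below v k → Below v′ k′ → Below (v +∞ v′) (k ℕ.+ k′)
Below-+ (u , refl , p) (u′ , refl , q) = u ℕ.+ u′ , refl , ℕₚ.+-mono-≤ p q

Below-minimum : ∀ {A : Set} (f : A → ℕ∞) {a xs k} → a ∈ xs → Below (f a) k → Below (minimum∞ (List.map f xs)) k
Below-minimum f {xs = a ∷ xs} (here refl) q = Below-⊓ˡ q
Below-minimum f {xs = a ∷ xs} (there a∈)  q = Below-⊓ʳ {f a} (Below-minimum f a∈ q)

⊓∞-sel : ∀ {v v′ u} → v ⊓∞ v′ ≡ just u → v ≡ just u ⊎ v′ ≡ just u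
⊓∞-sel {nothing}           e    = inj₂ e
⊓∞-sel {just a}  {nothing} e    = inj₁ e
⊓∞-sel {just a}  {just b}  refl with ℕₚ.⊓-sel a b
... | inj₁ e = inj₁ (cong just (sym e))
... | inj₂ e = inj₂ (cong just (sym e))

minimum∞-attained : ∀ {A : Set} (f : A → ℕ∞) xs {u} → minimum∞ (List.map f xs) ≡ just u → ∃[ a ] (a ∈ xs × f a ≡ just u)
minimum∞-attained f (x ∷ xs) e with ⊓∞-sel {f x} e
... | inj₁ q = x , here refl , q
... | inj₂ q = let a , a∈ , q′ = minimum∞-attained f xs q in a , there a∈ , q′

+∞-just : ∀ {v v′ u} → v +∞ v′ ≡ just u → ∃[ a ] ∃[ a′ ] (v ≡ just a × v′ ≡ just a′ × u ≡ a ℕ.+ a′)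
+∞-just {just a} {just a′} refl = a , a′ , refl , refl , refl

does⇒ : ∀ {A : Set} (a? : Dec A) → does a? ≡ true → A
does⇒ (yes a) _ = a

guard⁺ : ∀ {A : Set} {x y : A} {b₁ b₂ b₃} → b₁ ≡ true → b₂ ≡ true → b₃ ≡ true → (if b₁ ∧ b₂ ∧ b₃ then x else y) ≡ x
guard⁺ refl refl refl = refl

guard⁻ : ∀ {A : Set} {x y : A} b₁ b₂ b₃ → (if b₁ ∧ b₂ ∧ b₃ then just x else nothing) ≡ just y →
         b₁ ≡ true × b₂ ≡ true × b₃ ≡ true × x ≡ y
guard⁻ true true true refl = refl , refl , refl , refl

m+[n-m]≡n : ∀ m n → m ℤ.+ (n ℤ.- m) ≡ n
m+[n-m]≡n m n = trans (ℤₚ.+-comm m (n ℤ.- m)) (trans (ℤₚ.+-assoc n (ℤ.- m) m)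
  (trans (cong (λ k → n ℤ.+ k) (ℤₚ.+-inverseˡ m)) (ℤₚ.+-identityʳ n)))

if-just : ∀ {A : Set} {v : Maybe A} {y} b → (if b then v else nothing) ≡ just y → b ≡ true × v ≡ just y
if-just true e = refl , e

conjunction : ∀ {a b} → a ∧ b ≡ true → a ≡ true × b ≡ true
conjunction {true} {true} _ = refl , refl

-- Soundness of the dynamic program

module ColorClasses {n m : ℕ} (I : Instance n m) where
  open Instance I
  open Solutions I

  lookup-class : ∀ i c → lookup (class c) i ≡ does (κ i Finₚ.≟ c)
  lookup-class i c = Vecₚ.lookup∘tabulate _ i

  ∈-class : ∀ {i c} → i ∈ˢ class c → κ i ≡ c
  ∈-class {i} {c} i∈ = does⇒ (κ i Finₚ.≟ c) (trans (sym (lookup-class i c)) (∈⇒lookup i∈))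

  class-∈ : ∀ i → i ∈ˢ class (κ i)
  class-∈ i = lookup⇒∈ (trans (lookup-class i (κ i)) (dec-true (κ i Finₚ.≟ κ i) refl))

module DPCorrectness {n m : ℕ} (I : Instance n m) (ε : ℚ) (LB : ℤ) where
  open Instance I
  open Solutions I
  open DynamicProgram I ε LB
  open ColorClasses I

  InLevels : ℤ → Set
  InLevels z = zmin ℤ.≤ z × z ℤ.≤ zmax

  p̂-sum : Subset n → ℤ
  p̂-sum S = ∑ℤ (restrict 0ℤ S p̂)

  admit-just : ∀ z v {u} → admit z v ≡ just u → v ≡ just u × InLevels z × u ℕ.≤ b
  admit-just z (just u) e = let x , y , t , q = guard⁻ _ _ _ e in
    cong just q , (does⇒ (zmin ℤₚ.≤? z) x , does⇒ (z ℤₚ.≤? zmax) y) , subst (ℕ._≤ b) q (does⇒ (u ℕₚ.≤? b) t)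

  Below-admit : ∀ {z v k} → InLevels z → k ℕ.≤ b → Below v k → Below (admit z v) k
  Below-admit {z} (p , q) k≤b (u , refl , u≤k) = u ,
    guard⁺ (dec-true (zmin ℤₚ.≤? z) p) (dec-true (z ℤₚ.≤? zmax) q) (dec-true (u ℕₚ.≤? b) (ℕₚ.≤-trans u≤k k≤b)) , u≤k

  ∈-items : ∀ {i c} → i ∈ items c → κ i ≡ c
  ∈-items {c = c} i∈ = proj₂ (∈-filter⁻ (λ i → κ i Finₚ.≟ c) {xs = allFin n} (Anyₚ.reverse⁻ i∈))

  items-∈ : ∀ i → i ∈ items (κ i)
  items-∈ i = Anyₚ.reverse⁺ (∈-filter⁺ (λ j → κ j Finₚ.≟ κ i) (∈-allFin i) refl)

  items-unique : ∀ c → Unique (items c)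
  items-unique c = unique-reverse (Uniqueₚ.filter⁺ (λ i → κ i Finₚ.≟ c) (Uniqueₚ.allFin⁺ n))

  colors-unique : Unique colors
  colors-unique = unique-reverse (Uniqueₚ.allFin⁺ m)

  ∈-colors : ∀ c → c ∈ colors
  ∈-colors c = Anyₚ.reverse⁺ (∈-allFin c)

  -- Soundness of the traces

  -- Each trace step records the transition that attains the entry, so the weight is the stored
  -- value itself and not just bounded by it. Uniqueness of the list keeps the packed item apart
  -- from the items packed before it.
  inner-size : ∀ {is k ζ T} → Unique is → InnerTrace is k ζ T →
    (∀ {i} → i ∈ˢ T → i ∈ is) × ∣ T ∣ ≡ k × p̂-sum T ≡ ζ × (∀ {u} → inner is k ζ ≡ just u → weight T ≡ u)
  inner-size _ start = (λ i∈ → contradiction i∈ Sₚ.∉⊥) , Sₚ.∣⊥∣≡0 n , ∑-∅ ℤₚ.+-0-isCommutativeMonoid p̂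
    , λ { refl → ∑-∅ ℕₚ.+-0-isCommutativeMonoid w }
  inner-size (_ ∷ uniq) (skip e tr) = let sub , card , prof , wt = inner-size uniq tr in
    there ∘ sub , card , prof , λ q → wt (trans (sym e) q)
  inner-size {i ∷ is} {suc k} {ζ} (fresh ∷ uniq) (pack {S = S} e tr) = let sub , card , prof , wt = inner-size uniq tr
                                                                           dis = disjoint sub in
      (λ j∈ → members sub (Sₚ.x∈p∪q⁻ ⁅ i ⁆ S j∈))
    , trans (∣∣-∪ ⁅ i ⁆ S dis) (cong₂ ℕ._+_ (Sₚ.∣⁅x⁆∣≡1 i) card)
    , trans (∑-∪ ℤₚ.+-0-isCommutativeMonoid ⁅ i ⁆ S dis p̂) (trans (cong₂ ℤ._+_ (∑-⁅⁆ ℤₚ.+-0-isCommutativeMonoid i p̂) prof) (m+[n-m]≡n (p̂ i) ζ))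
    , λ q → trans (∑-∪ ℕₚ.+-0-isCommutativeMonoid ⁅ i ⁆ S dis w) (trans (cong (ℕ._+ weight S) (∑-⁅⁆ ℕₚ.+-0-isCommutativeMonoid i w)) (weigh wt (trans (sym e) q)))
    where
    disjoint : (∀ {i} → i ∈ˢ S → i ∈ is) → Disjoint ⁅ i ⁆ S
    disjoint sub = ⁅⁆-disjoint λ i∈S → All.lookup fresh (sub i∈S) refl
    members : (∀ {i} → i ∈ˢ S → i ∈ is) → ∀ {j} → j ∈ˢ ⁅ i ⁆ ⊎ j ∈ˢ S → j ∈ (i ∷ is)
    members sub (inj₁ j∈) = here (Sₚ.x∈⁅y⁆⇒x≡y i j∈)
    members sub (inj₂ j∈) = there (sub j∈)
    weigh : (∀ {u} → inner is k (ζ ℤ.- p̂ i) ≡ just u → weight S ≡ u) →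
            ∀ {u} → packed i (inner is) (suc k) ζ ≡ just u → w i ℕ.+ weight S ≡ u
    weigh wt {u} q =
      let a , a′ , e₁ , e₂ , e₃ = +∞-just {inner is k (ζ ℤ.- p̂ i)} (proj₁ (admit-just ζ (inner is k (ζ ℤ.- p̂ i) +∞ just (w i)) q)) in
      trans (cong (w i ℕ.+_) (wt e₁)) (trans (ℕₚ.+-comm (w i) a) (trans (cong (a ℕ.+_) (just-injective e₂)) (sym e₃)))

  -- For `counts` an upper bound suffices, since the terminal test 2 d ≤ t + 1 then bounds the
  -- maximal count. The field `d≤t` later places d in the range of `states`.
  record Sound (cs : List (Fin m)) (t d : ℕ) (z : ℤ) (S : Subset n) : Set where
    field
      colored : ∀ {i} → i ∈ˢ S → κ i ∈ cs
      size    : ∣ S ∣ ≡ t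
      counts  : ∀ c → count c S ℕ.≤ d
      d≤t     : d ℕ.≤ t
      levelled : p̂-sum S ≡ z
      weighed : ∀ {u} → outer cs (t , d , z) ≡ just u → weight S ≡ u

  transition-just : ∀ {c cs s k ζ u} → transition c (outer cs) s (k , ζ) ≡ just u →
    ∃[ a ] ∃[ a′ ] (outer cs s ≡ just a × h c k ζ ≡ just a′ × u ≡ a ℕ.+ a′) × InLevels (proj₂ (proj₂ s) ℤ.+ ζ)
  transition-just {c} {cs} {s} {k} {ζ} e =
    let q , lev , _ = admit-just (proj₂ (proj₂ s) ℤ.+ ζ) (outer cs s +∞ h c k ζ) e
        a , a′ , e₁ , e₂ , e₃ = +∞-just {outer cs s} q in
    a , a′ , (e₁ , e₂ , e₃) , lev

  -- The colours in the list are distinct, so every item of T has colour c and no item of S has it.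
  -- Hence the union is disjoint, colour c occurs at most ∣T∣ = k times, and the other colours occur
  -- only in S.
  outer-sound : ∀ {cs t d z S} → Unique cs → OuterTrace cs (t , d , z) S → Sound cs t d z S
  outer-sound _ start = record
    { colored = λ i∈ → contradiction i∈ Sₚ.∉⊥
    ; size = Sₚ.∣⊥∣≡0 n
    ; counts = λ c → subst (∣ ∅ ∩ class c ∣ ℕ.≤_) (Sₚ.∣⊥∣≡0 n) (Sₚ.∣p∩q∣≤∣p∣ ∅ (class c))
    ; d≤t = ℕ.z≤n
    ; levelled = ∑-∅ ℤₚ.+-0-isCommutativeMonoid p̂
    ; weighed = λ { refl → ∑-∅ ℕₚ.+-0-isCommutativeMonoid w }
    }
  outer-sound {c ∷ cs} (fresh ∷ uniq) (step {S = S} {T} (t , d , z) k ζ refl e inn out) = record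
    { colored = λ i∈ → members (Sₚ.x∈p∪q⁻ T S i∈)
    ; size = trans (∣∣-∪ T S dis) (trans (cong₂ ℕ._+_ T-size size) (ℕₚ.+-comm k t))
    ; counts = counted
    ; d≤t = ℕₚ.⊔-lub (ℕₚ.≤-trans d≤t (ℕₚ.m≤m+n t k)) (ℕₚ.m≤n+m k t)
    ; levelled = trans (∑-∪ ℤₚ.+-0-isCommutativeMonoid T S dis p̂) (trans (cong₂ ℤ._+_ T-level levelled) (ℤₚ.+-comm ζ z))
    ; weighed = λ q → trans (∑-∪ ℕₚ.+-0-isCommutativeMonoid T S dis w) (weigh (transition-just {c} {cs} {t , d , z} (trans (sym e) q)))
    }
    where
    open Sound (outer-sound uniq out)
    T-sound = inner-size (items-unique c) inn
    T-size = proj₁ (proj₂ T-sound)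
    T-level = proj₁ (proj₂ (proj₂ T-sound))
    T-color : ∀ {i} → i ∈ˢ T → κ i ≡ c
    T-color i∈ = ∈-items (proj₁ T-sound i∈)
    dis : Disjoint T S
    dis i∈T i∈S = All.lookup fresh (colored i∈S) (sym (T-color i∈T))
    members : ∀ {i} → i ∈ˢ T ⊎ i ∈ˢ S → κ i ∈ (c ∷ cs)
    members (inj₁ i∈) = here (T-color i∈)
    members (inj₂ i∈) = there (colored i∈)
    only-T : ∀ {i} → κ i ≡ c → i ∈ˢ T ⊎ i ∈ˢ S → i ∈ˢ T
    only-T e (inj₁ i∈T) = i∈T
    only-T e (inj₂ i∈S) = contradiction (sym e) (All.lookup fresh (colored i∈S))
    only-S : ∀ {i c′} → c′ ≢ c → κ i ≡ c′ → i ∈ˢ T ⊎ i ∈ˢ S → i ∈ˢ S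
    only-S c′≢c e (inj₁ i∈T) = contradiction (trans (sym e) (T-color i∈T)) c′≢c
    only-S c′≢c e (inj₂ i∈S) = i∈S
    ∩⊆T : ((T ∪ S) ∩ class c) ⊆ T
    ∩⊆T i∈ = let i∈∪ , i∈c = Sₚ.x∈p∩q⁻ (T ∪ S) (class c) i∈ in only-T (∈-class i∈c) (Sₚ.x∈p∪q⁻ T S i∈∪)
    ∩⊆S : ∀ {c′} → c′ ≢ c → ((T ∪ S) ∩ class c′) ⊆ (S ∩ class c′)
    ∩⊆S {c′} c′≢c i∈ = let i∈∪ , i∈c′ = Sₚ.x∈p∩q⁻ (T ∪ S) (class c′) i∈ in
      Sₚ.x∈p∩q⁺ (only-S c′≢c (∈-class i∈c′) (Sₚ.x∈p∪q⁻ T S i∈∪) , i∈c′)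
    counted′ : ∀ {c′} → Dec (c′ ≡ c) → count c′ (T ∪ S) ℕ.≤ d ℕ.⊔ k
    counted′ (yes refl) = ℕₚ.≤-trans (subst (count c (T ∪ S) ℕ.≤_) T-size (Sₚ.p⊆q⇒∣p∣≤∣q∣ ∩⊆T)) (ℕₚ.m≤n⊔m d k)
    counted′ {c′} (no c′≢c) = ℕₚ.≤-trans (Sₚ.p⊆q⇒∣p∣≤∣q∣ (∩⊆S c′≢c)) (ℕₚ.≤-trans (counts c′) (ℕₚ.m≤m⊔n d k))
    counted : ∀ c′ → count c′ (T ∪ S) ℕ.≤ d ℕ.⊔ k
    counted c′ = counted′ (c′ Finₚ.≟ c)
    weigh : ∀ {u} → ∃[ a ] ∃[ a′ ] (outer cs (t , d , z) ≡ just a × h c k ζ ≡ just a′ × u ≡ a ℕ.+ a′) × InLevels (z ℤ.+ ζ) →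
            weight T ℕ.+ weight S ≡ u
    weigh (a , a′ , (e₁ , e₂ , e₃) , _) = trans (cong₂ ℕ._+_ (proj₂ (proj₂ (proj₂ T-sound)) e₂) (weighed e₁)) (trans (ℕₚ.+-comm a′ a) (sym e₃))

  -- Backtracking never fails

  inner-trace : ∀ is {k ζ u} → inner is k ζ ≡ just u → ∃[ T ] InnerTrace is k ζ T
  inner-trace [] {k} {ζ} e = let x , y = conjunction (proj₁ (if-just _ e)) in empty (does⇒ (k ℕₚ.≟ 0) x) (does⇒ (ζ ℤₚ.≟ 0ℤ) y)
    where
    empty : ∀ {k ζ} → k ≡ 0 → ζ ≡ 0ℤ → ∃[ T ] InnerTrace [] k ζ T
    empty refl refl = ∅ , start
  inner-trace (i ∷ is) {k} {ζ} {u} e = choose k e (⊓∞-sel {inner is k ζ} e)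
    where
    choose : ∀ k → inner (i ∷ is) k ζ ≡ just u → inner is k ζ ≡ just u ⊎ packed i (inner is) k ζ ≡ just u →
             ∃[ T ] InnerTrace (i ∷ is) k ζ T
    choose k e (inj₁ q) = let T , tr = inner-trace is q in T , skip (trans e (sym q)) tr
    choose (suc k) e (inj₂ q) =
      let a , _ , e₁ , _ = +∞-just {inner is k (ζ ℤ.- p̂ i)} (proj₁ (admit-just ζ (inner is k (ζ ℤ.- p̂ i) +∞ just (w i)) q))
          T , tr = inner-trace is e₁ in
      ⁅ i ⁆ ∪ T , pack (trans e (sym q)) tr

  entered : ∀ {c cs s′ u} → outer (c ∷ cs) s′ ≡ just u →
    ∃[ s ] ∃[ q ] (s ▷ q ≡ s′ × transition c (outer cs) s q ≡ just u)
  entered {c} {cs} {s′} e =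
    let (s , q) , _ , r = minimum∞-attained (enter c (outer cs) s′) (List.cartesianProduct states (pairs c)) e
        x , y = if-just _ r in
    s , q , does⇒ ((s ▷ q) ≟ˢ s′) x , y

  outer-trace : ∀ cs {s u} → outer cs s ≡ just u → ∃[ S ] OuterTrace cs s S
  outer-trace [] {s} e = empty (does⇒ (s ≟ˢ (0 , 0 , 0ℤ)) (proj₁ (if-just _ e)))
    where
    empty : ∀ {s} → s ≡ (0 , 0 , 0ℤ) → ∃[ S ] OuterTrace [] s S
    empty refl = ∅ , start
  outer-trace (c ∷ cs) {s′} e =
    let s , (k , ζ) , e₁ , e₂ = entered {c} {cs} {s′} e
        a , a′ , (f₁ , f₂ , _) , _ = transition-just {c} {cs} {s} {k} {ζ} e₂
        S , out = outer-trace cs f₁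
        T , inn = inner-trace (items c) f₂ in
    T ∪ S , step s k ζ (sym e₁) (trans e (sym e₂)) inn out

  -- Every entry reached by a transition has passed `admit`. The start entry has not, which is why
  -- level 0 is assumed to be in the window.
  outer-level : InLevels 0ℤ → ∀ cs {t d z u} → outer cs (t , d , z) ≡ just u → InLevels z
  outer-level lev₀ [] {t} {d} {z} e =
    subst InLevels (sym (cong (proj₂ ∘ proj₂) (does⇒ ((t , d , z) ≟ˢ (0 , 0 , 0ℤ)) (proj₁ (if-just _ e))))) lev₀
  outer-level lev₀ (c ∷ cs) {t} {d} {z} e =
    let s , (k , ζ) , e₁ , e₂ = entered {c} {cs} {t , d , z} e
        _ , _ , _ , lev = transition-just {c} {cs} {s} {k} {ζ} e₂ in
    subst InLevels (cong (proj₂ ∘ proj₂) e₁) lev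

-- Completeness of the dynamic program and existence of an output

module DPCompleteness {n m : ℕ} (I : Instance n m) (ε : ℚ) (LB : ℤ) where
  open Instance I
  open Solutions I
  open DynamicProgram I ε LB
  open ColorClasses I
  open DPCorrectness I ε LB

  weight-mono : ∀ {S T} → S ⊆ T → weight S ℕ.≤ weight T
  weight-mono {S} {T} S⊆T = mono (restrict 0 S w) (restrict 0 T w) pointwise
    where
    mono : ∀ {k} (f g : Fin k → ℕ) → (∀ i → f i ℕ.≤ g i) → ∑ℕ f ℕ.≤ ∑ℕ g
    mono {zero}  f g q = ℕ.z≤n
    mono {suc k} f g q = ℕₚ.+-mono-≤ (q zero) (mono (f ∘ suc) (g ∘ suc) (q ∘ suc))
    pointwise : ∀ i → restrict 0 S w i ℕ.≤ restrict 0 T w i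
    pointwise i with lookup S i in e
    ... | false = ℕ.z≤n
    ... | true  = ℕₚ.≤-reflexive (cong (if_then w i else 0) (sym (∈⇒lookup (S⊆T (lookup⇒∈ e)))))

  ∈-levels : ∀ {z} → InLevels z → z ∈ levels
  ∈-levels {z} (p , q) = subst (_∈ levels) (trans (cong (λ y → zmin ℤ.+ y) (ℤₚ.0≤i⇒+∣i∣≡i (ℤₚ.i≤j⇒0≤j-i p))) (m+[n-m]≡n zmin z))
    (∈-map⁺ (λ j → zmin ℤ.+ + j) (∈-upTo⁺ (ℕ.s≤s (ℤₚ.drop‿+≤+
      (subst₂ ℤ._≤_ (sym (ℤₚ.0≤i⇒+∣i∣≡i (ℤₚ.i≤j⇒0≤j-i p))) (sym (ℤₚ.0≤i⇒+∣i∣≡i (ℤₚ.i≤j⇒0≤j-i (ℤₚ.≤-trans p q))))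
        (ℤₚ.+-monoˡ-≤ (ℤ.- zmin) q))))))

  ∈-states : ∀ {t d z} → t ℕ.≤ n → d ℕ.≤ n → InLevels z → (t , d , z) ∈ states
  ∈-states t≤n d≤n lev = ∈-cartesianProduct⁺ (∈-upTo⁺ (ℕ.s≤s t≤n)) (∈-cartesianProduct⁺ (∈-upTo⁺ (ℕ.s≤s d≤n)) (∈-levels lev))

  module _ (S : Subset n) (S-levels : ∀ T → T ⊆ S → InLevels (p̂-sum T)) (S-fits : weight S ℕ.≤ b) where

    fits : ∀ {T} → T ⊆ S → weight T ℕ.≤ b
    fits T⊆S = ℕₚ.≤-trans (weight-mono T⊆S) S-fits

    -- The trace of S on the processed items, defined by the recursion of `inner` so that set and
    -- table unfold together.
    pick : List (Fin n) → Subset n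
    pick []       = ∅
    pick (i ∷ is) = if lookup S i then ⁅ i ⁆ ∪ pick is else pick is

    pick-⊆ : ∀ is {j} → j ∈ˢ pick is → j ∈ˢ S × j ∈ is
    pick-⊆ [] j∈ = contradiction j∈ Sₚ.∉⊥
    pick-⊆ (i ∷ is) j∈ with lookup S i in e
    ... | false = let q , r = pick-⊆ is j∈ in q , there r
    ... | true with Sₚ.x∈p∪q⁻ ⁅ i ⁆ (pick is) j∈
    ...   | inj₁ j∈i = let j≡i = Sₚ.x∈⁅y⁆⇒x≡y i j∈i in subst (_∈ˢ S) (sym j≡i) (lookup⇒∈ e) , here j≡i
    ...   | inj₂ j∈′ = let q , r = pick-⊆ is j∈′ in q , there r

    pick-∈ : ∀ is {j} → j ∈ˢ S → j ∈ is → j ∈ˢ pick is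
    pick-∈ (i ∷ is) j∈S (here refl) = subst (λ b → i ∈ˢ (if b then ⁅ i ⁆ ∪ pick is else pick is)) (sym (∈⇒lookup j∈S))
      (Sₚ.x∈p∪q⁺ (inj₁ (Sₚ.x∈⁅x⁆ i)))
    pick-∈ (i ∷ is) j∈S (there j∈) with lookup S i
    ... | true  = Sₚ.x∈p∪q⁺ (inj₂ (pick-∈ is j∈S j∈))
    ... | false = pick-∈ is j∈S j∈

    pick-items : ∀ c → pick (items c) ≡ S ∩ class c
    pick-items c = Sₚ.⊆-antisym
      (λ i∈ → let i∈S , i∈c = pick-⊆ (items c) i∈ in Sₚ.x∈p∩q⁺ (i∈S , subst (λ c → _ ∈ˢ class c) (∈-items i∈c) (class-∈ _)))
      (λ i∈ → let i∈S , i∈c = Sₚ.x∈p∩q⁻ S (class c) i∈ in pick-∈ (items c) i∈S (subst (λ c → _ ∈ items c) (∈-class i∈c) (items-∈ _)))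

    -- The items of S seen so far always form a subset of S, so every packing transition on the way
    -- stays in the window and within the capacity.
    inner-complete : ∀ is → Unique is → Below (inner is ∣ pick is ∣ (p̂-sum (pick is))) (weight (pick is))
    inner-complete [] _ = subst₂ (λ k ζ → Below (inner [] k ζ) (weight ∅)) (sym (Sₚ.∣⊥∣≡0 n)) (sym (∑-∅ ℤₚ.+-0-isCommutativeMonoid p̂))
      (0 , refl , ℕ.z≤n)
    inner-complete (i ∷ is) (fresh ∷ uniq) = choose (lookup S i) refl
      where
      T = pick is
      ih = inner-complete is uniq
      choose : ∀ b → lookup S i ≡ b → Below (inner (i ∷ is) ∣ if b then ⁅ i ⁆ ∪ T else T ∣ (p̂-sum (if b then ⁅ i ⁆ ∪ T else T)))
                                            (weight (if b then ⁅ i ⁆ ∪ T else T))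
      choose false e = Below-⊓ˡ ih
      choose true  e = subst₂ (λ k u → Below (inner (i ∷ is) k ζ) u)
          (sym (trans (∣∣-∪ ⁅ i ⁆ T dis) (cong (ℕ._+ ∣ T ∣) (Sₚ.∣⁅x⁆∣≡1 i)))) (sym weighed)
          (Below-⊓ʳ {inner is (suc ∣ T ∣) ζ} (Below-admit (S-levels (⁅ i ⁆ ∪ T) sub) (subst (ℕ._≤ b) weighed (fits sub))
            (subst (λ z → Below (inner is ∣ T ∣ z +∞ just (w i)) (weight T ℕ.+ w i)) back (Below-+ ih (w i , refl , ℕₚ.≤-refl)))))
        where
        dis : Disjoint ⁅ i ⁆ T
        dis = ⁅⁆-disjoint λ i∈T → All.lookup fresh (proj₂ (pick-⊆ is i∈T)) refl
        ζ = p̂-sum (⁅ i ⁆ ∪ T)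
        member : ∀ {j} → j ∈ˢ ⁅ i ⁆ ⊎ j ∈ˢ T → j ∈ˢ S
        member (inj₁ j∈i) = subst (_∈ˢ S) (sym (Sₚ.x∈⁅y⁆⇒x≡y i j∈i)) (lookup⇒∈ e)
        member (inj₂ j∈T) = proj₁ (pick-⊆ is j∈T)
        sub : (⁅ i ⁆ ∪ T) ⊆ S
        sub j∈ = member (Sₚ.x∈p∪q⁻ ⁅ i ⁆ T j∈)
        weighed : weight (⁅ i ⁆ ∪ T) ≡ weight T ℕ.+ w i
        weighed = trans (∑-∪ ℕₚ.+-0-isCommutativeMonoid ⁅ i ⁆ T dis w)
          (trans (cong (ℕ._+ weight T) (∑-⁅⁆ ℕₚ.+-0-isCommutativeMonoid i w)) (ℕₚ.+-comm (w i) (weight T)))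
        back : p̂-sum T ≡ ζ ℤ.- p̂ i
        back = sym (trans (cong (λ y → y ℤ.- p̂ i) (trans (∑-∪ ℤₚ.+-0-isCommutativeMonoid ⁅ i ⁆ T dis p̂)
            (trans (cong (λ y → y ℤ.+ p̂-sum T) (∑-⁅⁆ ℤₚ.+-0-isCommutativeMonoid i p̂)) (ℤₚ.+-comm (p̂ i) (p̂-sum T)))))
          (trans (ℤₚ.+-assoc (p̂-sum T) (p̂ i) (ℤ.- p̂ i)) (trans (cong (λ y → p̂-sum T ℤ.+ y) (ℤₚ.+-inverseʳ (p̂ i))) (ℤₚ.+-identityʳ (p̂-sum T)))))

    gather : List (Fin m) → Subset n
    gather []       = ∅
    gather (c ∷ cs) = (S ∩ class c) ∪ gather cs

    -- The d-coordinate along the outer program, with the arguments of the maximum in the order of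
    -- `_▷_`, so that `moves` holds definitionally in this coordinate.
    largest : List (Fin m) → ℕ
    largest []       = 0
    largest (c ∷ cs) = largest cs ℕ.⊔ count c S

    gather-⊆ : ∀ cs {j} → j ∈ˢ gather cs → j ∈ˢ S × κ j ∈ cs
    gather-⊆ [] j∈ = contradiction j∈ Sₚ.∉⊥
    gather-⊆ (c ∷ cs) j∈ with Sₚ.x∈p∪q⁻ (S ∩ class c) (gather cs) j∈
    ... | inj₁ j∈′ = let q , r = Sₚ.x∈p∩q⁻ S (class c) j∈′ in q , here (∈-class r)
    ... | inj₂ j∈′ = let q , r = gather-⊆ cs j∈′ in q , there r

    gather-∈ : ∀ cs {j} → j ∈ˢ S → κ j ∈ cs → j ∈ˢ gather cs
    gather-∈ (c ∷ cs) {j} j∈S (here e)   = Sₚ.x∈p∪q⁺ (inj₁ (Sₚ.x∈p∩q⁺ (j∈S , subst (λ c → j ∈ˢ class c) e (class-∈ j))))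
    gather-∈ (c ∷ cs) j∈S (there q)      = Sₚ.x∈p∪q⁺ (inj₂ (gather-∈ cs j∈S q))

    gather-colors : gather colors ≡ S
    gather-colors = Sₚ.⊆-antisym (λ j∈ → proj₁ (gather-⊆ colors j∈)) (λ j∈ → gather-∈ colors j∈ (∈-colors _))

    largest≤ : ∀ cs → largest cs ℕ.≤ maxCount S
    largest≤ []       = ℕ.z≤n
    largest≤ (c ∷ cs) = ℕₚ.⊔-lub (largest≤ cs) (⊔-fold-upper (λ c → count c S) c)

    largest≤n : ∀ cs → largest cs ℕ.≤ n
    largest≤n []       = ℕ.z≤n
    largest≤n (c ∷ cs) = ℕₚ.⊔-lub (largest≤n cs) (Sₚ.∣p∣≤n (S ∩ class c))

    state : List (Fin m) → State
    state cs = ∣ gather cs ∣ , largest cs , p̂-sum (gather cs)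

    outer-complete : ∀ cs → Unique cs → Below (outer cs (state cs)) (weight (gather cs))
    outer-complete [] _ = subst₂ (λ t z → Below (outer [] (t , 0 , z)) (weight ∅)) (sym (Sₚ.∣⊥∣≡0 n)) (sym (∑-∅ ℤₚ.+-0-isCommutativeMonoid p̂))
      (0 , refl , ℕ.z≤n)
    outer-complete (c ∷ cs) (fresh ∷ uniq) =
      Below-minimum (enter c (outer cs) s′) {state cs , q} (∈-cartesianProduct⁺ s∈ q∈)
        (subst (λ b → Below (if b then transition c (outer cs) (state cs) q else nothing) (weight (A ∪ G)))
          (sym (dec-true ((state cs ▷ q) ≟ˢ s′) moves))
          (Below-admit (subst InLevels (cong (proj₂ ∘ proj₂) (sym moves)) (S-levels (A ∪ G) sub)) (fits sub)
            (subst (Below (outer cs (state cs) +∞ h c ∣ A ∣ (p̂-sum A))) (trans (ℕₚ.+-comm (weight G) (weight A)) (sym (∑-∪ ℕₚ.+-0-isCommutativeMonoid A G dis w)))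
              (Below-+ (outer-complete cs uniq)
                (subst (λ T → Below (h c ∣ T ∣ (p̂-sum T)) (weight T)) (pick-items c) (inner-complete (items c) (items-unique c)))))))
      where
      A = S ∩ class c
      G = gather cs
      q = ∣ A ∣ , p̂-sum A
      s′ = state (c ∷ cs)
      A⊆S : A ⊆ S
      A⊆S = Sₚ.p∩q⊆p S (class c)
      G⊆S : G ⊆ S
      G⊆S j∈ = proj₁ (gather-⊆ cs j∈)
      sub : (A ∪ G) ⊆ S
      sub j∈ = proj₁ (gather-⊆ (c ∷ cs) j∈)
      dis : Disjoint A G
      dis j∈A j∈G = All.lookup fresh (proj₂ (gather-⊆ cs j∈G)) (sym (∈-class (proj₂ (Sₚ.x∈p∩q⁻ S (class c) j∈A))))
      s∈ : state cs ∈ states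
      s∈ = ∈-states (Sₚ.∣p∣≤n G) (largest≤n cs) (S-levels G G⊆S)
      q∈ : q ∈ pairs c
      q∈ = ∈-cartesianProduct⁺ (∈-upTo⁺ (ℕ.s≤s (Sₚ.∣p∩q∣≤∣q∣ S (class c)))) (∈-levels (S-levels A A⊆S))
      moves : (state cs ▷ q) ≡ s′
      moves = cong₂ (λ t z → t , largest cs ℕ.⊔ ∣ A ∣ , z)
        (trans (ℕₚ.+-comm ∣ G ∣ ∣ A ∣) (sym (∣∣-∪ A G dis)))
        (trans (ℤₚ.+-comm (p̂-sum G) (p̂-sum A)) (sym (∑-∪ ℤₚ.+-0-isCommutativeMonoid A G dis p̂)))

    terminal-reached : ColorFeasible S → Terminal (∣ S ∣ , largest colors , p̂-sum S)
    terminal-reached cf = (let u , e , u≤ = reached in u , e , ℕₚ.≤-trans u≤ S-fits)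
                        , ℕₚ.≤-trans (ℕₚ.*-monoʳ-≤ 2 (largest≤ colors)) cf
      where
      reached : Below (outer colors (∣ S ∣ , largest colors , p̂-sum S)) (weight S)
      reached = subst (λ T → Below (outer colors (∣ T ∣ , largest colors , p̂-sum T)) (weight T)) gather-colors (outer-complete colors colors-unique)

  terminal? : ∀ s → Dec (Terminal s)
  terminal? s@(t , d , z) = reached? (outer colors s) refl ×-dec (2 ℕ.* d ℕₚ.≤? t ℕ.+ 1)
    where
    reached? : ∀ v → outer colors s ≡ v → Dec (∃[ u ] outer colors s ≡ just u × u ℕ.≤ b)
    reached? nothing  e = no λ (u , e′ , _) → nothing≢just (trans (sym e) e′)
      where
      nothing≢just : ∀ {u : ℕ} → nothing ≢ just u
      nothing≢just ()
    reached? (just u) e = Dec.map′ (λ u≤b → u , e , u≤b) (λ (u′ , e′ , u′≤b) → subst (ℕ._≤ b) (just-injective (trans (sym e′) e)) u′≤b) (u ℕₚ.≤? b)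

  terminal-sound : ∀ {t d z} → Terminal (t , d , z) → ∃[ S ] (OuterTrace colors (t , d , z) S × Sound colors t d z S)
  terminal-sound ((u , e , _) , _) = let S , tr = outer-trace colors e in S , tr , outer-sound colors-unique tr

  -- `outer` is defined on the infinite type `State`, so a maximal terminal level needs a finiteness
  -- argument: a terminal entry backtracks to a set, whose size is t and bounds d.
  terminal∈states : InLevels 0ℤ → ∀ {t d z} → Terminal (t , d , z) → (t , d , z) ∈ states
  terminal∈states lev₀ {t} {d} {z} term@((u , e , _) , _) = ∈-states t≤n (ℕₚ.≤-trans d≤t t≤n) (outer-level lev₀ colors e)
    where
    open Sound (proj₂ (proj₂ (terminal-sound term)))
    t≤n : t ℕ.≤ n
    t≤n = subst (ℕ._≤ n) size (Sₚ.∣p∣≤n (proj₁ (terminal-sound term)))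

  output-exists : InLevels 0ℤ → ∀ {s} → Terminal s → ∃[ S ] Output S
  output-exists lev₀ {s} term = S , record { terminal = terminal ; maximal = maximal ; trace = trace }
    where
    listed : ∀ {t d z} → Terminal (t , d , z) → (t , d , z) ∈ filter terminal? states
    listed q = ∈-filter⁺ terminal? (terminal∈states lev₀ q) q
    best : ∃[ a ] (a ∈ filter terminal? states × (∀ {s} → s ∈ filter terminal? states → proj₂ (proj₂ s) ℤ.≤ proj₂ (proj₂ a)))
    best = least (λ a b → ℤₚ.≤-total (proj₂ (proj₂ b)) (proj₂ (proj₂ a))) (λ p q → ℤₚ.≤-trans q p) (listed term)
    terminal : Terminal (proj₁ best)
    terminal = proj₂ (∈-filter⁻ terminal? {xs = states} (proj₁ (proj₂ best)))
    maximal : ∀ t′ d′ z′ → Terminal (t′ , d′ , z′) → z′ ℤ.≤ proj₂ (proj₂ (proj₁ best))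
    maximal t′ d′ z′ q = proj₂ (proj₂ best) (listed q)
    S = proj₁ (terminal-sound terminal)
    trace = proj₁ (proj₂ (terminal-sound terminal))

  output-feasible : ∀ {S} → Output S → Feasible S
  output-feasible {S} out = ℕₚ.≤-trans (ℕₚ.*-monoʳ-≤ 2 maxCount≤d) (subst (λ t → 2 ℕ.* d ℕ.≤ t ℕ.+ 1) (sym size) (proj₂ terminal))
    , subst (ℕ._≤ b) (sym (weighed (proj₁ (proj₂ (proj₁ terminal))))) (proj₂ (proj₂ (proj₁ terminal)))
    where
    open Output out
    open Sound (outer-sound colors-unique trace)
    fold-lub : ∀ {k} (f : Fin k → ℕ) → (∀ c → f c ℕ.≤ d) → Vector.foldr ℕ._⊔_ 0 f ℕ.≤ d
    fold-lub {zero}  f q = ℕ.z≤n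
    fold-lub {suc k} f q = ℕₚ.⊔-lub (q zero) (fold-lub (f ∘ suc) (q ∘ suc))
    maxCount≤d : maxCount S ℕ.≤ d
    maxCount≤d = fold-lub (λ c → count c S) counts

  output-dominates : ∀ {S T} → Output S → Feasible T → (∀ T′ → T′ ⊆ T → InLevels (p̂-sum T′)) → p̂-sum T ℤ.≤ p̂-sum S
  output-dominates {S} {T} out (cf , fits) levels-T = subst (p̂-sum T ℤ.≤_) (sym levelled) (maximal _ _ _ (terminal-reached T levels-T fits cf))
    where
    open Output out
    open Sound (outer-sound colors-unique trace)

-- The window of levels and the approximation ratio

if-elim : ∀ {A : Set} (Q : ℤ → Set) (a? : Dec A) {x y} → (A → Q x) → (¬ A → Q y) → Q (if does a? then x else y)
if-elim Q (yes a) f g = f a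
if-elim Q (no ¬a) f g = g ¬a

dot-linearˡ : ∀ {n} k (g : Fin n → ℚ) l h x →
              dot (λ i → k ℚ.* g i ℚ.+ l ℚ.* h i) x ≡ k ℚ.* dot g x ℚ.+ l ℚ.* dot h x
dot-linearˡ k g l h x = trans (dot-comm (λ i → k ℚ.* g i ℚ.+ l ℚ.* h i) x) (trans (dot-linear x k g l h)
  (cong₂ (λ u v → k ℚ.* u ℚ.+ l ℚ.* v) (dot-comm x g) (dot-comm x h)))

dot-ones : ∀ n → dot {n} (λ _ → 1ℚ) (λ _ → 1ℚ) ≡ fromℕ n
dot-ones zero    = refl
dot-ones (suc n) = trans (cong (1ℚ ℚ.+_) (dot-ones n)) (sym (fromℕ-suc n))

χ-⊆-elim : ∀ {n} {T S : Subset n} (Q : ℚ → ℚ → Set) → T ⊆ S → Q 1ℚ 1ℚ → Q 0ℚ 1ℚ → Q 0ℚ 0ℚ → ∀ i → Q (χ T i) (χ S i)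
χ-⊆-elim {T = T} {S} Q T⊆S q₁₁ q₀₁ q₀₀ i with lookup T i in t | lookup S i in s
... | true  | true  = q₁₁
... | false | true  = q₀₁
... | false | false = q₀₀
... | true  | false = false≢true (trans (sym s) (∈⇒lookup (T⊆S (lookup⇒∈ t))))

argmax : ∀ {n} (f : Fin n → ℤ) → 0ℤ ℤ.< maximum f → ∃[ i ] f i ≡ maximum f
argmax {zero}  f 0<0 = contradiction 0<0 (ℤₚ.<-irrefl refl)
argmax {suc n} f _   = maximum-attained f

module Approximation {n m : ℕ} (I : Instance n m)
  (w≤b : ∀ i → Instance.w I i ℕ.≤ Instance.b I)
  (p-range : ∀ i → (ℤ.- Solutions.pmax I) ℤ.< Instance.p I i × Instance.p I i ℤ.≤ Solutions.pmax I)
  (0<pmax : 0ℤ ℤ.< Solutions.pmax I)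
  (ε : ℚ) (0<ε : 0ℚ ℚ.< ε) (ε<1 : ε ℚ.< 1ℚ)
  {S₁ : Subset n} (lpRound : LinearProgram.LPRound I S₁) where
  open Instance I
  open Solutions I
  open Relaxation I using (P)
  open Encoding I using (profit-dot)
  open LPRounding I w≤b (proj₂ ∘ p-range) 0<pmax using (M; 0<M; P≤M; lpRound-bound)

  LB : ℤ
  LB = profit S₁

  open DynamicProgram I ε LB
  open DPCorrectness I ε LB using (p̂-sum; InLevels)
  open DPCompleteness I ε LB

  S₁-feasible : Feasible S₁
  S₁-feasible = proj₁ (lpRound-bound lpRound)

  pmax≤LB : pmax ℤ.≤ LB
  pmax≤LB = proj₁ (proj₂ (lpRound-bound lpRound))

  ≤UB : ∀ T → Feasible T → profit T ℤ.≤ UB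
  ≤UB = proj₂ (proj₂ (lpRound-bound lpRound))

  N : ℚ
  N = fromℕ n

  0<N : 0ℚ ℚ.< N
  0<N = 0<fromℕ (nonempty (proj₁ (argmax p 0<pmax)))
    where
    nonempty : ∀ {k} → Fin k → 0 ℕ.< k
    nonempty {suc k} _ = ℕ.s≤s ℕ.z≤n

  0<LB : 0ℚ ℚ.< fromℤ LB
  0<LB = ℚₚ.<-≤-trans 0<M (fromℤ-mono-≤ pmax≤LB)

  -M≤P : ∀ i → ℚ.- M ℚ.≤ P i
  -M≤P i = subst (ℚ._≤ P i) (fromℤ-neg pmax) (fromℤ-mono-≤ (ℤₚ.<⇒≤ (proj₁ (p-range i))))

  size : Subset n → ℚ
  size T = dot (λ _ → 1ℚ) (χ T)

  size≤N : ∀ T → size T ℚ.≤ N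
  size≤N T = subst (ℚ._≤ N) (∣∣-dot T) (fromℕ-mono-≤ (Sₚ.∣p∣≤n T))

  constant : ∀ k l T → dot (λ _ → 1ℚ) (λ i → k ℚ.* 1ℚ ℚ.+ l ℚ.* χ T i) ≡ k ℚ.* N ℚ.+ l ℚ.* size T
  constant k l T = trans (dot-linear (λ _ → 1ℚ) k (λ _ → 1ℚ) l (χ T)) (cong (λ u → k ℚ.* u ℚ.+ l ℚ.* size T) (dot-ones n))

  -- The correction is M (n - ∣T∣): at most n - ∣T∣ items of S are omitted, each of profit at most
  -- M.
  subset-lower : ∀ {T S} → T ⊆ S → dot P (χ S) ℚ.≤ dot P (χ T) ℚ.+ (M ℚ.* N ℚ.+ (ℚ.- M) ℚ.* size T)
  subset-lower {T} {S} T⊆S = subst (dot P (χ S) ℚ.≤_)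
    (trans (∑ℚ-distrib-+ (λ i → P i ℚ.* χ T i) (λ i → 1ℚ ℚ.* (M ℚ.* 1ℚ ℚ.+ (ℚ.- M) ℚ.* χ T i))) (cong (dot P (χ T) ℚ.+_) (constant M (ℚ.- M) T)))
    (∑ℚ-mono λ i → χ-⊆-elim (λ t s → P i ℚ.* s ℚ.≤ P i ℚ.* t ℚ.+ 1ℚ ℚ.* (M ℚ.* 1ℚ ℚ.+ (ℚ.- M) ℚ.* t)) T⊆S
      (ℚₚ.≤-reflexive (solve 2 (λ p m → p :* con 1ℚ := p :* con 1ℚ :+ con 1ℚ :* (m :* con 1ℚ :+ (:- m) :* con 1ℚ)) refl (P i) M))
      (≤-by (M ℚ.- P i) (≤⇒0≤- (P≤M i))
        (solve 2 (λ p m → p :* con 0ℚ :+ con 1ℚ :* (m :* con 1ℚ :+ (:- m) :* con 0ℚ) := p :* con 1ℚ :+ (m :- p)) refl (P i) M))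
      (≤-by M (ℚₚ.<⇒≤ 0<M)
        (solve 2 (λ p m → p :* con 0ℚ :+ con 1ℚ :* (m :* con 1ℚ :+ (:- m) :* con 0ℚ) := p :* con 0ℚ :+ m) refl (P i) M)) i)

  -- Omitting an item of negative profit gains at most M, and M is allowed once per index. The
  -- summand with factor 0 gives the correction the shape of `constant`.
  subset-upper : ∀ {T S} → T ⊆ S → dot P (χ T) ℚ.≤ dot P (χ S) ℚ.+ (M ℚ.* N ℚ.+ 0ℚ ℚ.* size T)
  subset-upper {T} {S} T⊆S = subst (dot P (χ T) ℚ.≤_)
    (trans (∑ℚ-distrib-+ (λ i → P i ℚ.* χ S i) (λ i → 1ℚ ℚ.* (M ℚ.* 1ℚ ℚ.+ 0ℚ ℚ.* χ T i))) (cong (dot P (χ S) ℚ.+_) (constant M 0ℚ T)))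
    (∑ℚ-mono λ i → χ-⊆-elim (λ t s → P i ℚ.* t ℚ.≤ P i ℚ.* s ℚ.+ 1ℚ ℚ.* (M ℚ.* 1ℚ ℚ.+ 0ℚ ℚ.* t)) T⊆S
      (≤-by M (ℚₚ.<⇒≤ 0<M)
        (solve 2 (λ p m → p :* con 1ℚ :+ con 1ℚ :* (m :* con 1ℚ :+ con 0ℚ :* con 1ℚ) := p :* con 1ℚ :+ m) refl (P i) M))
      (≤-by (P i ℚ.- ℚ.- M) (≤⇒0≤- (-M≤P i))
        (solve 2 (λ p m → p :* con 1ℚ :+ con 1ℚ :* (m :* con 1ℚ :+ con 0ℚ :* con 0ℚ) := p :* con 0ℚ :+ (p :- (:- m))) refl (P i) M))
      (≤-by M (ℚₚ.<⇒≤ 0<M)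
        (solve 2 (λ p m → p :* con 0ℚ :+ con 1ℚ :* (m :* con 1ℚ :+ con 0ℚ :* con 0ℚ) := p :* con 0ℚ :+ m) refl (P i) M)) i)

  subset-mono : (∀ i → 0ℤ ℤ.≤ p i) → ∀ {T S} → T ⊆ S → dot P (χ T) ℚ.≤ dot P (χ S)
  subset-mono 0≤p T⊆S = ∑ℚ-mono λ i → χ-⊆-elim (λ t s → P i ℚ.* t ℚ.≤ P i ℚ.* s) T⊆S
    ℚₚ.≤-refl (≤-by (P i) (fromℤ-mono-≤ (0≤p i)) (solve 1 (λ p → p :* con 1ℚ := p :* con 0ℚ :+ p) refl (P i))) ℚₚ.≤-refl i

  scale-N : scale ℚ.* N ≡ ε ℚ.* fromℤ LB
  scale-N = ÷₀-* (ε ℚ.* fromℤ LB) (0<⇒≢0 0<N)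

  0<scale : 0ℚ ℚ.< scale
  0<scale = ℚₚ.*-cancelʳ-<-nonNeg N {{ℚ.nonNegative (ℚₚ.<⇒≤ 0<N)}}
    (subst₂ ℚ._<_ (sym (ℚₚ.*-zeroˡ N)) (sym scale-N) (0<* 0<ε 0<LB))

  -- Multiplied by n this reads ε LB ≤ n M. It follows from ε < 1 and from LB ≤ n M, which is
  -- `subset-lower` for the empty subset of `S₁`.
  scale≤M : scale ℚ.≤ M
  scale≤M = ℚₚ.*-cancelʳ-≤-pos N {{ℚ.positive 0<N}} (subst (ℚ._≤ M ℚ.* N) (sym scale-N)
    (≤-by ((1ℚ ℚ.- ε) ℚ.* fromℤ LB ℚ.+ ((dot P (χ ∅) ℚ.+ (M ℚ.* N ℚ.+ (ℚ.- M) ℚ.* size ∅)) ℚ.- dot P (χ S₁)))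
      (0≤+ (0≤* (ℚₚ.<⇒≤ (<⇒0<- ε<1)) (ℚₚ.<⇒≤ 0<LB)) (≤⇒0≤- (subset-lower {∅} {S₁} Sₚ.⊥⊆)))
      (trans (solve 4 (λ m n e l → m :* n := e :* l :+ ((con 1ℚ :- e) :* l :+ ((con 0ℚ :+ (m :* n :+ (:- m) :* con 0ℚ)) :- l))) refl M N ε (fromℤ LB))
        (cong (λ u → ε ℚ.* fromℤ LB ℚ.+ ((1ℚ ℚ.- ε) ℚ.* fromℤ LB ℚ.+ u))
          (cong₂ ℚ._-_ (cong₂ (λ a s → a ℚ.+ (M ℚ.* N ℚ.+ (ℚ.- M) ℚ.* s)) (sym (empty P)) (sym (empty λ _ → 1ℚ))) (profit-dot S₁))))))
    where
    empty : ∀ g → dot g (χ ∅) ≡ 0ℚ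
    empty g = dot-0 g {χ ∅} λ i → χ-∉ {S = ∅} {i} Sₚ.∉⊥

  P̂ : Fin n → ℚ
  P̂ i = fromℤ (p̂ i)

  p̂-dot : ∀ T → fromℤ (p̂-sum T) ≡ dot P̂ (χ T)
  p̂-dot T = trans (fromℤ-∑ (restrict 0ℤ T p̂)) (dot-∑ fromℤ 0ℤ refl T p̂)

  ÷scale-* : ∀ x → (x ÷₀ scale) ℚ.* scale ≡ x
  ÷scale-* x = ÷₀-* x (0<⇒≢0 0<scale)

  ≤÷ : ∀ {a x} → a ℚ.* scale ℚ.≤ x → a ℚ.≤ x ÷₀ scale
  ≤÷ {a} {x} q = ℚₚ.*-cancelʳ-≤-pos scale {{ℚ.positive 0<scale}} (subst (a ℚ.* scale ℚ.≤_) (sym (÷scale-* x)) q)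

  ÷≤ : ∀ {a x} → x ℚ.≤ a ℚ.* scale → x ÷₀ scale ℚ.≤ a
  ÷≤ {a} {x} q = ℚₚ.*-cancelʳ-≤-pos scale {{ℚ.positive 0<scale}} (subst (ℚ._≤ a ℚ.* scale) (sym (÷scale-* x)) q)

  -- The floor rounds towards minus infinity, so scale times `p̂ i` is at most `p i` for negative
  -- profits too.
  rounding-lower : ∀ T → scale ℚ.* fromℤ (p̂-sum T) ℚ.≤ dot P (χ T)
  rounding-lower T = subst (ℚ._≤ dot P (χ T))
    (trans (dot-linearˡ scale P̂ 0ℚ (λ _ → 1ℚ) (χ T)) (trans (solve 2 (λ a s → a :+ con 0ℚ :* s := a) refl (scale ℚ.* dot P̂ (χ T)) (size T))
      (cong (scale ℚ.*_) (sym (p̂-dot T)))))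
    (dot-mono (λ i → scale ℚ.* P̂ i ℚ.+ 0ℚ ℚ.* 1ℚ) P (0≤χ T) λ i → ≤-by ((P i ÷₀ scale ℚ.- P̂ i) ℚ.* scale)
      (0≤* (≤⇒0≤- (floor≤ (P i ÷₀ scale))) (ℚₚ.<⇒≤ 0<scale))
      (trans (sym (÷scale-* (P i))) (solve 3 (λ q f s → q :* s := (s :* f :+ con 0ℚ :* con 1ℚ) :+ (q :- f) :* s) refl (P i ÷₀ scale) (P̂ i) scale)))

  rounding-upper : ∀ T → dot P (χ T) ℚ.≤ scale ℚ.* fromℤ (p̂-sum T) ℚ.+ scale ℚ.* size T
  rounding-upper T = subst (dot P (χ T) ℚ.≤_)
    (trans (dot-linearˡ scale P̂ scale (λ _ → 1ℚ) (χ T)) (cong (λ u → scale ℚ.* u ℚ.+ scale ℚ.* size T) (sym (p̂-dot T))))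
    (dot-mono P (λ i → scale ℚ.* P̂ i ℚ.+ scale ℚ.* 1ℚ) (0≤χ T) λ i → ≤-by ((P̂ i ℚ.+ 1ℚ ℚ.- P i ÷₀ scale) ℚ.* scale)
      (0≤* (≤⇒0≤- (ℚₚ.<⇒≤ (<floor+1 (P i ÷₀ scale)))) (ℚₚ.<⇒≤ 0<scale))
      (trans (solve 3 (λ q f s → s :* f :+ s :* con 1ℚ := q :* s :+ ((f :+ con 1ℚ) :- q) :* s) refl (P i ÷₀ scale) (P̂ i) scale)
        (cong (ℚ._+ (P̂ i ℚ.+ 1ℚ ℚ.- P i ÷₀ scale) ℚ.* scale) (÷scale-* (P i)))))

  fromℤ-nM : fromℤ (+ n ℤ.* pmax) ≡ N ℚ.* M
  fromℤ-nM = fromℤ-* (+ n) pmax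

  -- Packing only part of S loses at most pmax per omitted item, and rounding
  -- loses at most scale ≤ pmax per packed item.
  level-lower : ∀ {T S} → 0ℤ ℤ.≤ profit S → T ⊆ S → zmin ℤ.≤ p̂-sum T
  level-lower {T} {S} 0≤p T⊆S = if-elim (ℤ._≤ p̂-sum T) nonNegative?
    (λ 0≤ → fromℤ-cancel-≤ {0ℤ} {p̂-sum T} (subst₂ ℚ._≤_ (trans (dot-comm (λ _ → 0ℚ) (χ T)) (dot-0 (χ T) λ _ → refl)) (sym (p̂-dot T))
      (dot-mono (λ _ → 0ℚ) P̂ (0≤χ T) λ i → fromℤ-mono-≤ {0ℤ} (floor-glb {P i ÷₀ scale} {0ℤ} (≤÷ (subst (ℚ._≤ P i) (sym (ℚₚ.*-zeroˡ scale)) (fromℤ-mono-≤ (0≤ i))))))))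
    (λ _ → floor-≤ (÷≤ (≤-by excess
      (0≤+ (≤⇒0≤- (rounding-upper T)) (0≤+ (≤⇒0≤- (subset-lower T⊆S))
        (0≤+ (subst (0ℚ ℚ.≤_) (profit-dot S) (fromℤ-mono-≤ 0≤p)) (0≤* (≤⇒0≤- scale≤M) (subst (0ℚ ℚ.≤_) (∣∣-dot T) (0≤fromℕ ∣ T ∣))))))
      (trans (solve 7 (λ a s t v m k u → a :* s := :- (k :* m) :+ ((s :* a :+ s :* t :- v) :+ ((v :+ (m :* k :+ (:- m) :* t) :- u) :+ (u :+ (m :- s) :* t)))) refl
          A scale (size T) (dot P (χ T)) M N (dot P (χ S)))
        (cong (λ x → x ℚ.+ excess) (sym (trans (fromℤ-neg (+ n ℤ.* pmax)) (cong ℚ.-_ fromℤ-nM))))))))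
    where
    A = fromℤ (p̂-sum T)
    excess = (scale ℚ.* A ℚ.+ scale ℚ.* size T ℚ.- dot P (χ T))
        ℚ.+ ((dot P (χ T) ℚ.+ (M ℚ.* N ℚ.+ (ℚ.- M) ℚ.* size T) ℚ.- dot P (χ S)) ℚ.+ (dot P (χ S) ℚ.+ (M ℚ.- scale) ℚ.* size T))

  -- Rounding never raises a profit. For nonnegative profits a subset earns no more than S;
  -- otherwise dropping items can gain up to n `pmax`, which the larger `zmax` absorbs.
  level-upper : ∀ {T S} → profit S ℤ.≤ UB → T ⊆ S → p̂-sum T ℤ.≤ zmax
  level-upper {T} {S} p≤UB T⊆S = if-elim (p̂-sum T ℤ.≤_) nonNegative?
    (λ 0≤ → ≤-ceiling (≤÷ (ℚₚ.≤-trans rounded (ℚₚ.≤-trans (subset-mono 0≤ T⊆S) ≤UBℚ))))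
    (λ _ → ≤-ceiling (≤÷ (ℚₚ.≤-trans rounded (ℚₚ.≤-trans (subset-upper T⊆S)
      (subst (dot P (χ S) ℚ.+ (M ℚ.* N ℚ.+ 0ℚ ℚ.* size T) ℚ.≤_)
        (sym (trans (fromℤ-+ UB (+ n ℤ.* pmax)) (cong (fromℤ UB ℚ.+_) (trans fromℤ-nM (solve 3 (λ m k t → k :* m := m :* k :+ con 0ℚ :* t) refl M N (size T))))))
        (ℚₚ.+-monoˡ-≤ _ ≤UBℚ))))))
    where
    ≤UBℚ : dot P (χ S) ℚ.≤ fromℤ UB
    ≤UBℚ = subst (ℚ._≤ fromℤ UB) (profit-dot S) (fromℤ-mono-≤ p≤UB)
    rounded : fromℤ (p̂-sum T) ℚ.* scale ℚ.≤ dot P (χ T)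
    rounded = subst (ℚ._≤ dot P (χ T)) (ℚₚ.*-comm scale (fromℤ (p̂-sum T))) (rounding-lower T)

  in-levels : ∀ S → Feasible S → 0ℤ ℤ.≤ profit S → ∀ T → T ⊆ S → InLevels (p̂-sum T)
  in-levels S feas 0≤p T T⊆S = level-lower 0≤p T⊆S , level-upper {T} {S} (≤UB S feas) T⊆S

  0≤LB : 0ℤ ℤ.≤ LB
  0≤LB = ℤₚ.<⇒≤ (ℤₚ.<-≤-trans 0<pmax pmax≤LB)

  -- The set returned by LP-Round is feasible and of positive profit, so its own state is terminal.
  -- Its empty subset puts level 0 in the window.
  output : ∃[ S ] Output S
  output = output-exists
    (subst InLevels (∑-∅ ℤₚ.+-0-isCommutativeMonoid p̂) (in-levels S₁ S₁-feasible 0≤LB ∅ Sₚ.⊥⊆))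
    (terminal-reached S₁ (in-levels S₁ S₁-feasible 0≤LB) (proj₂ S₁-feasible) (proj₁ S₁-feasible))

  approximation : ∀ {S} → Output S → ∀ opt → IsOPT opt → (1ℚ ℚ.- ε) ℚ.* fromℤ opt ℚ.≤ fromℤ (profit S)
  approximation {S} out opt ((T , T-feasible , refl) , best) = ≤-by
      -- The nonnegative terms are, in order: rounding of S, maximality of its level, rounding of T,
      -- the n - ∣T∣ items outside T at scale each, and ε times the gap between OPT and LB.
      ((fromℤ (profit S) ℚ.- scale ℚ.* A S) ℚ.+ (scale ℚ.* (A S ℚ.- A T) ℚ.+ ((scale ℚ.* A T ℚ.+ scale ℚ.* size T ℚ.- fromℤ opt)
        ℚ.+ (scale ℚ.* (N ℚ.- size T) ℚ.+ ε ℚ.* (fromℤ opt ℚ.- fromℤ LB)))))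
      (0≤+ (≤⇒0≤- (subst (scale ℚ.* A S ℚ.≤_) (sym (profit-dot S)) (rounding-lower S)))
      (0≤+ (0≤* (ℚₚ.<⇒≤ 0<scale) (≤⇒0≤- (fromℤ-mono-≤ (output-dominates out T-feasible (in-levels T T-feasible 0≤opt)))))
      (0≤+ (≤⇒0≤- (subst (ℚ._≤ scale ℚ.* A T ℚ.+ scale ℚ.* size T) (sym (profit-dot T)) (rounding-upper T)))
      (0≤+ (0≤* (ℚₚ.<⇒≤ 0<scale) (≤⇒0≤- (size≤N T))) (0≤* (ℚₚ.<⇒≤ 0<ε) (≤⇒0≤- (fromℤ-mono-≤ LB≤opt)))))))
      -- The solver identity leaves the remainder ε LB - scale n, which is 0 by `scale-N`.
      (trans (solve 9 (λ v s a a′ t o k e l → v := ((con 1ℚ :- e) :* o :+ ((v :- s :* a) :+ (s :* (a :- a′) :+ ((s :* a′ :+ s :* t :- o) :+ (s :* (k :- t) :+ e :* (o :- l)))))) :+ (e :* l :- s :* k)) refl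
          (fromℤ (profit S)) scale (A S) (A T) (size T) (fromℤ opt) N ε (fromℤ LB))
        (trans (cong (λ u → total ℚ.+ (ε ℚ.* fromℤ LB ℚ.- u)) scale-N) (trans (cong (total ℚ.+_) (ℚₚ.+-inverseʳ (ε ℚ.* fromℤ LB))) (ℚₚ.+-identityʳ total))))
    where
    A : Subset n → ℚ
    A T = fromℤ (p̂-sum T)
    LB≤opt : LB ℤ.≤ opt
    LB≤opt = best S₁ S₁-feasible
    0≤opt : 0ℤ ℤ.≤ opt
    0≤opt = ℤₚ.≤-trans 0≤LB LB≤opt
    total = (1ℚ ℚ.- ε) ℚ.* fromℤ opt ℚ.+ ((fromℤ (profit S) ℚ.- scale ℚ.* A S) ℚ.+ (scale ℚ.* (A S ℚ.- A T) ℚ.+ ((scale ℚ.* A T ℚ.+ scale ℚ.* size T ℚ.- fromℤ opt)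
        ℚ.+ (scale ℚ.* (N ℚ.- size T) ℚ.+ ε ℚ.* (fromℤ opt ℚ.- fromℤ LB)))))

proposition6p2 : ∀ {n m : ℕ} (I : Instance n m) →
    (∀ i → Instance.w I i ℕ.≤ Instance.b I) →
    (∀ i → (ℤ.- Solutions.pmax I) ℤ.< Instance.p I i × Instance.p I i ℤ.≤ Solutions.pmax I) →
    0ℤ ℤ.< Solutions.pmax I →
    (ε : ℚ) → 0ℚ ℚ.< ε → ε ℚ.< 1ℚ →
    (∃[ S ] F2 I ε S)
    × (∀ S → F2 I ε S →
    Solutions.Feasible I S
    × (∀ opt → Solutions.IsOPT I opt →
    (1ℚ ℚ.- ε) ℚ.* fromℤ opt ℚ.≤ fromℤ (Solutions.profit I S)))
proposition6p2 I w≤b p-range 0<pmax ε 0<ε ε<1 = existence , λ S run →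
    DPCompleteness.output-feasible I ε _ (F2.output run)
  , Approximation.approximation I w≤b p-range 0<pmax ε 0<ε ε<1 (F2.lpRound run) (F2.output run)
  where
  existence : ∃[ S ] F2 I ε S
  existence =
    let r , r-max = argmax (Instance.p I) 0<pmax
        S₁ , lpRound = LPRounding.lpRound-exists I w≤b (proj₂ ∘ p-range) 0<pmax r-max
        S , output = Approximation.output I w≤b p-range 0<pmax ε 0<ε ε<1 lpRound in
    S , record { S₁ = S₁ ; lpRound = lpRound ; output = output }
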